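{- Let $q$ be a prime power, $k=\mathbb{F}_q$, $n\ge 1$ an integer, and $\lambda$ a nontrivial additive character of $k$. Let $U\in \mathrm{M}_n(k)$ be a nonzero matrix and let $u$ be the rank of $U$. Then $$G_{\mathrm{SL}_n(k)}(U,\lambda)=\begin{cases} q^{\binom{n}{2}}K_n(\lambda,\det U) & \text{if } u=n,\\[4pt] (-1)^u q^{\binom{n}{2}}\displaystyle\prod_{i=2}^{n-u}(q^i-1) & \text{if } u<n.\end{cases}$$
   Context: $\mathrm{M}_n(k)$ is the set of $n\times n$ matrices over $k$. For $U=(u_{ij}),V=(v_{ij})\in \mathrm{M}_n(k)$, put $U\cdot V=\sum_{1\le i,j\le n}u_{ij}v_{ij}\in k$ (entrywise product summed, not matrix multiplication). An additive character is a homomorphism $(k,+)\to\mathbb{C}^*$. Define $$G_{\mathrm{SL}_n(k)}(U,\lambda)=\sum_{X\in \mathrm{SL}_n(k)}\lambda(U\cdot X),$$ and, for $y\in k^*$, the Kloosterman sum $$K_n(\lambda,y)=\sum_{\substack{x_1,\dots,x_n\in k\\ x_1x_2\cdots x_n=y}}\lambda(x_1+x_2+\cdots+x_n).$$ Empty products equal $1$. -}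

module Defs where

open import Algebra.Bundles using (AbelianGroup; CommutativeRing; Ring; Semiring)
open import Algebra.Structures using (IsCommutativeRing)
import Algebra.Definitions.RawSemiring
import Algebra.Properties.CommutativeSemigroup
import Algebra.Properties.Ring
import Algebra.Solver.Ring.NaturalCoefficients.Default as SemiringSolver
open import Algebra.Morphism.Bundles using (GroupHomomorphism)
open import Data.Fin.Base using (Fin; zero; suc; toℕ)
import Data.Fin.Properties as Fin
open import Data.List.Base as List using (List; []; _∷_; cartesianProductWith)
open import Data.Nat.Base as ℕ using (ℕ; zero; suc; _∸_)
import Data.Nat.Primality as ℕ
import Data.Nat.Properties as ℕ
open import Data.Product.Base using (∃; ∃₂; _×_; _,_; proj₁; proj₂)
import Data.Rational.Base
open import Data.Rational.Base as ℚ using (ℚ; 0ℚ; 1ℚ; ½; ∣_∣; positive)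
import Data.Rational.Properties as ℚ
import Data.Rational.Solver
open import Data.Vec.Functional as Vector using (Vector; removeAt)
open import Function.Base using (flip; _$_)
open import Function.Bundles using (Inverse)
open import Function.Properties.Inverse using (Inverse⇒Injection) renaming (sym to ↔-sym)
open import Level as Level using (0ℓ)
open import Relation.Binary.Definitions using (Decidable)
open import Relation.Binary.PropositionalEquality as ≡ using (_≡_; refl; cong; subst)
open import Relation.Nullary.Decidable using (via-injection)
open import Relation.Nullary.Negation using (¬_)
open import Relation.Unary using (Pred)

------------------------------------------------------------------------
-- The real numbers, as Cauchy sequences of rationals up to null sequences

module Real where

  open Data.Rational.Base using (_+_; _*_; _-_; -_; _<_; _≤_)
  open Data.Rational.Solver.+-*-Solver

  Cauchy : (ℕ → ℚ) → Set
  Cauchy x = ∀ ε → 0ℚ < ε → ∃ λ N → ∀ m n → N ℕ.≤ m → N ℕ.≤ n → ∣ x m - x n ∣ < ε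

  Null : (ℕ → ℚ) → Set
  Null x = ∀ ε → 0ℚ < ε → ∃ λ N → ∀ n → N ℕ.≤ n → ∣ x n ∣ < ε

  record ℝ : Set where
    constructor _,_
    field
      seq    : ℕ → ℚ
      cauchy : Cauchy seq
  open ℝ public

  -- A record rather than a bare Π-type, so that x and y can be inferred.
  infix 4 _≈_
  record _≈_ (x y : ℝ) : Set where
    constructor mk≈
    field null : Null (λ n → seq x n - seq y n)
  open _≈_ public

  -- `Cauchy` and `Null` are the instances d m n = x m - x n and d m n = x n
  -- of the vanishing of a double sequence.
  Small : (ℕ → ℕ → ℚ) → Set
  Small d = ∀ ε → 0ℚ < ε → ∃ λ N → ∀ m n → N ℕ.≤ m → N ℕ.≤ n → ∣ d m n ∣ < ε

  Bounded : (ℕ → ℕ → ℚ) → Set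
  Bounded d = ∃ λ B → 0ℚ < B × ∃ λ N → ∀ m n → N ℕ.≤ m → N ℕ.≤ n → ∣ d m n ∣ ≤ B

  small⇒null : ∀ {x} → Small (λ _ n → x n) → Null x
  small⇒null s ε ε>0 = let N , p = s ε ε>0 in N , λ n → p N n ℕ.≤-refl

  null⇒small : ∀ {x} → Null x → Small (λ _ n → x n)
  null⇒small s ε ε>0 = let N , p = s ε ε>0 in N , λ _ n _ → p n

  small-resp : ∀ {d e} → (∀ m n → d m n ≡ e m n) → Small d → Small e
  small-resp d≡e s ε ε>0 = let N , p = s ε ε>0 in
    N , λ m n N≤m N≤n → subst (λ z → ∣ z ∣ < ε) (d≡e m n) (p m n N≤m N≤n)

  small-0 : Small (λ _ _ → 0ℚ)
  small-0 ε ε>0 = 0 , λ _ _ _ _ → ε>0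

  small-neg : ∀ {d} → Small d → Small (λ m n → - d m n)
  small-neg {d} s ε ε>0 = let N , p = s ε ε>0 in
    N , λ m n N≤m N≤n → subst (_< ε) (≡.sym (ℚ.∣-p∣≡∣p∣ (d m n))) (p m n N≤m N≤n)

  half>0 : ∀ {ε} → 0ℚ < ε → 0ℚ < ε * ½
  half>0 {ε} ε>0 = ℚ.positive⁻¹ _ {{ℚ.pos*pos⇒pos ε {{positive ε>0}} ½}}

  half+half : ∀ ε → ε * ½ + ε * ½ ≡ ε
  half+half ε = ≡.trans (≡.sym (ℚ.*-distribˡ-+ ε ½ ½)) (ℚ.*-identityʳ ε)

  small-+ : ∀ {d e} → Small d → Small e → Small (λ m n → d m n + e m n)
  small-+ {d} {e} s t ε ε>0 =
    let N , p = s (ε * ½) (half>0 ε>0)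
        M , q = t (ε * ½) (half>0 ε>0)
    in N ℕ.⊔ M , λ m n ≤m ≤n → begin-strict
      ∣ d m n + e m n ∣      ≤⟨ ℚ.∣p+q∣≤∣p∣+∣q∣ (d m n) (e m n) ⟩
      ∣ d m n ∣ + ∣ e m n ∣  <⟨ ℚ.+-mono-<
                                  (p m n (ℕ.m⊔n≤o⇒m≤o N M ≤m) (ℕ.m⊔n≤o⇒m≤o N M ≤n))
                                  (q m n (ℕ.m⊔n≤o⇒n≤o N M ≤m) (ℕ.m⊔n≤o⇒n≤o N M ≤n)) ⟩
      ε * ½ + ε * ½          ≡⟨ half+half ε ⟩
      ε                      ∎
    where open ℚ.≤-Reasoning

  small-* : ∀ {b d} → Bounded b → Small d → Small (λ m n → b m n * d m n)
  small-* {b} {d} (B , B>0 , M , p) s ε ε>0 = M ℕ.⊔ N , λ m n ≤m ≤n → begin-strict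
      ∣ b m n * d m n ∣      ≡⟨ ℚ.∣p*q∣≡∣p∣*∣q∣ (b m n) (d m n) ⟩
      ∣ b m n ∣ * ∣ d m n ∣  ≤⟨ ℚ.*-monoʳ-≤-nonNeg ∣ d m n ∣ {{ℚ.∣-∣-nonNeg (d m n)}}
                                  (p m n (ℕ.m⊔n≤o⇒m≤o M N ≤m) (ℕ.m⊔n≤o⇒m≤o M N ≤n)) ⟩
      B * ∣ d m n ∣          <⟨ ℚ.*-monoʳ-<-pos B
                                  (q m n (ℕ.m⊔n≤o⇒n≤o M N ≤m) (ℕ.m⊔n≤o⇒n≤o M N ≤n)) ⟩
      B * (B⁻¹ * ε)          ≡⟨ ℚ.*-assoc B B⁻¹ ε ⟨
      B * B⁻¹ * ε            ≡⟨ cong (_* ε) (ℚ.*-inverseʳ B) ⟩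
      1ℚ * ε                 ≡⟨ ℚ.*-identityˡ ε ⟩
      ε                      ∎
    where
    open ℚ.≤-Reasoning
    instance
      B-pos : ℚ.Positive B
      B-pos = positive B>0
      B-nonZero : ℚ.NonZero B
      B-nonZero = ℚ.pos⇒nonZero B
    B⁻¹ : ℚ
    B⁻¹ = ℚ.1/ B
    B⁻¹ε>0 : 0ℚ < B⁻¹ * ε
    B⁻¹ε>0 = ℚ.positive⁻¹ _
      {{ℚ.pos*pos⇒pos B⁻¹ {{ℚ.1/pos⇒pos B}} ε {{positive ε>0}}}}
    N = proj₁ (s (B⁻¹ * ε) B⁻¹ε>0)
    q = proj₂ (s (B⁻¹ * ε) B⁻¹ε>0)

  cauchy⇒bounded : ∀ {x} → Cauchy x →
                   ∃ λ B → 0ℚ < B × ∃ λ N → ∀ n → N ℕ.≤ n → ∣ x n ∣ ≤ B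
  cauchy⇒bounded {x} c = 1ℚ + ∣ x N ∣ , B>0 , N , λ n N≤n → begin
      ∣ x n ∣                  ≡⟨ cong ∣_∣ (solve 2 (λ a b → a := (a :- b) :+ b) refl (x n) (x N)) ⟩
      ∣ (x n - x N) + x N ∣    ≤⟨ ℚ.∣p+q∣≤∣p∣+∣q∣ (x n - x N) (x N) ⟩
      ∣ x n - x N ∣ + ∣ x N ∣  ≤⟨ ℚ.+-monoˡ-≤ ∣ x N ∣ (ℚ.<⇒≤ (p n N N≤n ℕ.≤-refl)) ⟩
      1ℚ + ∣ x N ∣             ∎
    where
    open ℚ.≤-Reasoning
    1>0 : 0ℚ < 1ℚ
    1>0 = ℚ.positive⁻¹ 1ℚ
    N = proj₁ (c 1ℚ 1>0)
    p = proj₂ (c 1ℚ 1>0)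
    B>0 : 0ℚ < 1ℚ + ∣ x N ∣
    B>0 = ℚ.+-mono-<-≤ 1>0 (ℚ.0≤∣p∣ (x N))

  boundedˡ : ∀ x → Bounded (λ m _ → seq x m)
  boundedˡ x = let B , B>0 , N , p = cauchy⇒bounded (cauchy x) in
    B , B>0 , N , λ m _ N≤m _ → p m N≤m

  boundedʳ : ∀ x → Bounded (λ _ n → seq x n)
  boundedʳ x = let B , B>0 , N , p = cauchy⇒bounded (cauchy x) in
    B , B>0 , N , λ _ n _ → p n

  infixl 6 _+ᴿ_
  infixl 7 _*ᴿ_
  infix  8 -ᴿ_

  -- Abstract, so that comparing two reals does not unfold these proofs.
  abstract
    const-cauchy : ∀ p → Cauchy (λ _ → p)
    const-cauchy p = small-resp (λ _ _ → ≡.sym (ℚ.+-inverseʳ p)) small-0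

    +-cauchy : ∀ x y → Cauchy (λ n → seq x n + seq y n)
    +-cauchy x y = small-resp
      (λ m n → solve 4 (λ a b c d → (a :- b) :+ (c :- d) := (a :+ c) :- (b :+ d)) refl
                 (seq x m) (seq x n) (seq y m) (seq y n))
      (small-+ (cauchy x) (cauchy y))

    -‿cauchy : ∀ x → Cauchy (λ n → - seq x n)
    -‿cauchy x = small-resp
      (λ m n → solve 2 (λ a b → :- (a :- b) := (:- a) :- (:- b)) refl (seq x m) (seq x n))
      (small-neg (cauchy x))

    *-cauchy : ∀ x y → Cauchy (λ n → seq x n * seq y n)
    *-cauchy x y = small-resp
      (λ m n → solve 4 (λ a b c d → a :* (c :- d) :+ d :* (a :- b) := a :* c :- b :* d) refl
                 (seq x m) (seq x n) (seq y m) (seq y n))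
      (small-+ (small-* (boundedˡ x) (cauchy y)) (small-* (boundedʳ y) (cauchy x)))

  fromℚ : ℚ → ℝ
  fromℚ p = (λ _ → p) , const-cauchy p

  _+ᴿ_ : ℝ → ℝ → ℝ
  x +ᴿ y = (λ n → seq x n + seq y n) , +-cauchy x y

  -ᴿ_ : ℝ → ℝ
  -ᴿ x = (λ n → - seq x n) , -‿cauchy x

  _*ᴿ_ : ℝ → ℝ → ℝ
  x *ᴿ y = (λ n → seq x n * seq y n) , *-cauchy x y

  pointwise : ∀ {x y} → (∀ n → seq x n ≡ seq y n) → x ≈ y
  pointwise {x} {y} x≡y = mk≈ $ small⇒null $ small-resp
    (λ _ n → ≡.trans (≡.sym (ℚ.+-inverseʳ (seq y n))) (cong (_- seq y n) (≡.sym (x≡y n))))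
    small-0

  ≈-sym : ∀ {x y} → x ≈ y → y ≈ x
  ≈-sym {x} {y} (mk≈ p) = mk≈ $ small⇒null $ small-resp
    (λ _ n → solve 2 (λ a b → :- (a :- b) := b :- a) refl (seq x n) (seq y n))
    (small-neg (null⇒small p))

  ≈-trans : ∀ {x y z} → x ≈ y → y ≈ z → x ≈ z
  ≈-trans {x} {y} {z} (mk≈ p) (mk≈ q) = mk≈ $ small⇒null $ small-resp
    (λ _ n → solve 3 (λ a b c → (a :- b) :+ (b :- c) := a :- c) refl (seq x n) (seq y n) (seq z n))
    (small-+ (null⇒small p) (null⇒small q))

  +-cong : ∀ {x y u v} → x ≈ y → u ≈ v → x +ᴿ u ≈ y +ᴿ v
  +-cong {x} {y} {u} {v} (mk≈ p) (mk≈ q) = mk≈ $ small⇒null $ small-resp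
    (λ _ n → solve 4 (λ a b c d → (a :- b) :+ (c :- d) := (a :+ c) :- (b :+ d)) refl
               (seq x n) (seq y n) (seq u n) (seq v n))
    (small-+ (null⇒small p) (null⇒small q))

  -‿cong : ∀ {x y} → x ≈ y → -ᴿ x ≈ -ᴿ y
  -‿cong {x} {y} (mk≈ p) = mk≈ $ small⇒null $ small-resp
    (λ _ n → solve 2 (λ a b → :- (a :- b) := (:- a) :- (:- b)) refl (seq x n) (seq y n))
    (small-neg (null⇒small p))

  *-cong : ∀ {x y u v} → x ≈ y → u ≈ v → x *ᴿ u ≈ y *ᴿ v
  *-cong {x} {y} {u} {v} (mk≈ p) (mk≈ q) = mk≈ $ small⇒null $ small-resp
    (λ _ n → solve 4 (λ a b c d → a :* (c :- d) :+ d :* (a :- b) := a :* c :- b :* d) refl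
               (seq x n) (seq y n) (seq u n) (seq v n))
    (small-+ (small-* (boundedʳ x) (null⇒small q)) (small-* (boundedʳ v) (null⇒small p)))

  isCommutativeRing : IsCommutativeRing _≈_ _+ᴿ_ _*ᴿ_ -ᴿ_ (fromℚ 0ℚ) (fromℚ 1ℚ)
  isCommutativeRing = record
    { isRing = record
      { +-isAbelianGroup = record
        { isGroup = record
          { isMonoid = record
            { isSemigroup = record
              { isMagma = record
                { isEquivalence = record
                  { refl = pointwise λ _ → refl ; sym = ≈-sym ; trans = ≈-trans }
                ; ∙-cong = +-cong
                }
              ; assoc = λ x y z → pointwise λ n → ℚ.+-assoc (seq x n) (seq y n) (seq z n)
              }
            ; identity = (λ x → pointwise λ n → ℚ.+-identityˡ (seq x n))
                       , (λ x → pointwise λ n → ℚ.+-identityʳ (seq x n))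
            }
          ; inverse = (λ x → pointwise λ n → ℚ.+-inverseˡ (seq x n))
                    , (λ x → pointwise λ n → ℚ.+-inverseʳ (seq x n))
          ; ⁻¹-cong = -‿cong
          }
        ; comm = λ x y → pointwise λ n → ℚ.+-comm (seq x n) (seq y n)
        }
      ; *-cong = *-cong
      ; *-assoc = λ x y z → pointwise λ n → ℚ.*-assoc (seq x n) (seq y n) (seq z n)
      ; *-identity = (λ x → pointwise λ n → ℚ.*-identityˡ (seq x n))
                   , (λ x → pointwise λ n → ℚ.*-identityʳ (seq x n))
      ; distrib = (λ x y z → pointwise λ n → ℚ.*-distribˡ-+ (seq x n) (seq y n) (seq z n))
                , (λ x y z → pointwise λ n → ℚ.*-distribʳ-+ (seq x n) (seq y n) (seq z n))
      }
    ; *-comm = λ x y → pointwise λ n → ℚ.*-comm (seq x n) (seq y n)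
    }

ℝ-ring : CommutativeRing 0ℓ 0ℓ
ℝ-ring = record { isCommutativeRing = Real.isCommutativeRing }

------------------------------------------------------------------------
-- Adjoining a square root of -1

module Complexification {c ℓ} (R : CommutativeRing c ℓ) where

  private module R = CommutativeRing R
  open R using (_+_; _*_; -_; 0#; 1#)
  open Algebra.Properties.Ring R.ring using (-0#≈0#; -1*x≈-x)
  open SemiringSolver R.commutativeSemiring using (solve; _:+_; _:*_; _:=_)

  infix 6 _+i_
  record Carrier : Set c where
    constructor _+i_
    field
      re im : R.Carrier
  open Carrier public

  infix 4 _≈_
  record _≈_ (z w : Carrier) : Set ℓ where
    constructor mk≈
    field
      re≈ : re z R.≈ re w
      im≈ : im z R.≈ im w
  open _≈_ public

  _+ᶜ_ _*ᶜ_ : Carrier → Carrier → Carrier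
  (a +i b) +ᶜ (c +i d) = (a + c) +i (b + d)
  (a +i b) *ᶜ (c +i d) = (a * c + - (b * d)) +i (a * d + b * c)

  -ᶜ_ : Carrier → Carrier
  -ᶜ (a +i b) = (- a) +i (- b)

  isCommutativeRing : IsCommutativeRing _≈_ _+ᶜ_ _*ᶜ_ -ᶜ_ (0# +i 0#) (1# +i 0#)
  isCommutativeRing = record
    { isRing = record
      { +-isAbelianGroup = record
        { isGroup = record
          { isMonoid = record
            { isSemigroup = record
              { isMagma = record
                { isEquivalence = record
                  { refl = mk≈ R.refl R.refl
                  ; sym = λ (mk≈ p q) → mk≈ (R.sym p) (R.sym q)
                  ; trans = λ (mk≈ p q) (mk≈ r s) → mk≈ (R.trans p r) (R.trans q s)
                  }
                ; ∙-cong = λ (mk≈ p q) (mk≈ r s) → mk≈ (R.+-cong p r) (R.+-cong q s)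
                }
              ; assoc = λ _ _ _ → mk≈ (R.+-assoc _ _ _) (R.+-assoc _ _ _)
              }
            ; identity = (λ _ → mk≈ (R.+-identityˡ _) (R.+-identityˡ _))
                       , (λ _ → mk≈ (R.+-identityʳ _) (R.+-identityʳ _))
            }
          ; inverse = (λ _ → mk≈ (R.-‿inverseˡ _) (R.-‿inverseˡ _))
                    , (λ _ → mk≈ (R.-‿inverseʳ _) (R.-‿inverseʳ _))
          ; ⁻¹-cong = λ (mk≈ p q) → mk≈ (R.-‿cong p) (R.-‿cong q)
          }
        ; comm = λ _ _ → mk≈ (R.+-comm _ _) (R.+-comm _ _)
        }
      ; *-cong = *-cong
      ; *-assoc = *-assoc
      ; *-identity = *-identityˡ , λ z → trans (*-comm z _) (*-identityˡ z)
      ; distrib = distribˡ , λ z w v → trans (*-comm _ z)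
          (trans (distribˡ z w v) (mk≈ (R.+-cong (re≈ (*-comm z w)) (re≈ (*-comm z v)))
                                       (R.+-cong (im≈ (*-comm z w)) (im≈ (*-comm z v)))))
      }
    ; *-comm = *-comm
    }
    where
    trans : ∀ {z w v} → z ≈ w → w ≈ v → z ≈ v
    trans (mk≈ p q) (mk≈ r s) = mk≈ (R.trans p r) (R.trans q s)

    *-cong : ∀ {z z′ w w′} → z ≈ z′ → w ≈ w′ → (z *ᶜ w) ≈ (z′ *ᶜ w′)
    *-cong (mk≈ p q) (mk≈ r s) = mk≈
      (R.+-cong (R.*-cong p r) (R.-‿cong (R.*-cong q s)))
      (R.+-cong (R.*-cong p s) (R.*-cong q r))

    *-comm : ∀ z w → (z *ᶜ w) ≈ (w *ᶜ z)
    *-comm (a +i b) (c +i d) = mk≈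
      (R.+-cong (R.*-comm a c) (R.-‿cong (R.*-comm b d)))
      (R.trans (R.+-comm _ _) (R.+-cong (R.*-comm b c) (R.*-comm a d)))

    *-identityˡ : ∀ z → ((1# +i 0#) *ᶜ z) ≈ z
    *-identityˡ (a +i b) = mk≈
      (R.trans (R.+-cong (R.*-identityˡ a) (R.trans (R.-‿cong (R.zeroˡ b)) -0#≈0#)) (R.+-identityʳ a))
      (R.trans (R.+-cong (R.*-identityˡ b) (R.zeroˡ a)) (R.+-identityʳ b))

    -- With each - x written as j * x for j = - 1#, the remaining laws are
    -- semiring identities.
    j : R.Carrier
    j = - 1#

    neg : ∀ {x} → - x R.≈ j * x
    neg {x} = R.sym (-1*x≈-x x)

    *-assoc : ∀ z w v → ((z *ᶜ w) *ᶜ v) ≈ (z *ᶜ (w *ᶜ v))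
    *-assoc (a +i b) (c +i d) (e +i f) = mk≈
      (R.trans (R.+-cong (R.*-congʳ (R.+-congˡ neg)) neg)
        (R.trans
          (solve 7 (λ j a b c d e f →
            (a :* c :+ j :* (b :* d)) :* e :+ j :* ((a :* d :+ b :* c) :* f) :=
            a :* (c :* e :+ j :* (d :* f)) :+ j :* (b :* (c :* f :+ d :* e)))
            R.refl j a b c d e f)
          (R.sym (R.+-cong (R.*-congˡ (R.+-congˡ neg)) neg))))
      (R.trans (R.+-congʳ (R.*-congʳ (R.+-congˡ neg)))
        (R.trans
          (solve 7 (λ j a b c d e f →
            (a :* c :+ j :* (b :* d)) :* f :+ (a :* d :+ b :* c) :* e :=
            a :* (c :* f :+ d :* e) :+ b :* (c :* e :+ j :* (d :* f)))
            R.refl j a b c d e f)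
          (R.sym (R.+-congˡ (R.*-congˡ (R.+-congˡ neg))))))

    distribˡ : ∀ z w v → (z *ᶜ (w +ᶜ v)) ≈ ((z *ᶜ w) +ᶜ (z *ᶜ v))
    distribˡ (a +i b) (c +i d) (e +i f) = mk≈
      (R.trans (R.+-congˡ neg)
        (R.trans
          (solve 7 (λ j a b c d e f →
            a :* (c :+ e) :+ j :* (b :* (d :+ f)) :=
            (a :* c :+ j :* (b :* d)) :+ (a :* e :+ j :* (b :* f)))
            R.refl j a b c d e f)
          (R.sym (R.+-cong (R.+-congˡ neg) (R.+-congˡ neg)))))
      (solve 6 (λ a b c d e f →
        a :* (d :+ f) :+ b :* (c :+ e) := (a :* d :+ b :* c) :+ (a :* f :+ b :* e))
        R.refl a b c d e f)

ℂ-ring : CommutativeRing 0ℓ 0ℓ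
ℂ-ring = record { isCommutativeRing = Complexification.isCommutativeRing ℝ-ring }

module ℂ where
  open CommutativeRing ℂ-ring public
  open Algebra.Definitions.RawSemiring (Semiring.rawSemiring semiring) public using (_^_; product)
    renaming (_×_ to _·_)

  fromℕ : ℕ → Carrier
  fromℕ m = m · 1#

  ∑ : ∀ {a} {A : Set a} → List A → (A → Carrier) → Carrier
  ∑ xs f = List.foldr (λ x s → f x + s) 0# xs

  -- ∏[ a ⋯ b ] f is the product of f i over a ≤ i ≤ b, so it is 1# when b < a.
  ∏[_⋯_] : ℕ → ℕ → (ℕ → Carrier) → Carrier
  ∏[ a ⋯ b ] f = product {suc b ∸ a} (λ i → f (a ℕ.+ toℕ i))

------------------------------------------------------------------------
-- The group of units of a commutative ring

module UnitGroup {c ℓ} (R : CommutativeRing c ℓ) where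

  open CommutativeRing R
  open Algebra.Properties.CommutativeSemigroup *-commutativeSemigroup using (interchange)

  record Unit : Set (c Level.⊔ ℓ) where
    field
      value    : Carrier
      inverse  : Carrier
      value*inverse : value * inverse ≈ 1#
  open Unit public

  1ᵁ : Unit
  1ᵁ = record { value = 1# ; inverse = 1# ; value*inverse = *-identityˡ 1# }

  _*ᵁ_ : Unit → Unit → Unit
  u *ᵁ v = record
    { value   = value u * value v
    ; inverse = inverse u * inverse v
    ; value*inverse = trans
        (interchange (value u) (value v) (inverse u) (inverse v))
        (trans (*-cong (value*inverse u) (value*inverse v)) (*-identityˡ 1#))
    }

  _⁻¹ : Unit → Unit
  u ⁻¹ = record
    { value = inverse u ; inverse = value u
    ; value*inverse = trans (*-comm _ _) (value*inverse u) }

  inverse-cong : ∀ u v → value u ≈ value v → inverse u ≈ inverse v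
  inverse-cong u v u≈v =
    trans (sym (*-identityʳ _)) $
    trans (*-congˡ (sym (value*inverse v))) $
    trans (sym (*-assoc _ _ _)) $
    trans (*-congʳ (trans (*-congˡ (sym u≈v)) (trans (*-comm _ _) (value*inverse u)))) $
    *-identityˡ _

  unitGroup : AbelianGroup (c Level.⊔ ℓ) ℓ
  unitGroup = record
    { Carrier = Unit
    ; _≈_ = λ u v → value u ≈ value v
    ; _∙_ = _*ᵁ_
    ; ε = 1ᵁ
    ; _⁻¹ = _⁻¹
    ; isAbelianGroup = record
      { isGroup = record
        { isMonoid = record
          { isSemigroup = record
            { isMagma = record
              { isEquivalence = record
                { refl = CommutativeRing.refl R ; sym = sym ; trans = trans }
              ; ∙-cong = *-cong
              }
            ; assoc = λ _ _ _ → *-assoc _ _ _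
            }
          ; identity = (λ _ → *-identityˡ _) , (λ _ → *-identityʳ _)
          }
        ; inverse = (λ u → trans (*-comm _ _) (value*inverse u)) , value*inverse
        ; ⁻¹-cong = λ {u} {v} → inverse-cong u v
        }
      ; comm = λ _ _ → *-comm _ _
      }
    }

module ℂˣ = UnitGroup ℂ-ring

------------------------------------------------------------------------
-- Matrices over a commutative ring

module LinearAlgebra {c ℓ} (R : CommutativeRing c ℓ) where

  open CommutativeRing R hiding (zero) renaming (Carrier to K)
  open Algebra.Definitions.RawSemiring (Semiring.rawSemiring semiring) using (_^_; sum)

  Matrix : ℕ → ℕ → Set c
  Matrix m n = Vector (Vector K n) m

  -- Laplace expansion along the first row.
  det : ∀ {n} → Matrix n n → K
  det {zero}  A = 1#
  det {suc n} A = sum λ j →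
    (- 1#) ^ toℕ j * A zero j * det (λ i → removeAt (A (suc i)) j)

  -- The entrywise product, summed.
  infixl 7 _∙_
  _∙_ : ∀ {m n} → Matrix m n → Matrix m n → K
  U ∙ V = sum λ i → sum λ j → U i j * V i j

  combination : ∀ {m n} → Vector K m → Vector (Vector K n) m → Vector K n
  combination a v i = sum λ j → a j * v j i

  LinearlyIndependent : ∀ {m n} → Vector (Vector K n) m → Set (c Level.⊔ ℓ)
  LinearlyIndependent v = ∀ a → (∀ i → combination a v i ≈ 0#) → ∀ j → a j ≈ 0#

  Span : ∀ {m n} → Vector (Vector K n) m → Pred (Vector K n) (c Level.⊔ ℓ)
  Span v w = ∃ λ a → ∀ i → w i ≈ combination a v i

  HasDimension : ∀ {p n} → Pred (Vector K n) p → ℕ → Set (c Level.⊔ ℓ Level.⊔ p)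
  HasDimension {n = n} V d = ∃ λ (b : Vector (Vector K n) d) →
    (∀ j → V (b j)) × LinearlyIndependent b × (∀ w → V w → Span b w)

  -- The rank is the dimension of the column space; flip U lists the columns of U.
  HasRank : ∀ {m n} → Matrix m n → ℕ → Set (c Level.⊔ ℓ)
  HasRank U = HasDimension (Span (flip U))

------------------------------------------------------------------------
-- Finite fields

IsPrimePower : ℕ → Set
IsPrimePower q = ∃₂ λ p r → ℕ.Prime p × 1 ℕ.≤ r × q ≡ p ℕ.^ r

record FiniteField c ℓ (q : ℕ) : Set (Level.suc (c Level.⊔ ℓ)) where
  field
    commutativeRing : CommutativeRing c ℓ
  open CommutativeRing commutativeRing public
  field
    0≉1         : ¬ 0# ≈ 1#
    inverse     : ∀ x → ¬ x ≈ 0# → ∃ λ y → x * y ≈ 1#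
    enumeration : Inverse (≡.setoid (Fin q)) setoid

  -- Each ≈-class is listed exactly once.
  elements : List Carrier
  elements = List.tabulate (Inverse.to enumeration)

  infix 4 _≟_
  _≟_ : Decidable _≈_
  _≟_ = via-injection (Inverse⇒Injection (↔-sym enumeration)) Fin._≟_

-- All n-tuples with entries taken from xs.
tuples : ∀ {a} {A : Set a} → List A → (n : ℕ) → List (Vector A n)
tuples xs zero    = Vector.[] ∷ []
tuples xs (suc n) = cartesianProductWith Vector._∷_ xs (tuples xs n)

------------------------------------------------------------------------
-- Character sums

module CharacterSums {c ℓ q} (k : FiniteField c ℓ q) where

  private open module k = FiniteField k using (Carrier; commutativeRing; 1#; _≟_; elements)
  open FiniteField k public using (_≈_; 0#)
  open Algebra.Definitions.RawSemiring (Semiring.rawSemiring k.semiring) using (sum; product)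
  open LinearAlgebra commutativeRing public

  AdditiveCharacter : Set (c Level.⊔ ℓ)
  AdditiveCharacter =
    GroupHomomorphism (Ring.+-rawGroup k.ring) (AbelianGroup.rawGroup ℂˣ.unitGroup)

  infix 9 _⟨_⟩
  _⟨_⟩ : AdditiveCharacter → Carrier → ℂ.Carrier
  χ ⟨ x ⟩ = ℂˣ.value (GroupHomomorphism.⟦_⟧ χ x)

  Nontrivial : AdditiveCharacter → Set c
  Nontrivial χ = ¬ (∀ x → χ ⟨ x ⟩ ℂ.≈ ℂ.1#)

  SL : (n : ℕ) → List (Matrix n n)
  SL n = List.filter (λ X → det X ≟ 1#) (tuples (tuples elements n) n)

  G-SL : ∀ n → Matrix n n → AdditiveCharacter → ℂ.Carrier
  G-SL n U χ = ℂ.∑ (SL n) λ X → χ ⟨ U ∙ X ⟩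

  -- Only meaningful, as a Kloosterman sum, for y ≉ 0#.
  Kloosterman : ∀ n → AdditiveCharacter → Carrier → ℂ.Carrier
  Kloosterman n χ y =
    ℂ.∑ (List.filter (λ x → product x ≟ y) (tuples elements n)) λ x → χ ⟨ sum x ⟩

{-# OPTIONS --safe #-}

-- Fix the first row x of X and let U₀ be the first row of U, U′ the remaining
-- rows.  Column operations of determinant 1 bring x ≠ 0 to (s, 0, …, 0); they
-- turn X into a matrix with a free first column below s, and summing over that
-- column leaves 0 unless U′ x = 0, when it leaves q ^ (n - 1) λ(U₀ ∙ x) times the
-- sum of size n - 1 for a minor M of the matrix obtained from U by the adjoint
-- operations.  Here q · #ker M = #ker U′ and det U · s = (U₀ ∙ x) · det M.
-- Summing over x ∈ ker U′:
--   * if ker U = 0, then U₀ ∙ x runs over k and the result is the recursion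
--     K_n(λ, y) = ∑_{t ≠ 0} λ(t) K_{n-1}(λ, y / t) of Kloosterman sums;
--   * if ker U ≠ 0 and U₀ does not vanish on ker U′, then
--     ∑_{x ≠ 0} λ(U₀ ∙ x) = -1 and M has the nullity of U;
--   * if U₀ vanishes on ker U′, then there are #ker U - 1 summands and M has
--     one less nullity than U; when M is nonsingular, the sum of K_{n-1} over
--     k* appears, which is (-1) ^ (n - 1).
-- For the induction the determinant of X is any y ≠ 0.

module Submission where

open import Defs

open import Algebra.Bundles using (CommutativeRing; CommutativeSemiring; Semiring)
import Algebra.Definitions.RawSemiring
open import Algebra.Morphism.Bundles using (GroupHomomorphism)
import Algebra.Properties.CommutativeSemigroup as CommutativeSemigroupProperties
import Algebra.Properties.Group as GroupProperties
import Algebra.Properties.Monoid.Sum as MonoidSum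
import Algebra.Properties.Ring as RingProperties
import Algebra.Properties.Semiring.Exp as SemiringExp
import Algebra.Properties.Semiring.Mult as SemiringMult
import Algebra.Properties.Semiring.Sum as SemiringSum
import Algebra.Solver.Ring.NaturalCoefficients.Default as SemiringSolver
open import Data.Bool.Base using (if_then_else_)
open import Data.Fin.Base using (Fin; zero; suc; toℕ)
import Data.Fin.Properties as Fin
open import Data.List.Base as List using (List; cartesianProductWith)
open import Data.Nat.Base as ℕ using (ℕ; zero; suc; _≤_; _<_; _∸_)
open import Data.Nat.Combinatorics using (_C_; nC1≡n; nCk+nC[k+1]≡[n+1]C[k+1])
import Data.Nat.Properties as ℕ
open import Data.Nat.Solver using (module +-*-Solver)
open import Data.Product.Base using (∃; _×_; _,_; proj₁; proj₂)
open import Data.Rational.Base as ℚ using (ℚ; 0ℚ; ½; ∣_∣)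
import Data.Rational.Properties as ℚ
import Data.Rational.Solver
open import Data.Sum.Base using (_⊎_; inj₁; inj₂)
open import Data.Unit.Polymorphic.Base using (⊤; tt)
open import Data.Vec.Functional as Vector using (Vector; _∷_; head; tail; removeAt)
import Data.Vec.Functional.Relation.Binary.Equality.Setoid as VectorEquality
open import Function.Base using (_∘_; _$_; flip)
open import Function.Bundles using (Inverse)
open import Level using (Level; _⊔_)
open import Relation.Binary.Bundles using (Setoid)
open import Relation.Binary.Definitions using (Decidable)
open import Relation.Binary.PropositionalEquality as ≡ using (_≡_)
import Relation.Binary.Reasoning.Setoid as SetoidReasoning
open import Relation.Nullary.Decidable
  using (Dec; yes; no; does; ¬?; _×-dec_; map′; decidable-stable)
open import Relation.Nullary.Negation using (¬_; contradiction)
open import Relation.Unary using (Pred)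
import Relation.Unary as Unary

-- The rank is replaced at once by the equation `#kernel U * q ^ u = q ^ n`. Kernel sizes are easier
-- to follow than bases: dropping a row multiplies the size by `q` or leaves it alone, and passing
-- to a minor divides it by `q`. They are wanted in ℕ, where factors cancel and sizes compare, and
-- again as factors of complex sums; hence finite sums are developed over any commutative semiring
-- and used in both. Conditions such as `det X = y` or `U′ x = 0` are carried as weights 0 and 1
-- instead of sublists, so that sums can be exchanged and substituted freely. A row of `X` is
-- cleared by column operations because in `U ∙ X` they pass to `U` by transposition. The
-- determinant, defined by expansion along the first row, must therefore be known as an alternating
-- function of the columns. The reduction itself works in any commutative ring with a character
-- whose sum is 0; ℂ matters only for proving that this sum vanishes.

_^ˢ_ : ∀ {a ℓ} → Setoid a ℓ → ℕ → Setoid a ℓ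
S ^ˢ n = VectorEquality.≋-setoid S n

-- Finite sums in a commutative semiring, and changes of variables in them.

module FiniteSums {r ℓr} (R : CommutativeSemiring r ℓr) where

  open CommutativeSemiring R hiding (zero)
  open CommutativeSemigroupProperties *-commutativeSemigroup using (interchange)
  open CommutativeSemigroupProperties +-commutativeSemigroup using () renaming (interchange to +-interchange)
  open SemiringSum semiring using (sum)
  open SetoidReasoning setoid

  private
    variable
      a b c ℓ p q : Level
      A : Set a
      B : Set b
      D : Set c
      P : Set p
      Q : Set q

  ∑ : List A → (A → Carrier) → Carrier
  ∑ xs f = List.foldr (λ x s → f x + s) 0# xs

  ∑-cong : ∀ {f g : A → Carrier} → (∀ x → f x ≈ g x) → ∀ xs → ∑ xs f ≈ ∑ xs g
  ∑-cong f≈g List.[]       = refl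
  ∑-cong f≈g (x List.∷ xs) = +-cong (f≈g x) (∑-cong f≈g xs)

  ∑-zero : ∀ (xs : List A) → ∑ xs (λ _ → 0#) ≈ 0#
  ∑-zero List.[]       = refl
  ∑-zero (x List.∷ xs) = trans (+-identityˡ _) (∑-zero xs)

  ∑-vanish : ∀ {f : A → Carrier} → (∀ x → f x ≈ 0#) → ∀ xs → ∑ xs f ≈ 0#
  ∑-vanish f≈0 xs = trans (∑-cong f≈0 xs) (∑-zero xs)

  ∑-+ : ∀ (f g : A → Carrier) xs → ∑ xs (λ x → f x + g x) ≈ ∑ xs f + ∑ xs g
  ∑-+ f g List.[]       = sym (+-identityˡ 0#)
  ∑-+ f g (x List.∷ xs) = trans (+-congˡ (∑-+ f g xs)) (+-interchange _ _ _ _)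

  *-∑ : ∀ y (f : A → Carrier) xs → y * ∑ xs f ≈ ∑ xs (λ x → y * f x)
  *-∑ y f List.[]       = zeroʳ y
  *-∑ y f (x List.∷ xs) = trans (distribˡ _ _ _) (+-congˡ (*-∑ y f xs))

  ∑-* : ∀ y (f : A → Carrier) xs → ∑ xs f * y ≈ ∑ xs (λ x → f x * y)
  ∑-* y f List.[]       = zeroˡ y
  ∑-* y f (x List.∷ xs) = trans (distribʳ _ _ _) (+-congˡ (∑-* y f xs))

  ∑-swap : ∀ (f : A → B → Carrier) xs ys →
           ∑ xs (λ x → ∑ ys (f x)) ≈ ∑ ys (λ y → ∑ xs (λ x → f x y))
  ∑-swap f List.[]       ys = sym (∑-zero ys)
  ∑-swap f (x List.∷ xs) ys = trans (+-congˡ (∑-swap f xs ys)) (sym (∑-+ (f x) _ ys))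

  ∑-++ : ∀ (f : A → Carrier) xs ys → ∑ (xs List.++ ys) f ≈ ∑ xs f + ∑ ys f
  ∑-++ f List.[]       ys = sym (+-identityˡ _)
  ∑-++ f (x List.∷ xs) ys = trans (+-congˡ (∑-++ f xs ys)) (sym (+-assoc _ _ _))

  ∑-map : ∀ (f : B → Carrier) (g : A → B) xs → ∑ (List.map g xs) f ≈ ∑ xs (f ∘ g)
  ∑-map f g List.[]       = refl
  ∑-map f g (x List.∷ xs) = +-congˡ (∑-map f g xs)

  ∑-cartesianProductWith : ∀ (f : D → Carrier) (g : A → B → D) xs ys →
    ∑ (cartesianProductWith g xs ys) f ≈ ∑ xs λ x → ∑ ys λ y → f (g x y)
  ∑-cartesianProductWith f g List.[]       ys = refl
  ∑-cartesianProductWith f g (x List.∷ xs) ys = trans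
    (∑-++ f (List.map (g x) ys) _)
    (+-cong (∑-map f (g x) ys) (∑-cartesianProductWith f g xs ys))

  ∑-tuples : ∀ (xs : List A) n (f : Vector A (suc n) → Carrier) →
    ∑ (tuples xs (suc n)) f ≈ ∑ xs λ x → ∑ (tuples xs n) λ t → f (x Vector.∷ t)
  ∑-tuples xs n f = ∑-cartesianProductWith f Vector._∷_ xs (tuples xs n)

  ∑-tabulate : ∀ {n} (g : Fin n → A) (f : A → Carrier) → ∑ (List.tabulate g) f ≈ sum (f ∘ g)
  ∑-tabulate {n = zero}  g f = refl
  ∑-tabulate {n = suc n} g f = +-congˡ (∑-tabulate (g ∘ suc) f)

  𝟙 : Dec P → Carrier
  𝟙 P? = if does P? then 1# else 0#

  𝟙-yes : (P? : Dec P) → P → 𝟙 P? ≈ 1#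
  𝟙-yes (yes _) _ = refl
  𝟙-yes (no ¬p) p = contradiction p ¬p

  𝟙-no : (P? : Dec P) → ¬ P → 𝟙 P? ≈ 0#
  𝟙-no (yes p) ¬p = contradiction p ¬p
  𝟙-no (no _)  _  = refl

  𝟙-cong : (P? : Dec P) (Q? : Dec Q) → (P → Q) → (Q → P) → 𝟙 P? ≈ 𝟙 Q?
  𝟙-cong (yes p) Q? f g = sym (𝟙-yes Q? (f p))
  𝟙-cong (no ¬p) Q? f g = sym (𝟙-no Q? (¬p ∘ g))

  𝟙-× : (P? : Dec P) (Q? : Dec Q) → 𝟙 (P? ×-dec Q?) ≈ 𝟙 P? * 𝟙 Q?
  𝟙-× (yes _) Q? = sym (*-identityˡ _)
  𝟙-× (no  _) Q? = sym (zeroˡ _)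

  𝟙*-cong : ∀ (P? : Dec P) {x y} → (P → x ≈ y) → 𝟙 P? * x ≈ 𝟙 P? * y
  𝟙*-cong (yes p) x≈y = *-congˡ (x≈y p)
  𝟙*-cong (no _)  _   = trans (zeroˡ _) (sym (zeroˡ _))

  𝟙*-yes : ∀ (P? : Dec P) → P → ∀ x → 𝟙 P? * x ≈ x
  𝟙*-yes P? p x = trans (*-congʳ (𝟙-yes P? p)) (*-identityˡ x)

  𝟙*-no : ∀ (P? : Dec P) → ¬ P → ∀ x → 𝟙 P? * x ≈ 0#
  𝟙*-no P? ¬p x = trans (*-congʳ (𝟙-no P? ¬p)) (zeroˡ x)

  ∑-filter : ∀ {P : A → Set p} (P? : Unary.Decidable P) (f : A → Carrier) xs →
             ∑ (List.filter P? xs) f ≈ ∑ xs λ x → 𝟙 (P? x) * f x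
  ∑-filter P? f List.[] = refl
  ∑-filter P? f (x List.∷ xs) with P? x
  ... | yes _ = +-cong (sym (*-identityˡ _)) (∑-filter P? f xs)
  ... | no  _ = trans (∑-filter P? f xs) (sym (trans (+-congʳ (zeroˡ _)) (+-identityˡ _)))

  sum-𝟙-≡ : ∀ {n} (i : Fin n) → sum (λ j → 𝟙 (j Fin.≟ i)) ≈ 1#
  sum-𝟙-≡ {suc n} zero    = trans (+-congˡ (SemiringSum.sum-replicate-zero semiring n)) (+-identityʳ 1#)
  sum-𝟙-≡ {suc n} (suc i) = trans (+-identityˡ _) $ trans
    (SemiringSum.sum-cong-≋ semiring λ j → 𝟙-cong (suc j Fin.≟ suc i) (j Fin.≟ i) Fin.suc-injective (≡.cong suc))
    (sum-𝟙-≡ i)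

  -- "Each class is listed once" is expressed as a sum in the semiring. This is the form that
  -- reindexing consumes, and it passes to tuples by multiplying indicators, without any reasoning
  -- about permutations of lists.
  record Enumeration (S : Setoid a ℓ) : Set (a ⊔ ℓ ⊔ ℓr) where
    private module S = Setoid S
    infix 4 _≟_
    field
      _≟_   : Decidable S._≈_
      list  : List S.Carrier
      ∑-𝟙-≟ : ∀ x → ∑ list (λ y → 𝟙 (y ≟ x)) ≈ 1#

    ∑-δ : ∀ x (f : S.Carrier → Carrier) → (∀ {y z} → y S.≈ z → f y ≈ f z) →
          ∑ list (λ y → 𝟙 (y ≟ x) * f y) ≈ f x
    ∑-δ x f f-cong = begin
      ∑ list (λ y → 𝟙 (y ≟ x) * f y)  ≈⟨ ∑-cong (λ y → 𝟙*-cong (y ≟ x) f-cong) list ⟩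
      ∑ list (λ y → 𝟙 (y ≟ x) * f x)  ≈⟨ ∑-* (f x) _ list ⟨
      ∑ list (λ y → 𝟙 (y ≟ x)) * f x  ≈⟨ *-congʳ (∑-𝟙-≟ x) ⟩
      1# * f x                         ≈⟨ *-identityˡ _ ⟩
      f x                              ∎

  module _ {S : Setoid a ℓ} {T : Setoid b ℓ} (E : Enumeration S) (F : Enumeration T) where
    private
      module S = Setoid S
      module T = Setoid T
      module E = Enumeration E
      module F = Enumeration F

    -- Double counting: insert the sum over `y` of the indicator of `y = φ x`, exchange the sums,
    -- and count the `x` for each `y`. Bijectivity is the single equivalence of `x ≈ ψ y` with
    -- `φ x ≈ y`, which already contains that `φ` and `ψ` respect equality.
    ∑-reindex : (φ : S.Carrier → T.Carrier) (ψ : T.Carrier → S.Carrier) →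
      (∀ x y → x S.≈ ψ y → φ x T.≈ y) → (∀ x y → φ x T.≈ y → x S.≈ ψ y) →
      ∀ (f : T.Carrier → Carrier) → (∀ {y z} → y T.≈ z → f y ≈ f z) →
      ∑ E.list (f ∘ φ) ≈ ∑ F.list f
    ∑-reindex φ ψ to from f f-cong = begin
      ∑ E.list (f ∘ φ)
        ≈⟨ ∑-cong (λ x → sym (F.∑-δ (φ x) f f-cong)) E.list ⟩
      ∑ E.list (λ x → ∑ F.list λ y → 𝟙 (y F.≟ φ x) * f y)
        ≈⟨ ∑-swap _ E.list F.list ⟩
      ∑ F.list (λ y → ∑ E.list λ x → 𝟙 (y F.≟ φ x) * f y)
        ≈⟨ ∑-cong (λ y → sym (∑-* (f y) _ E.list)) F.list ⟩
      ∑ F.list (λ y → ∑ E.list (λ x → 𝟙 (y F.≟ φ x)) * f y)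
        ≈⟨ ∑-cong (λ y → *-congʳ (trans
             (∑-cong (λ x → 𝟙-cong (y F.≟ φ x) (x E.≟ ψ y) (from x y ∘ T.sym) (T.sym ∘ to x y)) E.list)
             (E.∑-𝟙-≟ (ψ y)))) F.list ⟩
      ∑ F.list (λ y → 1# * f y)
        ≈⟨ ∑-cong (λ y → *-identityˡ (f y)) F.list ⟩
      ∑ F.list f ∎

  module _ {S : Setoid a ℓ} (E : Enumeration S) where
    private
      module S = Setoid S
      module E = Enumeration E

    infix 4 _≟ᵗ_
    _≟ᵗ_ : ∀ {n} → Decidable (Setoid._≈_ (S ^ˢ n))
    x ≟ᵗ y = Fin.all? λ i → x i E.≟ y i

    tuplesEnumeration : ∀ n → Enumeration (S ^ˢ n)
    tuplesEnumeration n = record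
      { _≟_ = _≟ᵗ_ ; list = tuples E.list n ; ∑-𝟙-≟ = ∑-𝟙-≟ᵗ n }
      where
      ∑-𝟙-≟ᵗ : ∀ n (x : Vector S.Carrier n) → ∑ (tuples E.list n) (λ y → 𝟙 (y ≟ᵗ x)) ≈ 1#
      ∑-𝟙-≟ᵗ zero    x = trans (+-congʳ (𝟙-yes (Vector.[] ≟ᵗ x) λ ())) (+-identityʳ 1#)
      ∑-𝟙-≟ᵗ (suc n) x = begin
        ∑ (tuples E.list (suc n)) (λ y → 𝟙 (y ≟ᵗ x))
          ≈⟨ ∑-tuples E.list n _ ⟩
        ∑ E.list (λ y₀ → ∑ (tuples E.list n) λ y → 𝟙 ((y₀ Vector.∷ y) ≟ᵗ x))
          ≈⟨ ∑-cong (λ y₀ → trans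
               (∑-cong (λ y → trans
                 (𝟙-cong ((y₀ Vector.∷ y) ≟ᵗ x) ((y₀ E.≟ head x) ×-dec (y ≟ᵗ tail x))
                   (λ e → e zero , e ∘ suc) λ (e₀ , e) → λ { zero → e₀ ; (suc i) → e i })
                 (𝟙-× (y₀ E.≟ head x) (y ≟ᵗ tail x))) (tuples E.list n))
               (sym (*-∑ _ _ (tuples E.list n)))) E.list ⟩
        ∑ E.list (λ y₀ → 𝟙 (y₀ E.≟ head x) * ∑ (tuples E.list n) λ y → 𝟙 (y ≟ᵗ tail x))
          ≈⟨ ∑-cong (λ y₀ → trans (*-congˡ (∑-𝟙-≟ᵗ n (tail x))) (*-identityʳ _)) E.list ⟩
        ∑ E.list (λ y₀ → 𝟙 (y₀ E.≟ head x))
          ≈⟨ E.∑-𝟙-≟ (head x) ⟩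
        1# ∎

-- Determinants as alternating multilinear forms in the columns; column operations.

module Determinants {c ℓ} (R : CommutativeRing c ℓ) where

  open CommutativeRing R hiding (zero) renaming (Carrier to K)
  open RingProperties ring using (-0#≈0#; -‿distribʳ-*; -‿+-comm; -1*x≈-x; x+x≈x⇒x≈0)
  open Algebra.Definitions.RawSemiring (Semiring.rawSemiring semiring) using (_^_; sum)
  open SemiringSum semiring using (sum-cong-≋; sum-replicate-zero; *-distribˡ-sum; *-distribʳ-sum; ∑-distrib-+)
  open SemiringSolver commutativeSemiring using (solve; _:+_; _:*_; _:=_)
  open SetoidReasoning setoid
  open LinearAlgebra R

  infix 4 _≋_ _≋ᴹ_
  _≋_ : ∀ {n} → Vector K n → Vector K n → Set ℓ
  x ≋ y = ∀ i → x i ≈ y i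

  _≋ᴹ_ : ∀ {m n} → Matrix m n → Matrix m n → Set ℓ
  A ≋ᴹ B = ∀ i → A i ≋ B i

  ∷-cong : ∀ {n} {x y : K} {s t : Vector K n} → x ≈ y → s ≋ t → (x ∷ s) ≋ (y ∷ t)
  ∷-cong x≈y s≋t zero    = x≈y
  ∷-cong x≈y s≋t (suc i) = s≋t i

  ∷-congᴹ : ∀ {m n} {x y : Vector K n} {A B : Matrix m n} → x ≋ y → A ≋ᴹ B → (x ∷ A) ≋ᴹ (y ∷ B)
  ∷-congᴹ x≋y A≋B zero    = x≋y
  ∷-congᴹ x≋y A≋B (suc i) = A≋B i

  0ᵛ : ∀ {n} → Vector K n
  0ᵛ _ = 0#

  sum-zero : ∀ {n} {x : Vector K n} → (∀ i → x i ≈ 0#) → sum x ≈ 0#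
  sum-zero {n} x≈0 = trans (sum-cong-≋ x≈0) (sum-replicate-zero n)

  Function : ℕ → ℕ → Set c
  Function m n = Vector (Vector K m) n → K

  Congruent : ∀ {m n} → Function m n → Set (c ⊔ ℓ)
  Congruent φ = ∀ {B D} → B ≋ᴹ D → φ B ≈ φ D

  Linear : ∀ {m n} → Function m (suc n) → Set (c ⊔ ℓ)
  Linear φ = ∀ x y t B → φ ((λ i → x i + t * y i) ∷ B) ≈ φ (x ∷ B) + t * φ (y ∷ B)

  Alternating : ∀ {m n} → Function m (suc n) → Set (c ⊔ ℓ)
  Alternating {n = zero}  φ = ⊤
  Alternating {n = suc n} φ = ∀ x B → φ (x ∷ x ∷ B) ≈ 0#

  -- Alternating multilinear forms, described recursively: conditions on the first one or two
  -- arguments, and again a form once the first argument is fixed. This follows the recursion of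
  -- Laplace expansion; repetition in distant positions is reduced to adjacent ones by
  -- `swap-columns`.
  data Form {m} : ∀ n → Function m n → Set (c ⊔ ℓ) where
    nil  : ∀ {φ} → Congruent φ → Form zero φ
    cons : ∀ {n φ} → Congruent φ → Linear φ → Alternating φ →
           (∀ x → Form n (λ B → φ (x ∷ B))) → Form (suc n) φ

  form-cong : ∀ {m n} {φ : Function m n} → Form n φ → Congruent φ
  form-cong (nil φ-cong)        = φ-cong
  form-cong (cons φ-cong _ _ _) = φ-cong

  form-combination : ∀ {m n} {φ ψ χ : Function m n} t → (∀ B → χ B ≈ φ B + t * ψ B) →
                     Form n φ → Form n ψ → Form n χ
  form-combination t χ≈ (nil φ-cong) (nil ψ-cong) = nil λ C≋D →
    trans (χ≈ _) (trans (+-cong (φ-cong C≋D) (*-congˡ (ψ-cong C≋D))) (sym (χ≈ _)))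
  form-combination {n = suc n} {φ} {ψ} {χ} t χ≈ (cons φ-cong φ-lin φ-alt φ-form) (cons ψ-cong ψ-lin ψ-alt ψ-form) = cons
    (λ C≋D → trans (χ≈ _) (trans (+-cong (φ-cong C≋D) (*-congˡ (ψ-cong C≋D))) (sym (χ≈ _))))
    (λ x y s B → trans (χ≈ _) $ trans (+-cong (φ-lin x y s B) (*-congˡ (ψ-lin x y s B))) $ trans
      (solve 6 (λ a b c d t s → (a :+ s :* b) :+ t :* (c :+ s :* d) := (a :+ t :* c) :+ s :* (b :+ t :* d))
         refl (φ (x ∷ B)) (φ (y ∷ B)) (ψ (x ∷ B)) (ψ (y ∷ B)) t s)
      (sym (+-cong (χ≈ _) (*-congˡ (χ≈ _)))))
    (alternating n χ≈ φ-alt ψ-alt)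
    (λ x → form-combination t (λ B → χ≈ (x ∷ B)) (φ-form x) (ψ-form x))
    where
    alternating : ∀ n {φ ψ χ : Function _ (suc n)} → (∀ B → χ B ≈ φ B + t * ψ B) →
                  Alternating φ → Alternating ψ → Alternating χ
    alternating zero    χ≈ φ-alt ψ-alt = tt
    alternating (suc n) χ≈ φ-alt ψ-alt x B = trans (χ≈ _) (trans
      (+-cong (φ-alt x B) (trans (*-congˡ (ψ-alt x B)) (zeroʳ t))) (+-identityʳ 0#))

  -- Makes the determinant of the rows below the first a form in the full columns, as the expansion
  -- requires.
  form-tail : ∀ {m n} {φ : Function m n} → Form n φ → Form n (λ B → φ (tail ∘ B))
  form-tail (nil φ-cong) = nil (λ C≋D → φ-cong (λ j i → C≋D j (suc i)))
  form-tail {n = suc n} {φ} (cons φ-cong φ-lin φ-alt φ-form) = cons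
    (λ C≋D → φ-cong (λ j i → C≋D j (suc i)))
    (λ x y t B → trans (push _ B) $ trans (φ-lin (tail x) (tail y) t (tail ∘ B))
       (sym (+-cong (push x B) (*-congˡ (push y B)))))
    (alternating n φ-cong φ-alt)
    -- With coefficient `0#` this only transfers the property along a pointwise equality.
    (λ x → form-combination 0# (λ B → trans (push x B) (sym (trans (+-congˡ (zeroˡ _)) (+-identityʳ _))))
             (form-tail (φ-form (tail x))) (form-tail (φ-form (tail x))))
    where
    push : ∀ x B → φ (tail ∘ (x ∷ B)) ≈ φ (tail x ∷ (tail ∘ B))
    push x B = φ-cong λ { zero i → refl ; (suc j) i → refl }
    alternating : ∀ n {φ : Function _ (suc n)} → Congruent φ → Alternating φ →
                  Alternating {n = n} (λ B → φ (tail ∘ B))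
    alternating zero    φ-cong φ-alt     = tt
    alternating (suc n) φ-cong φ-alt x B = trans
      (φ-cong λ { zero i → refl ; (suc zero) i → refl ; (suc (suc j)) i → refl })
      (φ-alt (tail x) (tail ∘ B))

  -- Laplace expansion, unfolded so that it recurses on the list of columns.
  ∂ : ∀ {m n} → Function (suc m) n → Function (suc m) (suc n)
  ∂ {n = zero}  φ B = head (head B) * φ (tail B)
  ∂ {n = suc n} φ B = head (head B) * φ (tail B) + - ∂ (λ D → φ (head B ∷ D)) (tail B)

  ∂-cong : ∀ {m n} {φ ψ : Function (suc m) n} → (∀ {B D} → B ≋ᴹ D → φ B ≈ ψ D) →
           ∀ {B D} → B ≋ᴹ D → ∂ φ B ≈ ∂ ψ D
  ∂-cong {n = zero}  φ≈ψ C≋D = *-cong (C≋D zero zero) (φ≈ψ (C≋D ∘ suc))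
  ∂-cong {n = suc n} φ≈ψ C≋D = +-cong (*-cong (C≋D zero zero) (φ≈ψ (C≋D ∘ suc)))
    (-‿cong (∂-cong (λ E≋F → φ≈ψ (∷-congᴹ (C≋D zero) E≋F)) (C≋D ∘ suc)))

  ∂-combination : ∀ {m n} {φ ψ χ : Function (suc m) n} t → (∀ B → χ B ≈ φ B + t * ψ B) →
                  ∀ B → ∂ χ B ≈ ∂ φ B + t * ∂ ψ B
  ∂-combination {n = zero} {φ} {ψ} t χ≈ B = trans (*-congˡ (χ≈ (tail B)))
    (solve 4 (λ h a t b → h :* (a :+ t :* b) := h :* a :+ t :* (h :* b)) refl
      (head (head B)) (φ (tail B)) t (ψ (tail B)))
  ∂-combination {n = suc n} {φ} {ψ} {χ} t χ≈ B = trans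
    (+-cong (*-congˡ (χ≈ (tail B)))
      (trans (-‿cong (∂-combination t (λ D → χ≈ (head B ∷ D)) (tail B))) neg))
    (trans (solve 6 (λ h a t b u v → h :* (a :+ t :* b) :+ (u :+ t :* v) := (h :* a :+ u) :+ t :* (h :* b :+ v)) refl
      (head (head B)) (φ (tail B)) t (ψ (tail B)) _ _) refl)
    where
    neg : ∀ {u v} → - (u + t * v) ≈ - u + t * - v
    neg = trans (sym (-‿+-comm _ _)) (+-congˡ (-‿distribʳ-* _ _))

  ∂-zero : ∀ {m n} {φ : Function (suc m) n} → (∀ B → φ B ≈ 0#) → ∀ B → ∂ φ B ≈ 0#
  ∂-zero {n = zero}  φ≈0 B = trans (*-congˡ (φ≈0 _)) (zeroʳ _)
  ∂-zero {n = suc n} φ≈0 B = trans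
    (+-cong (trans (*-congˡ (φ≈0 _)) (zeroʳ _)) (trans (-‿cong (∂-zero (λ D → φ≈0 _) (tail B))) -0#≈0#))
    (+-identityʳ 0#)

  -- With two equal leading columns the first two terms of the expansion cancel, and every later
  -- term contains `φ` at a repeated column. With the first column fixed, `∂ φ` is a linear
  -- combination of `φ` and of the expansion of a smaller form.
  ∂-form : ∀ {m n} {φ : Function (suc m) n} → Form n φ → Form (suc n) (∂ φ)
  ∂-form {φ = φ} (nil φ-cong) = cons (∂-cong φ-cong)
    (λ x y t B → solve 4 (λ a t b u → (a :+ t :* b) :* u := a :* u :+ t :* (b :* u)) refl
                   (head x) t (head y) (φ B))
    tt (λ x → nil (λ C≋D → *-congˡ (φ-cong C≋D)))
  ∂-form {n = suc n} {φ} (cons φ-cong φ-lin φ-alt φ-form) = cons (∂-cong φ-cong)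
    (λ x y t B → trans
      (+-congˡ (-‿cong (∂-combination t (φ-lin x y t) B)))
      (trans (+-congˡ (trans (sym (-‿+-comm _ _)) (+-congˡ (-‿distribʳ-* _ _))))
        (solve 6 (λ a t b f u v → (a :+ t :* b) :* f :+ (u :+ t :* v) := (a :* f :+ u) :+ t :* (b :* f :+ v)) refl
          (head x) t (head y) (φ B) _ _)))
    (alternating n φ-alt)
    (λ x → form-combination (head x) (λ B → trans (+-comm _ _) (+-congʳ (sym (-1*x≈-x _))))
       (form-combination {φ = λ _ → 0#} (- 1#) (λ B → sym (+-identityˡ _)) (zero-form _) (∂-form (φ-form x)))
       (cons φ-cong φ-lin φ-alt φ-form))
    where
    zero-form : ∀ {m} n → Form {m} n (λ _ → 0#)
    zero-form zero = nil (λ _ → refl)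
    zero-form (suc n) = cons (λ _ → refl) (λ _ _ t _ → sym (trans (+-identityˡ _) (zeroʳ t))) (alt n) (λ _ → zero-form n)
      where
      alt : ∀ {m} n → Alternating {m} {n} (λ _ → 0#)
      alt zero = tt
      alt (suc n) _ _ = refl
    alternating : ∀ n {φ : Function _ (suc n)} → Alternating φ → Alternating (∂ φ)
    alternating zero    φ-alt x B = -‿inverseʳ _
    alternating (suc n) {φ} φ-alt x B = begin
      head x * φ (x ∷ B) + - (head x * φ (x ∷ B) + - ∂ (λ D → φ (x ∷ x ∷ D)) B)
        ≈⟨ +-congˡ (-‿cong (trans (+-congˡ (trans (-‿cong (∂-zero (φ-alt x) B)) -0#≈0#)) (+-identityʳ _))) ⟩
      head x * φ (x ∷ B) + - (head x * φ (x ∷ B))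
        ≈⟨ -‿inverseʳ _ ⟩
      0# ∎

  laplace-∂ : ∀ {m n} {φ : Function (suc m) n} → Congruent φ → ∀ B →
              (sum λ j → (- 1#) ^ toℕ j * head (B j) * φ (removeAt B j)) ≈ ∂ φ B
  laplace-∂ {n = zero}  φ-cong B = trans (+-identityʳ _) (*-congʳ (*-identityˡ _))
  laplace-∂ {n = suc n} {φ} φ-cong B = +-cong (*-congʳ (*-identityˡ _)) $ begin
    (sum λ j → (- 1# * (- 1#) ^ toℕ j) * head (B (suc j)) * φ (removeAt B (suc j)))
      ≈⟨ sum-cong-≋ {n = suc n} (λ j → trans
           (*-congˡ (φ-cong {removeAt B (suc j)} {head B ∷ removeAt (tail B) j} λ { zero i → refl ; (suc l) i → refl }))
           (solve 4 (λ a b d e → ((a :* b) :* d) :* e := a :* ((b :* d) :* e)) refl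
             (- 1#) ((- 1#) ^ toℕ j) (head (B (suc j))) (φ (head B ∷ removeAt (tail B) j)))) ⟩
    (sum λ j → - 1# * ((- 1#) ^ toℕ j * head (B (suc j)) * φ (head B ∷ removeAt (tail B) j)))
      ≈⟨ *-distribˡ-sum (- 1#) (λ j → (- 1#) ^ toℕ j * head (B (suc j)) * φ (head B ∷ removeAt (tail B) j)) ⟨
    - 1# * (sum λ j → (- 1#) ^ toℕ j * head (B (suc j)) * φ (head B ∷ removeAt (tail B) j))
      ≈⟨ *-congˡ (laplace-∂ (λ D≋E → φ-cong (∷-congᴹ (λ _ → refl) D≋E)) (tail B)) ⟩
    - 1# * ∂ (λ D → φ (head B ∷ D)) (tail B)
      ≈⟨ -1*x≈-x _ ⟩
    - ∂ (λ D → φ (head B ∷ D)) (tail B) ∎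

  detᶜ : ∀ n → Function n n
  detᶜ zero    B = 1#
  detᶜ (suc n) B = ∂ (λ D → detᶜ n (tail ∘ D)) B

  detᶜ-form : ∀ n → Form n (detᶜ n)
  detᶜ-form zero    = nil (λ _ → refl)
  detᶜ-form (suc n) = ∂-form (form-tail (detᶜ-form n))

  det≈detᶜ : ∀ {n} (A : Matrix n n) → det A ≈ detᶜ n (flip A)
  det≈detᶜ {zero}  A = refl
  det≈detᶜ {suc n} A = trans
    (sum-cong-≋ λ j → *-congˡ {x = (- 1#) ^ toℕ j * A zero j} (det≈detᶜ (λ i → removeAt (A (suc i)) j)))
    (laplace-∂ (λ C≋D → form-cong (detᶜ-form n) λ j i → C≋D j (suc i)) (flip A))

  det-cong : ∀ {n} {A B : Matrix n n} → A ≋ᴹ B → det A ≈ det B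
  det-cong {n} {A} {B} A≋B = trans (det≈detᶜ A)
    (trans (form-cong (detᶜ-form n) {flip A} {flip B} (λ j i → A≋B i j)) (sym (det≈detᶜ B)))

  zero-column : ∀ {m n} {φ : Function m (suc n)} → Form (suc n) φ → ∀ x B → x ≋ 0ᵛ → φ (x ∷ B) ≈ 0#
  zero-column {φ = φ} (cons φ-cong φ-lin _ _) x B x≈0 = x+x≈x⇒x≈0 _ $ begin
    φ (x ∷ B) + φ (x ∷ B)              ≈⟨ +-congˡ (*-identityˡ _) ⟨
    φ (x ∷ B) + 1# * φ (x ∷ B)         ≈⟨ φ-lin x x 1# B ⟨
    φ ((λ i → x i + 1# * x i) ∷ B)     ≈⟨ φ-cong (∷-congᴹ (λ i → trans (+-congˡ (trans (*-identityˡ _) (x≈0 i))) (+-identityʳ _)) (λ _ _ → refl)) ⟩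
    φ (x ∷ B)                          ∎

  -- Polarisation: expand the vanishing value at `x+y` repeated; only the two mixed terms survive.
  swap-columns : ∀ {m n} {φ : Function m (suc (suc n))} → Form (suc (suc n)) φ →
                 ∀ x y B → φ (x ∷ y ∷ B) + φ (y ∷ x ∷ B) ≈ 0#
  swap-columns {φ = φ} (cons φ-cong φ-lin φ-alt φ-form) x y B = begin
    φ (x ∷ y ∷ B) + φ (y ∷ x ∷ B)
      ≈⟨ +-cong (trans (+-congʳ (φ-alt x B)) (+-identityˡ _)) (trans (+-congˡ (φ-alt y B)) (+-identityʳ _)) ⟨
    (φ (x ∷ x ∷ B) + φ (x ∷ y ∷ B)) + (φ (y ∷ x ∷ B) + φ (y ∷ y ∷ B))
      ≈⟨ +-cong (second x) (second y) ⟨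
    φ (x ∷ x+y ∷ B) + φ (y ∷ x+y ∷ B)
      ≈⟨ +-congˡ (*-identityˡ _) ⟨
    φ (x ∷ x+y ∷ B) + 1# * φ (y ∷ x+y ∷ B)
      ≈⟨ φ-lin x y 1# (x+y ∷ B) ⟨
    φ (x+y ∷ x+y ∷ B)
      ≈⟨ φ-alt x+y B ⟩
    0# ∎
    where
    x+y : Vector K _
    x+y = λ i → x i + 1# * y i
    second : ∀ z → φ (z ∷ x+y ∷ B) ≈ φ (z ∷ x ∷ B) + φ (z ∷ y ∷ B)
    second z with φ-form z
    ... | cons _ lin _ _ = trans (lin x y 1# B) (+-congˡ (*-identityˡ _))

  -- Swapping `x` with its neighbour brings it one place closer to its copy, with the neighbour now
  -- a fixed argument.
  equal-columns : ∀ {m n} {φ : Function m (suc n)} → Form (suc n) φ →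
                  ∀ x B j → B j ≋ x → φ (x ∷ B) ≈ 0#
  equal-columns {n = suc n} (cons φ-cong φ-lin φ-alt φ-form) x B zero C₀≈x = trans
    (φ-cong (∷-congᴹ (λ _ → refl) λ { zero → C₀≈x ; (suc j) i → refl })) (φ-alt x (tail B))
  equal-columns {n = suc n} {φ} form@(cons φ-cong φ-lin φ-alt φ-form) x B (suc j) Cⱼ≈x = begin
    φ (x ∷ B)                                             ≈⟨ φ-cong (∷-congᴹ (λ _ → refl) λ { zero i → refl ; (suc j) i → refl }) ⟩
    φ (x ∷ head B ∷ tail B)                               ≈⟨ +-identityʳ _ ⟨
    φ (x ∷ head B ∷ tail B) + 0#                          ≈⟨ +-congˡ (equal-columns (φ-form (head B)) x (tail B) j Cⱼ≈x) ⟨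
    φ (x ∷ head B ∷ tail B) + φ (head B ∷ x ∷ tail B)     ≈⟨ swap-columns form x (head B) (tail B) ⟩
    0#                                                    ∎

  -- Here `x` is not among the arguments of `φ`. In the application it is the first column of a
  -- determinant, held fixed, which is why `φ` kills `x` in every position.
  add-multiples-of : ∀ {m n} {φ : Function m n} → Form n φ → ∀ x →
    (∀ B j → B j ≋ x → φ B ≈ 0#) →
    ∀ (v : Vector K n) B → φ (λ j i → B j i + v j * x i) ≈ φ B
  add-multiples-of (nil φ-cong) x _ v B = φ-cong λ ()
  add-multiples-of {n = suc n} {φ} (cons φ-cong φ-lin _ φ-form) x kills v B = begin
    φ (λ j i → B j i + v j * x i)
      ≈⟨ φ-cong (λ { zero i → refl ; (suc j) i → refl }) ⟩
    φ ((λ i → head B i + head v * x i) ∷ C+vx)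
      ≈⟨ φ-lin (head B) x (head v) C+vx ⟩
    φ (head B ∷ C+vx) + head v * φ (x ∷ C+vx)
      ≈⟨ +-congˡ (trans (*-congˡ (kills (x ∷ C+vx) zero λ _ → refl)) (zeroʳ _)) ⟩
    φ (head B ∷ C+vx) + 0#
      ≈⟨ +-identityʳ _ ⟩
    φ (head B ∷ C+vx)
      ≈⟨ add-multiples-of (φ-form (head B)) x (λ D j → kills (head B ∷ D) (suc j)) (tail v) (tail B) ⟩
    φ (head B ∷ tail B)
      ≈⟨ φ-cong (λ { zero i → refl ; (suc j) i → refl }) ⟩
    φ B ∎
    where
    C+vx : Matrix _ _
    C+vx = λ j i → tail B j i + tail v j * x i

  add-combination : ∀ {m n} {φ : Function m (suc n)} → Form (suc n) φ → ∀ {p} x B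
    (v : Vector K p) (D : Matrix p m) → (∀ j → φ (D j ∷ B) ≈ 0#) →
    φ ((λ i → x i + sum λ j → v j * D j i) ∷ B) ≈ φ (x ∷ B)
  add-combination form {zero} x B v D kills =
    form-cong form (∷-congᴹ (λ i → +-identityʳ _) (λ _ _ → refl))
  add-combination {φ = φ} form@(cons φ-cong φ-lin _ _) {suc p} x B v D kills = begin
    φ ((λ i → x i + sum λ j → v j * D j i) ∷ B)
      ≈⟨ φ-cong (∷-congᴹ (λ i → sym (+-assoc _ _ _)) (λ _ _ → refl)) ⟩
    φ ((λ i → (x i + v zero * D zero i) + sum λ j → v (suc j) * D (suc j) i) ∷ B)
      ≈⟨ add-combination form (λ i → x i + v zero * D zero i) B (tail v) (tail D) (kills ∘ suc) ⟩
    φ ((λ i → x i + v zero * D zero i) ∷ B)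
      ≈⟨ φ-lin x (D zero) (v zero) B ⟩
    φ (x ∷ B) + v zero * φ (D zero ∷ B)
      ≈⟨ +-congˡ (trans (*-congˡ (kills zero)) (zeroʳ _)) ⟩
    φ (x ∷ B) + 0#
      ≈⟨ +-identityʳ _ ⟩
    φ (x ∷ B) ∎

  det-clearedRow : ∀ {n} (A : Matrix (suc n) (suc n)) → (∀ j → A zero (suc j) ≈ 0#) →
                   det A ≈ A zero zero * det (λ i j → A (suc i) (suc j))
  det-clearedRow {n} A A₀ⱼ≈0 = trans
    (+-cong (*-congʳ (*-identityˡ _))
      (sum-zero λ j → trans (*-congʳ (trans (*-congˡ (A₀ⱼ≈0 j)) (zeroʳ _))) (zeroˡ _)))
    (+-identityʳ _)

  -- The expansion runs along the first row, so the vanishing part of the column appears as the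
  -- first column of every minor except the leading one.
  det-clearedColumn : ∀ {n} (A : Matrix (suc n) (suc n)) → (∀ i → A (suc i) zero ≈ 0#) →
                      det A ≈ A zero zero * det (λ i j → A (suc i) (suc j))
  det-clearedColumn {n} A Aᵢ₀≈0 = trans (det≈detᶜ A) $ trans (expand n A Aᵢ₀≈0) $
    *-congˡ (sym (det≈detᶜ (λ i j → A (suc i) (suc j))))
    where
    expand : ∀ n (A : Matrix (suc n) (suc n)) → (∀ i → A (suc i) zero ≈ 0#) →
             detᶜ (suc n) (flip A) ≈ A zero zero * detᶜ n (flip λ i j → A (suc i) (suc j))
    expand zero    A Aᵢ₀≈0 = refl
    expand (suc n) A Aᵢ₀≈0 = trans
      (+-congˡ (trans (-‿cong (∂-zero (λ D → trans
        (form-cong (detᶜ-form (suc n)) λ { zero i → refl ; (suc j) i → refl })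
        (zero-column (detᶜ-form (suc n)) (λ i → A (suc i) zero) (tail ∘ D) Aᵢ₀≈0)) _)) -0#≈0#))
      (+-identityʳ _)

  ⟨_,_⟩ : ∀ {n} → Vector K n → Vector K n → K
  ⟨ x , y ⟩ = sum λ i → x i * y i

  ⟨⟩-cong : ∀ {n} {x y u v : Vector K n} → x ≋ y → u ≋ v → ⟨ x , u ⟩ ≈ ⟨ y , v ⟩
  ⟨⟩-cong x≋y u≋v = sum-cong-≋ λ i → *-cong (x≋y i) (u≋v i)

  ⟨⟩-comm : ∀ {n} (x y : Vector K n) → ⟨ x , y ⟩ ≈ ⟨ y , x ⟩
  ⟨⟩-comm x y = sum-cong-≋ λ i → *-comm (x i) (y i)

  ⟨⟩-+ : ∀ {n} (x y z : Vector K n) t → ⟨ x , (λ i → y i + t * z i) ⟩ ≈ ⟨ x , y ⟩ + t * ⟨ x , z ⟩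
  ⟨⟩-+ x y z t = begin
    (sum λ i → x i * (y i + t * z i))
      ≈⟨ sum-cong-≋ (λ i → solve 4 (λ x y t z → x :* (y :+ t :* z) := x :* y :+ t :* (x :* z)) refl (x i) (y i) t (z i)) ⟩
    (sum λ i → x i * y i + t * (x i * z i))
      ≈⟨ ∑-distrib-+ (λ i → x i * y i) _ ⟩
    ⟨ x , y ⟩ + (sum λ i → t * (x i * z i))
      ≈⟨ +-congˡ (*-distribˡ-sum t (λ i → x i * z i)) ⟨
    ⟨ x , y ⟩ + t * ⟨ x , z ⟩ ∎

  ⟨⟩-zeroʳ : ∀ {n} (x : Vector K n) {z} → z ≋ 0ᵛ → ⟨ x , z ⟩ ≈ 0#
  ⟨⟩-zeroʳ x z≈0 = sum-zero λ i → trans (*-congˡ (z≈0 i)) (zeroʳ _)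

  -- A linear automorphism of the space of rows with determinant 1.  Applied to
  -- every row of a matrix, it is a column operation.
  record ColumnOperation (n : ℕ) : Set (c ⊔ ℓ) where
    field
      to from adjoint : Vector K n → Vector K n
      to-cong   : ∀ {x y} → x ≋ y → to x ≋ to y
      from-cong : ∀ {x y} → x ≋ y → from x ≋ from y
      to-from   : ∀ x → to (from x) ≋ x
      from-to   : ∀ x → from (to x) ≋ x
      ⟨⟩-adjoint : ∀ a x → ⟨ a , to x ⟩ ≈ ⟨ adjoint a , x ⟩
      det-to      : ∀ A → det (λ i → to (A i)) ≈ det A
      det-adjoint : ∀ A → det (λ i → adjoint (A i)) ≈ det A

  infixr 9 _∘ᶜ_
  _∘ᶜ_ : ∀ {n} → ColumnOperation n → ColumnOperation n → ColumnOperation n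
  g ∘ᶜ h = record
    { to = g.to ∘ h.to ; from = h.from ∘ g.from ; adjoint = h.adjoint ∘ g.adjoint
    ; to-cong = g.to-cong ∘ h.to-cong
    ; from-cong = h.from-cong ∘ g.from-cong
    ; to-from = λ x i → trans (g.to-cong (h.to-from _) i) (g.to-from x i)
    ; from-to = λ x i → trans (h.from-cong (g.from-to _) i) (h.from-to x i)
    ; ⟨⟩-adjoint = λ a x → trans (g.⟨⟩-adjoint _ _) (h.⟨⟩-adjoint _ _)
    ; det-to = λ A → trans (g.det-to _) (h.det-to A)
    ; det-adjoint = λ A → trans (h.det-adjoint _) (g.det-adjoint A)
    }
    where
    module g = ColumnOperation g
    module h = ColumnOperation h

  -- Right multiplication by a unipotent matrix differing from the identity in its first row, and by
  -- the transpose of that matrix. Being transposes, the two are adjoint to each other for the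
  -- pairing of rows.
  spread gather : ∀ {n} → Vector K n → Vector K (suc n) → Vector K (suc n)
  spread v x = head x ∷ λ j → tail x j + v j * head x
  gather v x = (head x + ⟨ v , tail x ⟩) ∷ tail x

  det-spread : ∀ {n} v (A : Matrix (suc n) (suc n)) → det (λ i → spread v (A i)) ≈ det A
  det-spread {n} v A with detᶜ-form (suc n)
  ... | form@(cons φ-cong _ _ φ-form) = begin
    det (λ i → spread v (A i))
      ≈⟨ det≈detᶜ (λ i → spread v (A i)) ⟩
    detᶜ (suc n) (flip λ i → spread v (A i))
      ≈⟨ φ-cong (λ { zero i → refl ; (suc j) i → refl }) ⟩
    detᶜ (suc n) (a ∷ λ j i → B j i + v j * a i)
      ≈⟨ add-multiples-of (φ-form a) a (equal-columns form a) v B ⟩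
    detᶜ (suc n) (a ∷ B)
      ≈⟨ φ-cong (λ { zero i → refl ; (suc j) i → refl }) ⟩
    detᶜ (suc n) (flip A)
      ≈⟨ det≈detᶜ A ⟨
    det A ∎
    where
    a = λ i → A i zero
    B = λ j i → A i (suc j)

  det-gather : ∀ {n} v (A : Matrix (suc n) (suc n)) → det (λ i → gather v (A i)) ≈ det A
  det-gather {n} v A = begin
    det (λ i → gather v (A i))
      ≈⟨ det≈detᶜ (λ i → gather v (A i)) ⟩
    detᶜ (suc n) (flip λ i → gather v (A i))
      ≈⟨ form-cong form (λ { zero i → refl ; (suc j) i → refl }) ⟩
    detᶜ (suc n) ((λ i → a i + sum λ j → v j * B j i) ∷ B)
      ≈⟨ add-combination form a B v B (λ j → equal-columns form (B j) B j λ _ → refl) ⟩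
    detᶜ (suc n) (a ∷ B)
      ≈⟨ form-cong form (λ { zero i → refl ; (suc j) i → refl }) ⟩
    detᶜ (suc n) (flip A)
      ≈⟨ det≈detᶜ A ⟨
    det A ∎
    where
    form = detᶜ-form (suc n)
    a = λ i → A i zero
    B = λ j i → A i (suc j)

  private
    x-y+y : ∀ x y → (x + - y) + y ≈ x
    x-y+y x y = trans (+-assoc _ _ _) (trans (+-congˡ (-‿inverseˡ y)) (+-identityʳ x))

    x+y-y : ∀ x y → (x + y) + - y ≈ x
    x+y-y x y = trans (+-assoc _ _ _) (trans (+-congˡ (-‿inverseʳ y)) (+-identityʳ x))

  spread-gather-adjoint : ∀ {n} v (a x : Vector K (suc n)) → ⟨ a , spread v x ⟩ ≈ ⟨ gather v a , x ⟩
  spread-gather-adjoint v a x = begin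
    head a * head x + (sum λ j → tail a j * (tail x j + v j * head x))
      ≈⟨ +-congˡ (trans (sum-cong-≋ λ j →
           solve 4 (λ a x v h → a :* (x :+ v :* h) := (v :* a) :* h :+ a :* x) refl (tail a j) (tail x j) (v j) (head x))
           (trans (∑-distrib-+ (λ j → v j * tail a j * head x) _)
                  (+-congʳ (sym (*-distribʳ-sum (head x) (λ j → v j * tail a j)))))) ⟩
    head a * head x + (⟨ v , tail a ⟩ * head x + ⟨ tail a , tail x ⟩)
      ≈⟨ solve 4 (λ a x s t → a :* x :+ (s :* x :+ t) := (a :+ s) :* x :+ t) refl (head a) (head x) _ _ ⟩
    (head a + ⟨ v , tail a ⟩) * head x + ⟨ tail a , tail x ⟩ ∎

  spreading gathering : ∀ {n} → Vector K n → ColumnOperation (suc n)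
  spreading v = record
    { to = spread v
    ; from = λ x → head x ∷ λ j → tail x j + - (v j * head x)
    ; adjoint = gather v
    ; to-cong = λ {x} {y} x≋y → ∷-cong {t = tail (spread v y)} (x≋y zero) λ j → +-cong (x≋y (suc j)) (*-congˡ (x≋y zero))
    ; from-cong = λ x≋y → ∷-cong (x≋y zero) λ j → +-cong (x≋y (suc j)) (-‿cong (*-congˡ (x≋y zero)))
    ; to-from = λ { x zero → refl ; x (suc j) → x-y+y _ _ }
    ; from-to = λ { x zero → refl ; x (suc j) → x+y-y _ _ }
    ; ⟨⟩-adjoint = spread-gather-adjoint v
    ; det-to = det-spread v
    ; det-adjoint = det-gather v
    }
  gathering v = record
    { to = gather v
    ; from = λ x → (head x + - ⟨ v , tail x ⟩) ∷ tail x
    ; adjoint = spread v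
    ; to-cong = λ x≋y → ∷-cong (+-cong (x≋y zero) (⟨⟩-cong {x = v} (λ _ → refl) (x≋y ∘ suc))) (x≋y ∘ suc)
    ; from-cong = λ x≋y → ∷-cong (+-cong (x≋y zero) (-‿cong (⟨⟩-cong {x = v} (λ _ → refl) (x≋y ∘ suc)))) (x≋y ∘ suc)
    ; to-from = λ { x zero → x-y+y _ _ ; x (suc j) → refl }
    ; from-to = λ { x zero → x+y-y _ _ ; x (suc j) → refl }
    ; ⟨⟩-adjoint = λ a x → trans (⟨⟩-comm a (gather v x))
        (trans (sym (spread-gather-adjoint v x a)) (⟨⟩-comm x (spread v a)))
    ; det-to = det-gather v
    ; det-adjoint = det-spread v
    }

-- Linear algebra over a finite field: exhaustive search and the clearing of a row.

module FiniteFieldLinearAlgebra {c ℓ q} (k : FiniteField c ℓ q) where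

  open FiniteField k hiding (zero) renaming (Carrier to K)
  open LinearAlgebra commutativeRing
  open Determinants commutativeRing
  open SemiringSolver commutativeSemiring using (solve; _:*_; _:=_)
  open SetoidReasoning setoid
  private module enumeration = Inverse enumeration

  -- Total, with `inv 0# = 0#`: for `a ≉ 0#` the map `t ↦ a * inv t` is then an involution of all of
  -- `K`, so it can reindex sums over `K`.
  inv : K → K
  inv x with x ≟ 0#
  ... | yes _  = 0#
  ... | no x≉0 = proj₁ (inverse x x≉0)

  *-inv : ∀ {x} → ¬ x ≈ 0# → x * inv x ≈ 1#
  *-inv {x} x≉0 with x ≟ 0#
  ... | yes x≈0 = contradiction x≈0 x≉0
  ... | no x≉0  = proj₂ (inverse x x≉0)

  *-cancelˡ : ∀ {x y z} → ¬ x ≈ 0# → x * y ≈ x * z → y ≈ z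
  *-cancelˡ {x} {y} {z} x≉0 xy≈xz = trans (sym (undo y)) (trans (*-congˡ xy≈xz) (undo z))
    where
    undo : ∀ y → inv x * (x * y) ≈ y
    undo y = trans (sym (*-assoc _ _ _))
      (trans (*-congʳ (trans (*-comm _ _) (*-inv x≉0))) (*-identityˡ y))

  *-nonzero : ∀ {x y} → ¬ x ≈ 0# → ¬ y ≈ 0# → ¬ x * y ≈ 0#
  *-nonzero x≉0 y≉0 xy≈0 = y≉0 (*-cancelˡ x≉0 (trans xy≈0 (sym (zeroʳ _))))

  inv-nonzero : ∀ {x} → ¬ x ≈ 0# → ¬ inv x ≈ 0#
  inv-nonzero x≉0 inv≈0 = 0≉1 (trans (sym (zeroʳ _)) (trans (*-congˡ (sym inv≈0)) (*-inv x≉0)))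

  *-inv-cancel : ∀ {x} y → ¬ x ≈ 0# → x * (y * inv x) ≈ y
  *-inv-cancel {x} y x≉0 = begin
    x * (y * inv x)  ≈⟨ solve 3 (λ x y i → x :* (y :* i) := (x :* i) :* y) refl x y (inv x) ⟩
    (x * inv x) * y  ≈⟨ *-congʳ (*-inv x≉0) ⟩
    1# * y           ≈⟨ *-identityˡ y ⟩
    y                ∎

  inv-cong : ∀ {x y} → x ≈ y → inv x ≈ inv y
  inv-cong {x} {y} x≈y with x ≟ 0# | y ≟ 0#
  ... | yes _   | yes _   = refl
  ... | yes x≈0 | no y≉0  = contradiction (trans (sym x≈y) x≈0) y≉0
  ... | no x≉0  | yes y≈0 = contradiction (trans x≈y y≈0) x≉0
  ... | no x≉0  | no y≉0  = *-cancelˡ x≉0 (trans (proj₂ (inverse x x≉0))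
    (sym (trans (*-congʳ x≈y) (proj₂ (inverse y y≉0)))))

  any? : ∀ {p} {P : Pred K p} → (∀ {x y} → x ≈ y → P x → P y) → Unary.Decidable P → Dec (∃ P)
  any? resp P? = map′ (λ (i , p) → enumeration.to i , p)
    (λ (x , p) → enumeration.from x , resp (sym (enumeration.inverseˡ ≡.refl)) p)
    (Fin.any? (P? ∘ enumeration.to))

  anyVector? : ∀ {n p} {P : Pred (Vector K n) p} → (∀ {x y} → x ≋ y → P x → P y) →
               Unary.Decidable P → Dec (∃ P)
  anyVector? {zero} resp P? = map′ (λ p → Vector.[] , p) (λ (x , p) → resp (λ ()) p) (P? Vector.[])
  anyVector? {suc n} {P = P} resp P? = map′ (λ (x , t , p) → x ∷ t , p)
    (λ (x , p) → head x , tail x , resp (λ { zero → refl ; (suc i) → refl }) p)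
    (any? (λ x≈y (t , p) → t , resp (∷-cong x≈y λ _ → refl) p)
          (λ x → anyVector? (λ s≋t → resp (∷-cong refl s≋t)) λ t → P? (x ∷ t)))

  Kernel : ∀ {m n} → Matrix m n → Pred (Vector K n) ℓ
  Kernel A x = ∀ i → ⟨ A i , x ⟩ ≈ 0#

  Kernel? : ∀ {m n} (A : Matrix m n) → Unary.Decidable (Kernel A)
  Kernel? A x = Fin.all? λ i → ⟨ A i , x ⟩ ≟ 0#

  Kernel-resp : ∀ {m n} (A : Matrix m n) {x y} → x ≋ y → Kernel A x → Kernel A y
  Kernel-resp A x≋y Ax≈0 i = trans (sym (⟨⟩-cong {x = A i} (λ _ → refl) x≋y)) (Ax≈0 i)

  -- The dichotomy behind the induction, decided by searching the finite space of vectors.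
  vanishes-on-kernel? : ∀ {m n} (A : Matrix m n) (w : Vector K n) →
    (∃ λ x → Kernel A x × ¬ ⟨ w , x ⟩ ≈ 0#) ⊎ (∀ x → Kernel A x → ⟨ w , x ⟩ ≈ 0#)
  vanishes-on-kernel? A w
    with anyVector? {P = λ x → Kernel A x × ¬ ⟨ w , x ⟩ ≈ 0#}
           (λ x≋y (Ax≈0 , wx≉0) → Kernel-resp A x≋y Ax≈0 ,
              λ wy≈0 → wx≉0 (trans (⟨⟩-cong {x = w} (λ _ → refl) x≋y) wy≈0))
           (λ x → Kernel? A x ×-dec ¬? (⟨ w , x ⟩ ≟ 0#))
  ... | yes found = inj₁ found
  ... | no  none  = inj₂ λ x Ax≈0 → decidable-stable (⟨ w , x ⟩ ≟ 0#) λ wx≉0 → none (x , Ax≈0 , wx≉0)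

  infix 4 _≋?_
  _≋?_ : ∀ {n} (x y : Vector K n) → Dec (x ≋ y)
  x ≋? y = Fin.all? λ i → x i ≟ y i

  nonzero-entry : ∀ {n} (x : Vector K n) → ¬ x ≋ 0ᵛ → ∃ λ i → ¬ x i ≈ 0#
  nonzero-entry x x≉0 = Fin.¬∀⟶∃¬ _ _ (λ i → x i ≟ 0#) x≉0

  ⟨⟩-scalar-unit : ∀ {n} (i : Fin n) t → ∃ λ v → ∀ x → ⟨ v , x ⟩ ≈ t * x i
  ⟨⟩-scalar-unit {suc n} zero t = (t ∷ 0ᵛ) , λ x →
    trans (+-congˡ (sum-zero {x = λ j → 0# * x (suc j)} λ j → zeroˡ _)) (+-identityʳ _)
  ⟨⟩-scalar-unit {suc n} (suc i) t with ⟨⟩-scalar-unit i t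
  ... | v , v-unit = (0# ∷ v) , λ x → trans (+-cong (zeroˡ _) (v-unit (tail x))) (+-identityˡ _)

  -- Directed from the cleared row to `x`: rows of `X` are substituted as images under `to`, and its
  -- `adjoint` is what then acts on `U`.
  record Clearing {n} (x : Vector K (suc n)) : Set (c ⊔ ℓ) where
    field
      operation : ColumnOperation (suc n)
      pivot     : K
      pivot≉0   : ¬ pivot ≈ 0#
      clears    : ColumnOperation.to operation (pivot ∷ 0ᵛ) ≋ x

  clearing : ∀ {n} (x : Vector K (suc n)) → ¬ x ≋ 0ᵛ → Clearing x
  clearing x x≉0 with tail x ≋? 0ᵛ
  ... | yes x′≈0 = record
    -- This acts as the identity: `x` is already cleared, with its own head as pivot.
    { operation = spreading 0ᵛ
    ; pivot     = head x
    ; pivot≉0   = λ x₀≈0 → x≉0 λ { zero → x₀≈0 ; (suc i) → x′≈0 i }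
    ; clears    = λ { zero → refl ; (suc i) → trans (+-identityˡ _) (trans (zeroˡ _) (sym (x′≈0 i))) }
    }
  ... | no x′≉0 with nonzero-entry (tail x) x′≉0
  -- Spreading turns `1# ∷ 0ᵛ` into `1# ∷ tail x`; gathering must then add `head x - 1#`, so `v` is
  -- a multiple of a unit vector with that value on `tail x`.
  ... | i , xᵢ≉0 with ⟨⟩-scalar-unit i ((head x + - 1#) * inv (tail x i))
  ... | v , v-unit = record
    { operation = gathering v ∘ᶜ spreading (tail x)
    ; pivot     = 1#
    ; pivot≉0   = 0≉1 ∘ sym
    ; clears    = λ { zero → trans (+-congˡ (trans (⟨⟩-cong {x = v} (λ _ → refl) spread≋) (trans (v-unit (tail x)) cancel)))
                               (trans (+-comm _ _) (trans (+-assoc _ _ _) (trans (+-congˡ (-‿inverseˡ _)) (+-identityʳ _))))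
                    ; (suc j) → spread≋ j }
    }
    where
    spread≋ : (λ j → 0# + tail x j * 1#) ≋ tail x
    spread≋ j = trans (+-identityˡ _) (*-identityʳ _)
    cancel : (head x + - 1#) * inv (tail x i) * tail x i ≈ head x + - 1#
    cancel = trans (*-assoc _ _ _) (trans (*-congˡ (trans (*-comm _ _) (*-inv xᵢ≉0))) (*-identityʳ _))

  module _ {m n} (g : ColumnOperation (suc n)) (A : Matrix m (suc n)) where
    open ColumnOperation g

    clearedColumn : Vector K m
    clearedColumn i = adjoint (A i) zero

    clearedMinor : Matrix m n
    clearedMinor i j = adjoint (A i) (suc j)

  module _ {n} {x : Vector K (suc n)} (cl : Clearing x) where
    open Clearing cl
    open ColumnOperation operation

    -- Pairing with the preimage `pivot ∷ 0ᵛ` of `x` sees only the first coordinate. Hence the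
    -- cleared column is the vector of values at `x`, up to the factor `pivot`, and vanishes exactly
    -- on the kernel.
    adjoint-zero : ∀ a → adjoint a zero * pivot ≈ ⟨ a , x ⟩
    adjoint-zero a = begin
      adjoint a zero * pivot            ≈⟨ +-identityʳ _ ⟨
      adjoint a zero * pivot + 0#       ≈⟨ +-congˡ (⟨⟩-zeroʳ (tail (adjoint a)) {0ᵛ} (λ _ → refl)) ⟨
      ⟨ adjoint a , pivot ∷ 0ᵛ ⟩        ≈⟨ ⟨⟩-adjoint a (pivot ∷ 0ᵛ) ⟨
      ⟨ a , to (pivot ∷ 0ᵛ) ⟩           ≈⟨ ⟨⟩-cong {x = a} (λ _ → refl) clears ⟩
      ⟨ a , x ⟩                         ∎

    clearedColumn≈0⇒Kernel : ∀ {m} (A : Matrix m (suc n)) → clearedColumn operation A ≋ 0ᵛ → Kernel A x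
    clearedColumn≈0⇒Kernel A A₀≈0 i = trans (sym (adjoint-zero (A i))) (trans (*-congʳ (A₀≈0 i)) (zeroˡ _))

    Kernel⇒clearedColumn≈0 : ∀ {m} (A : Matrix m (suc n)) → Kernel A x → clearedColumn operation A ≋ 0ᵛ
    Kernel⇒clearedColumn≈0 A Ax≈0 i = *-cancelˡ pivot≉0
      (trans (*-comm _ _) (trans (adjoint-zero (A i)) (trans (Ax≈0 i) (sym (zeroʳ _)))))

    -- The adjoint operation keeps the determinant, and because `A` kills `x` it leaves a first
    -- column with only its top entry.
    det-clearedMinor : ∀ (w : Vector K (suc n)) (A : Matrix n (suc n)) → Kernel A x →
      det (w ∷ A) * pivot ≈ ⟨ w , x ⟩ * det (clearedMinor operation A)
    det-clearedMinor w A Ax≈0 = begin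
      det (w ∷ A) * pivot
        ≈⟨ *-congʳ (det-adjoint (w ∷ A)) ⟨
      det (λ i → adjoint ((w ∷ A) i)) * pivot
        ≈⟨ *-congʳ (det-clearedColumn (λ i → adjoint ((w ∷ A) i)) (Kernel⇒clearedColumn≈0 A Ax≈0)) ⟩
      adjoint w zero * det (clearedMinor operation A) * pivot
        ≈⟨ solve 3 (λ a d p → (a :* d) :* p := (a :* p) :* d) refl _ _ _ ⟩
      adjoint w zero * pivot * det (clearedMinor operation A)
        ≈⟨ *-congʳ (adjoint-zero w) ⟩
      ⟨ w , x ⟩ * det (clearedMinor operation A) ∎

    ⟨⟩-clearedMinor : ∀ {m} (A : Matrix m (suc n)) → Kernel A x → ∀ a b i →
      ⟨ A i , to (a ∷ b) ⟩ ≈ ⟨ clearedMinor operation A i , b ⟩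
    ⟨⟩-clearedMinor A Ax≈0 a b i = begin
      ⟨ A i , to (a ∷ b) ⟩
        ≈⟨ ⟨⟩-adjoint (A i) (a ∷ b) ⟩
      adjoint (A i) zero * a + ⟨ clearedMinor operation A i , b ⟩
        ≈⟨ +-congʳ (trans (*-congʳ (Kernel⇒clearedColumn≈0 A Ax≈0 i)) (zeroˡ a)) ⟩
      0# + ⟨ clearedMinor operation A i , b ⟩
        ≈⟨ +-identityˡ _ ⟩
      ⟨ clearedMinor operation A i , b ⟩ ∎

-- Sums over vectors and sizes of kernels, with values in any commutative semiring.

module FiniteFieldSums {c ℓ q r ℓr} (k : FiniteField c ℓ q) (R : CommutativeSemiring r ℓr) where

  private
    module k = FiniteField k
  open k using (elements; 0#; 1#) renaming (Carrier to K; _≈_ to _≈ᵏ_; _≟_ to _≟ᵏ_)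
  open LinearAlgebra k.commutativeRing using (Matrix)
  open Determinants k.commutativeRing
  open FiniteFieldLinearAlgebra k
  open SemiringSolver k.commutativeSemiring using (solve; _:+_; _:*_; _:=_)
  private
    module R = CommutativeSemiring R
  open R using (_≈_; _+_; _*_) renaming (Carrier to A)
  open FiniteSums R
  open SemiringSum R.semiring using (sum; sum-cong-≋)
  open SemiringExp R.semiring using (_^_)
  open SetoidReasoning R.setoid
  private module enumeration = Inverse k.enumeration

  Respects : ∀ {n} → (Vector K n → A) → Set _
  Respects f = ∀ {x y} → x ≋ y → f x ≈ f y

  fieldEnumeration : Enumeration k.setoid
  fieldEnumeration = record
    { _≟_   = _≟ᵏ_
    ; list  = elements
    ; ∑-𝟙-≟ = λ x → R.trans (∑-tabulate enumeration.to λ y → 𝟙 (y ≟ᵏ x)) $ R.trans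
        (sum-cong-≋ λ i → 𝟙-cong (enumeration.to i ≟ᵏ x) (i Fin.≟ enumeration.from x)
          (λ i≈x → ≡.sym (enumeration.inverseʳ (k.sym i≈x)))
          (λ i≡x → enumeration.inverseˡ i≡x))
        (sum-𝟙-≡ (enumeration.from x))
    }

  vectorEnumeration : ∀ n → Enumeration (k.setoid ^ˢ n)
  vectorEnumeration = tuplesEnumeration fieldEnumeration

  vectors : ∀ n → List (Vector K n)
  vectors n = tuples elements n

  ∑ᵏ : (K → A) → A
  ∑ᵏ = ∑ elements

  ∑ᵛ : ∀ {n} → (Vector K n → A) → A
  ∑ᵛ {n} = ∑ (vectors n)

  ∑ᵛ-cong : ∀ n {f g : Vector K n → A} → (∀ x → f x ≈ g x) → ∑ᵛ f ≈ ∑ᵛ g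
  ∑ᵛ-cong n f≈g = ∑-cong f≈g (vectors n)

  ∑ᵏ-cong : ∀ {f g : K → A} → (∀ x → f x ≈ g x) → ∑ᵏ f ≈ ∑ᵏ g
  ∑ᵏ-cong f≈g = ∑-cong f≈g elements

  |K| : A
  |K| = ∑ᵏ λ _ → R.1#

  ∑ᵛ-1 : ∀ n → ∑ᵛ {n} (λ _ → R.1#) ≈ |K| ^ n
  ∑ᵛ-1 zero    = R.+-identityʳ _
  ∑ᵛ-1 (suc n) = begin
    ∑ᵛ {suc n} (λ _ → R.1#)              ≈⟨ ∑-tuples elements n _ ⟩
    ∑ᵏ (λ _ → ∑ᵛ {n} λ _ → R.1#)         ≈⟨ ∑ᵏ-cong (λ _ → R.trans (∑ᵛ-1 n) (R.sym (R.*-identityˡ _))) ⟩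
    ∑ᵏ (λ _ → R.1# * |K| ^ n)            ≈⟨ ∑-* (|K| ^ n) _ elements ⟨
    |K| * |K| ^ n                        ∎

  -- Takes the place of the nullity: in ℕ it is `q` to that power, in the target ring it is a factor
  -- of the sums.
  #kernel : ∀ {m n} → Matrix m n → A
  #kernel B = ∑ᵛ λ x → 𝟙 (Kernel? B x)

  _+ᵛ_·_ : ∀ {n} → Vector K n → K → Vector K n → Vector K n
  (x +ᵛ t · y) i = x i k.+ t k.* y i

  ⟨⟩-+-zero : ∀ {n} (a x y : Vector K n) t → ⟨ a , y ⟩ ≈ᵏ 0# → ⟨ a , x +ᵛ t · y ⟩ ≈ᵏ ⟨ a , x ⟩
  ⟨⟩-+-zero a x y t ay≈0 = k.trans (⟨⟩-+ a x y t)
    (k.trans (k.+-congˡ (k.trans (k.*-congˡ ay≈0) (k.zeroʳ t))) (k.+-identityʳ _))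

  ∑ᵛ-translate : ∀ {n} (x₀ : Vector K n) t (f : Vector K n → A) → Respects f →
    ∑ᵛ (λ x → f (x +ᵛ t · x₀)) ≈ ∑ᵛ f
  ∑ᵛ-translate {n} x₀ t f f-cong = ∑-reindex (vectorEnumeration n) (vectorEnumeration n)
    (_+ᵛ t · x₀) (_+ᵛ k.- t · x₀)
    (λ x y x≈ i → k.trans (k.+-congʳ (x≈ i)) (cancel (y i) (k.- t) t (x₀ i) (k.-‿inverseˡ t)))
    (λ x y ≈y i → k.trans (k.sym (cancel (x i) t (k.- t) (x₀ i) (k.-‿inverseʳ t))) (k.+-congʳ (≈y i)))
    f f-cong
    where
    cancel : ∀ y s t x → s k.+ t ≈ᵏ 0# → (y k.+ s k.* x) k.+ t k.* x ≈ᵏ y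
    cancel y s t x s+t≈0 = k.trans
      (solve 4 (λ y s t x → (y :+ s :* x) :+ t :* x := y :+ (s :+ t) :* x) k.refl y s t x)
      (k.trans (k.+-congˡ (k.trans (k.*-congʳ s+t≈0) (k.zeroˡ x))) (k.+-identityʳ y))

  𝟙-Kernel-∷ : ∀ {m n} (w : Vector K n) (B : Matrix m n) x →
    𝟙 (Kernel? (w ∷ B) x) ≈ 𝟙 (Kernel? B x) * 𝟙 (⟨ w , x ⟩ ≟ᵏ 0#)
  𝟙-Kernel-∷ w B x = R.trans
    (𝟙-cong (Kernel? (w ∷ B) x) (Kernel? B x ×-dec (⟨ w , x ⟩ ≟ᵏ 0#))
      (λ Cx≈0 → Cx≈0 ∘ suc , Cx≈0 zero) λ (Bx≈0 , wx≈0) → λ { zero → wx≈0 ; (suc i) → Bx≈0 i })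
    (𝟙-× (Kernel? B x) (⟨ w , x ⟩ ≟ᵏ 0#))

  -- The values of a nonzero linear form on a subspace are equidistributed.
  ∑-kernel : ∀ {m n} (B : Matrix m n) (w x₀ : Vector K n) → Kernel B x₀ → ¬ ⟨ w , x₀ ⟩ ≈ᵏ 0# →
    ∀ (f : K → A) → (∀ {s t} → s ≈ᵏ t → f s ≈ f t) →
    ∑ᵛ (λ x → 𝟙 (Kernel? B x) * f ⟨ w , x ⟩) ≈ #kernel (w ∷ B) * ∑ᵏ f
  ∑-kernel {n = n} B w x₀ Bx₀≈0 wx₀≉0 f f-cong = begin
    ∑ᵛ (λ x → 𝟙 (Kernel? B x) * f ⟨ w , x ⟩)
      ≈⟨ ∑ᵛ-cong n (λ x → R.*-congˡ (R.sym (E.∑-δ ⟨ w , x ⟩ f f-cong))) ⟩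
    ∑ᵛ (λ x → 𝟙 (Kernel? B x) * ∑ᵏ λ t → 𝟙 (t ≟ᵏ ⟨ w , x ⟩) * f t)
      ≈⟨ ∑ᵛ-cong n (λ x → R.trans (*-∑ _ _ elements) (∑ᵏ-cong λ t → R.sym (R.*-assoc _ _ _))) ⟩
    ∑ᵛ (λ x → ∑ᵏ λ t → 𝟙 (Kernel? B x) * 𝟙 (t ≟ᵏ ⟨ w , x ⟩) * f t)
      ≈⟨ ∑-swap _ (vectors n) elements ⟩
    ∑ᵏ (λ t → ∑ᵛ λ x → 𝟙 (Kernel? B x) * 𝟙 (t ≟ᵏ ⟨ w , x ⟩) * f t)
      ≈⟨ ∑ᵏ-cong (λ t → R.trans (R.sym (∑-* (f t) _ (vectors n))) (R.*-congʳ (fibre t))) ⟩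
    ∑ᵏ (λ t → #kernel (w ∷ B) * f t)
      ≈⟨ *-∑ _ f elements ⟨
    #kernel (w ∷ B) * ∑ᵏ f ∎
    where
    module E = Enumeration fieldEnumeration
    fibre : ∀ t → ∑ᵛ (λ x → 𝟙 (Kernel? B x) * 𝟙 (t ≟ᵏ ⟨ w , x ⟩)) ≈ #kernel (w ∷ B)
    fibre t = begin
      ∑ᵛ f′
        ≈⟨ ∑ᵛ-translate x₀ s f′ f′-cong ⟨
      ∑ᵛ (λ x → f′ (x +ᵛ s · x₀))
        ≈⟨ ∑ᵛ-cong n (λ x → R.trans
             (R.*-cong
               (𝟙-cong (Kernel? B (x +ᵛ s · x₀)) (Kernel? B x)
                 (λ e i → k.trans (k.sym (⟨⟩-+-zero (B i) x x₀ s (Bx₀≈0 i))) (e i))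
                 (λ e i → k.trans (⟨⟩-+-zero (B i) x x₀ s (Bx₀≈0 i)) (e i)))
               (𝟙-cong (t ≟ᵏ ⟨ w , x +ᵛ s · x₀ ⟩) (⟨ w , x ⟩ ≟ᵏ 0#)
                 (λ e → k.sym (+-cancelʳ t 0# ⟨ w , x ⟩ (k.trans (k.+-identityˡ t) (k.trans e (value x)))))
                 (λ e → k.sym (k.trans (value x) (k.trans (k.+-congʳ e) (k.+-identityˡ t))))))
             (R.sym (𝟙-Kernel-∷ w B x))) ⟩
      #kernel (w ∷ B) ∎
      where
      open GroupProperties k.+-group using () renaming (∙-cancelʳ to +-cancelʳ)
      -- Translation by `s` times `x₀` preserves the kernel of `B` and raises `⟨ w , x ⟩` by exactly
      -- `t`, so it carries the fibre over `0#` onto the fibre over `t`.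
      s = t k.* inv ⟨ w , x₀ ⟩
      value : ∀ x → ⟨ w , x +ᵛ s · x₀ ⟩ ≈ᵏ ⟨ w , x ⟩ k.+ t
      value x = k.trans (⟨⟩-+ w x x₀ s) (k.+-congˡ (k.trans (k.*-comm _ _) (*-inv-cancel t wx₀≉0)))
      f′ : Vector K n → A
      f′ x = 𝟙 (Kernel? B x) * 𝟙 (t ≟ᵏ ⟨ w , x ⟩)
      f′-cong : Respects f′
      f′-cong {x} {y} x≋y = R.*-cong
        (𝟙-cong (Kernel? B x) (Kernel? B y) (Kernel-resp B x≋y) (Kernel-resp B (k.sym ∘ x≋y)))
        (𝟙-cong (t ≟ᵏ ⟨ w , x ⟩) (t ≟ᵏ ⟨ w , y ⟩)
          (λ e → k.trans e wx≈wy) (λ e → k.trans e (k.sym wx≈wy)))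
        where
        wx≈wy = ⟨⟩-cong {x = w} (λ _ → k.refl) x≋y

  -- After the change of coordinates the first column of `B` is zero: the first coordinate is free,
  -- and the others range over the kernel of the minor.
  #kernel-clearedMinor : ∀ {m n} {x : Vector K (suc n)} (cl : Clearing x) (B : Matrix m (suc n)) → Kernel B x →
    #kernel B ≈ |K| * #kernel (clearedMinor (Clearing.operation cl) B)
  #kernel-clearedMinor {n = n} {x} cl B Bx≈0 = begin
    ∑ᵛ (λ y → 𝟙 (Kernel? B y))
      ≈⟨ ∑-reindex (vectorEnumeration (suc n)) (vectorEnumeration (suc n)) to from
           (λ y z y≈ i → k.trans (to-cong y≈ i) (to-from z i))
           (λ y z ≈z i → k.trans (k.sym (from-to y i)) (from-cong ≈z i))
           (λ y → 𝟙 (Kernel? B y))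
           (λ {y} {z} y≈z → 𝟙-cong (Kernel? B y) (Kernel? B z) (Kernel-resp B y≈z) (Kernel-resp B (k.sym ∘ y≈z))) ⟨
    ∑ᵛ (λ y → 𝟙 (Kernel? B (to y)))
      ≈⟨ ∑-tuples elements n _ ⟩
    ∑ᵏ (λ a → ∑ᵛ λ b → 𝟙 (Kernel? B (to (a ∷ b))))
      ≈⟨ ∑ᵏ-cong (λ a → R.trans (∑ᵛ-cong n λ b → 𝟙-cong (Kernel? B (to (a ∷ b))) (Kernel? (clearedMinor operation B) b)
           (λ e i → k.trans (k.sym (⟨⟩-clearedMinor cl B Bx≈0 a b i)) (e i))
           (λ e i → k.trans (⟨⟩-clearedMinor cl B Bx≈0 a b i) (e i))) (R.sym (R.*-identityˡ _))) ⟩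
    ∑ᵏ (λ _ → R.1# * #kernel (clearedMinor operation B))
      ≈⟨ ∑-* _ _ elements ⟨
    |K| * #kernel (clearedMinor operation B) ∎
    where
    open Clearing cl
    open ColumnOperation operation

  #kernel-vanishing : ∀ {m n} (w : Vector K n) (B : Matrix m n) → (∀ x → Kernel B x → ⟨ w , x ⟩ ≈ᵏ 0#) →
    #kernel (w ∷ B) ≈ #kernel B
  #kernel-vanishing {n = n} w B vanishes = ∑ᵛ-cong n λ x → 𝟙-cong (Kernel? (w ∷ B) x) (Kernel? B x)
    (_∘ suc) (λ Bx≈0 → λ { zero → vanishes x Bx≈0 ; (suc i) → Bx≈0 i })

  #kernel-nonvanishing : ∀ {m n} (w x₀ : Vector K n) (B : Matrix m n) → Kernel B x₀ → ¬ ⟨ w , x₀ ⟩ ≈ᵏ 0# →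
    #kernel B ≈ #kernel (w ∷ B) * |K|
  #kernel-nonvanishing {n = n} w x₀ B Bx₀≈0 wx₀≉0 = R.trans
    (∑ᵛ-cong n λ x → R.sym (R.*-identityʳ _))
    (∑-kernel B w x₀ Bx₀≈0 wx₀≉0 (λ _ → R.1#) (λ _ → R.refl))

  #kernel-trivial : ∀ {m n} (B : Matrix m n) → (∀ x → Kernel B x → x ≋ 0ᵛ) → #kernel B ≈ R.1#
  #kernel-trivial {n = n} B trivial = R.trans
    (∑ᵛ-cong n λ x → 𝟙-cong (Kernel? B x) (x E.≟ 0ᵛ) (trivial x)
      (λ x≈0 i → ⟨⟩-zeroʳ (B i) x≈0))
    (E.∑-𝟙-≟ 0ᵛ)
    where module E = Enumeration (vectorEnumeration n)

  #kernel-η : ∀ {m n} (B : Matrix (suc m) n) → #kernel (head B ∷ tail B) ≈ #kernel B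
  #kernel-η {n = n} B = ∑ᵛ-cong n λ x → 𝟙-cong (Kernel? (head B ∷ tail B) x) (Kernel? B x)
    (λ e → λ { zero → e zero ; (suc i) → e (suc i) }) (λ e → λ { zero → e zero ; (suc i) → e (suc i) })

-- Rank and nullity by counting.

module KernelSize {c ℓ q} (k : FiniteField c ℓ q) where

  private
    module k = FiniteField k
  open k using (0#; 1#) renaming (Carrier to K; _≈_ to _≈ᵏ_; _≟_ to _≟ᵏ_)
  open LinearAlgebra k.commutativeRing
  open Determinants k.commutativeRing
  open FiniteFieldLinearAlgebra k
  open FiniteSums ℕ.+-*-commutativeSemiring
  open FiniteFieldSums k ℕ.+-*-commutativeSemiring
  open SemiringExp ℕ.+-*-semiring using () renaming (_^_ to _^ˢᴿ_)
  open SemiringSum k.semiring using (sum; sum-cong-≋; ∑-comm; *-distribˡ-sum)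
  open SemiringSolver k.commutativeSemiring using (solve; _:+_; _:*_; _:=_)
  open GroupProperties k.+-group using () renaming (∙-cancelʳ to +-cancelʳ)
  open ≡ using (refl; sym; trans; cong; cong₂)

  |K|≡q : |K| ≡ q
  |K|≡q = trans (∑-tabulate (Inverse.to k.enumeration) (λ _ → 1)) (ones q)
    where
    ones : ∀ n → SemiringSum.sum ℕ.+-*-semiring {n} (λ _ → 1) ≡ n
    ones zero    = refl
    ones (suc n) = cong suc (ones n)

  ^ˢᴿ≡^ : ∀ m n → m ^ˢᴿ n ≡ m ℕ.^ n
  ^ˢᴿ≡^ m zero    = refl
  ^ˢᴿ≡^ m (suc n) = cong (m ℕ.*_) (^ˢᴿ≡^ m n)

  #vectors : ∀ n → ∑ᵛ {n} (λ _ → 1) ≡ q ℕ.^ n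
  #vectors n = trans (∑ᵛ-1 n) (trans (^ˢᴿ≡^ |K| n) (cong (ℕ._^ n) |K|≡q))

  ∑-mono : ∀ {a} {A : Set a} {f g : A → ℕ} → (∀ x → f x ℕ.≤ g x) → ∀ xs → ∑ xs f ℕ.≤ ∑ xs g
  ∑-mono f≤g List.[]       = ℕ.z≤n
  ∑-mono f≤g (x List.∷ xs) = ℕ.+-mono-≤ (f≤g x) (∑-mono f≤g xs)

  𝟙≤1 : ∀ {p} {P : Set p} (P? : Dec P) → 𝟙 P? ℕ.≤ 1
  𝟙≤1 (yes _) = ℕ.≤-refl
  𝟙≤1 (no _)  = ℕ.z≤n

  𝟙+𝟙≤𝟙 : ∀ {p₁ p₂ p₃} {P : Set p₁} {Q : Set p₂} {S : Set p₃} (P? : Dec P) (Q? : Dec Q) (S? : Dec S) →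
          (P → S) → (Q → S) → (P → ¬ Q) → 𝟙 P? ℕ.+ 𝟙 Q? ℕ.≤ 𝟙 S?
  𝟙+𝟙≤𝟙 (yes p) Q? S? f g h = ℕ.≤-reflexive (trans (cong suc (𝟙-no Q? (h p))) (sym (𝟙-yes S? (f p))))
  𝟙+𝟙≤𝟙 (no _) (yes q) S? f g h = ℕ.≤-reflexive (sym (𝟙-yes S? (g q)))
  𝟙+𝟙≤𝟙 (no _) (no _)  S? f g h = ℕ.z≤n

  #kernel-≤ : ∀ {m n} (B : Matrix m n) → #kernel B ℕ.≤ q ℕ.^ n
  #kernel-≤ {n = n} B = ℕ.≤-trans (∑-mono (λ x → 𝟙≤1 (Kernel? B x)) (vectors n)) (ℕ.≤-reflexive (#vectors n))

  -- The zero vector and a nonzero kernel vector would together make the count at least two.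
  #kernel≡1⇒trivial : ∀ {m n} (B : Matrix m n) → #kernel B ≡ 1 → ∀ x → Kernel B x → x ≋ 0ᵛ
  #kernel≡1⇒trivial {n = n} B #kernel≡1 x Bx≈0 = decidable-stable (x ≋? 0ᵛ) λ x≉0 →
    contradiction #kernel≡1 (ℕ.>⇒≢ (two x≉0))
    where
    module E = Enumeration (vectorEnumeration n)
    two : ¬ x ≋ 0ᵛ → 2 ℕ.≤ #kernel B
    two x≉0 = begin
      2                                                     ≡⟨ cong₂ ℕ._+_ (E.∑-𝟙-≟ 0ᵛ) (E.∑-𝟙-≟ x) ⟨
      ∑ᵛ (λ y → 𝟙 (y E.≟ 0ᵛ)) ℕ.+ ∑ᵛ (λ y → 𝟙 (y E.≟ x))    ≡⟨ ∑-+ (λ y → 𝟙 (y E.≟ 0ᵛ)) _ (vectors n) ⟨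
      ∑ᵛ (λ y → 𝟙 (y E.≟ 0ᵛ) ℕ.+ 𝟙 (y E.≟ x))               ≤⟨ ∑-mono bound (vectors n) ⟩
      #kernel B                                             ∎
      where
      open ℕ.≤-Reasoning
      bound : ∀ y → 𝟙 (y E.≟ 0ᵛ) ℕ.+ 𝟙 (y E.≟ x) ℕ.≤ 𝟙 (Kernel? B y)
      bound y = 𝟙+𝟙≤𝟙 (y E.≟ 0ᵛ) (y E.≟ x) (Kernel? B y)
        (λ y≈0 i → ⟨⟩-zeroʳ (B i) y≈0)
        (λ y≈x → Kernel-resp B (λ i → k.sym (y≈x i)) Bx≈0)
        (λ y≈0 y≈x → x≉0 λ i → k.trans (k.sym (y≈x i)) (y≈0 i))

  -- Each row divides the size of the kernel by at most `q`. With fewer rows than columns this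
  -- forces nonzero kernel vectors.
  #kernel-≥ : ∀ {m n} (B : Matrix m n) → q ℕ.^ n ℕ.≤ #kernel B ℕ.* q ℕ.^ m
  #kernel-≥ {zero} {n} B = ℕ.≤-reflexive $ sym $ trans (ℕ.*-identityʳ _) $
    trans (∑ᵛ-cong n λ x → 𝟙-yes (Kernel? B x) λ ()) (#vectors n)
  #kernel-≥ {suc m} {n} B = ℕ.≤-trans (#kernel-≥ (tail B)) (ℕ.≤-trans (ℕ.*-monoˡ-≤ (q ℕ.^ m) step)
      (ℕ.≤-reflexive (ℕ.*-assoc (#kernel B) q (q ℕ.^ m))))
    where
    step : #kernel (tail B) ℕ.≤ #kernel B ℕ.* q
    step with vanishes-on-kernel? (tail B) (head B)
    ... | inj₁ (x₀ , Bx₀≈0 , wx₀≉0) = ℕ.≤-reflexive (trans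
      (#kernel-nonvanishing (head B) x₀ (tail B) Bx₀≈0 wx₀≉0) (cong₂ ℕ._*_ (#kernel-η B) |K|≡q))
    ... | inj₂ vanishes = ℕ.≤-trans
      (ℕ.≤-reflexive (trans (sym (#kernel-vanishing (head B) (tail B) vanishes)) (trans (#kernel-η B) (sym (ℕ.*-identityʳ _)))))
      (ℕ.*-monoʳ-≤ (#kernel B) 1≤q)
      where
      1≤q : 1 ℕ.≤ q
      1≤q = ℕ.>-nonZero⁻¹ q {{Fin.nonZeroIndex (Inverse.from k.enumeration 0#)}}

  -- Count the pairs `(a , x)` for which `U x` is the combination of the basis `b` with coefficients
  -- `a`. Each `x` has exactly one `a`, since `b` is a basis of the column space; each `a` has a
  -- translate of the kernel, based at the combination of preimages of the `b j`.
  HasRank⇒#kernel : ∀ {n} (U : Matrix n n) u → HasRank U u → #kernel U ℕ.* q ℕ.^ u ≡ q ℕ.^ n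
  HasRank⇒#kernel {n} U u (b , b∈span , independent , spans) = sym $ begin
    q ℕ.^ n
      ≡⟨ #vectors n ⟨
    ∑ᵛ {n} (λ x → 1)
      ≡⟨ ∑ᵛ-cong n one ⟨
    ∑ᵛ (λ x → ∑ᵛ λ a → 𝟙 (hits? a x))
      ≡⟨ ∑-swap _ (vectors n) (vectors u) ⟩
    ∑ᵛ (λ a → ∑ᵛ λ x → 𝟙 (hits? a x))
      ≡⟨ ∑ᵛ-cong u fibre ⟩
    ∑ᵛ {u} (λ _ → #kernel U)
      ≡⟨ ∑ᵛ-cong u (λ _ → sym (ℕ.*-identityʳ _)) ⟩
    ∑ᵛ {u} (λ _ → #kernel U ℕ.* 1)
      ≡⟨ *-∑ (#kernel U) (λ _ → 1) (vectors u) ⟨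
    #kernel U ℕ.* ∑ᵛ {u} (λ _ → 1)
      ≡⟨ cong (#kernel U ℕ.*_) (#vectors u) ⟩
    #kernel U ℕ.* q ℕ.^ u ∎
    where
    open ≡.≡-Reasoning
    Hits : Vector K u → Vector K n → Set ℓ
    Hits a x = ∀ i → ⟨ U i , x ⟩ ≈ᵏ combination a b i
    hits? : ∀ a x → Dec (Hits a x)
    hits? a x = Fin.all? λ i → ⟨ U i , x ⟩ ≟ᵏ combination a b i

    combination-cong : ∀ {a a′} → a ≋ a′ → ∀ i → combination a b i ≈ᵏ combination a′ b i
    combination-cong a≋a′ i = ⟨⟩-cong {y = _} {u = λ j → b j i} a≋a′ (λ _ → k.refl)

    one : ∀ x → ∑ᵛ (λ a → 𝟙 (hits? a x)) ≡ 1
    one x = trans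
      (∑ᵛ-cong u λ a → 𝟙-cong (hits? a x) (a E.≟ a₀) (unique a) (λ a≋a₀ i → k.trans (a₀-hits i) (k.sym (combination-cong a≋a₀ i))))
      (E.∑-𝟙-≟ a₀)
      where
      module E = Enumeration (vectorEnumeration u)
      coordinates = spans (λ i → ⟨ U i , x ⟩) (x , λ i → ⟨⟩-comm (U i) x)
      a₀ = proj₁ coordinates
      a₀-hits : Hits a₀ x
      a₀-hits = proj₂ coordinates
      difference : ∀ a i → combination (λ j → a j k.+ k.- 1# k.* a₀ j) b i ≈ᵏ
                   combination a b i k.+ k.- 1# k.* combination a₀ b i
      difference a i = k.trans (⟨⟩-comm _ (λ j → b j i)) (k.trans (⟨⟩-+ (λ j → b j i) a a₀ (k.- 1#))
        (k.+-cong (⟨⟩-comm (λ j → b j i) a) (k.*-congˡ (⟨⟩-comm (λ j → b j i) a₀))))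
      minus : ∀ {y z} → y ≈ᵏ z → y k.+ k.- 1# k.* z ≈ᵏ 0#
      minus {y} {z} y≈z = k.trans (k.+-cong y≈z (RingProperties.-1*x≈-x k.ring z)) (k.-‿inverseʳ z)
      minus⁻¹ : ∀ {y z} → y k.+ k.- 1# k.* z ≈ᵏ 0# → y ≈ᵏ z
      minus⁻¹ {y} {z} e = +-cancelʳ (k.- 1# k.* z) y z (k.trans e (k.sym (minus k.refl)))
      unique : ∀ a → Hits a x → a ≋ a₀
      unique a a-hits j = minus⁻¹ (independent (λ j → a j k.+ k.- 1# k.* a₀ j)
        (λ i → k.trans (difference a i) (minus (k.trans (k.sym (a-hits i)) (a₀-hits i)))) j)

    fibre : ∀ a → ∑ᵛ (λ x → 𝟙 (hits? a x)) ≡ #kernel U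
    fibre a = trans
      (sym (∑ᵛ-translate x₀ 1# (λ x → 𝟙 (hits? a x)) λ {x} {y} x≋y →
        𝟙-cong (hits? a x) (hits? a y)
          (λ e i → k.trans (⟨⟩-cong {x = U i} (λ _ → k.refl) (k.sym ∘ x≋y)) (e i))
          (λ e i → k.trans (⟨⟩-cong {x = U i} (λ _ → k.refl) x≋y) (e i))))
      (∑ᵛ-cong n λ x → 𝟙-cong (hits? a (x +ᵛ 1# · x₀)) (Kernel? U x)
        (λ e i → +-cancelʳ (combination a b i) ⟨ U i , x ⟩ 0#
          (k.trans (k.sym (value x i)) (k.trans (e i) (k.sym (k.+-identityˡ _)))))
        (λ e i → k.trans (value x i) (k.trans (k.+-congʳ (e i)) (k.+-identityˡ _))))
      where
      preimage : ∀ j → Vector K n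
      preimage j = proj₁ (b∈span j)
      x₀ : Vector K n
      x₀ l = sum λ j → a j k.* preimage j l
      x₀-hits : Hits a x₀
      x₀-hits i = K.begin
        (sum λ l → U i l k.* sum λ j → a j k.* preimage j l)
          K.≈⟨ sum-cong-≋ (λ l → *-distribˡ-sum (U i l) (λ j → a j k.* preimage j l)) ⟩
        (sum λ l → sum λ j → U i l k.* (a j k.* preimage j l))
          K.≈⟨ ∑-comm (λ l j → U i l k.* (a j k.* preimage j l)) ⟩
        (sum λ j → sum λ l → U i l k.* (a j k.* preimage j l))
          K.≈⟨ sum-cong-≋ (λ j → k.trans
                 (sum-cong-≋ λ l → solve 3 (λ x y z → x :* (y :* z) := y :* (z :* x)) k.refl (U i l) (a j) (preimage j l))
                 (k.sym (*-distribˡ-sum (a j) (λ l → preimage j l k.* U i l)))) ⟩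
        (sum λ j → a j k.* ⟨ preimage j , U i ⟩)
          K.≈⟨ sum-cong-≋ (λ j → k.*-congˡ (proj₂ (b∈span j) i)) ⟨
        combination a b i K.∎
        where module K = SetoidReasoning k.setoid
      value : ∀ x i → ⟨ U i , x +ᵛ 1# · x₀ ⟩ ≈ᵏ ⟨ U i , x ⟩ k.+ combination a b i
      value x i = k.trans (⟨⟩-+ (U i) x x₀ 1#) (k.+-congˡ (k.trans (k.*-identityˡ _) (x₀-hits i)))

-- Orthogonality and the reduction of the matrix sum by one row and one column.

module GaussSums {c ℓ q r ℓr} (k : FiniteField c ℓ q) (R : CommutativeRing r ℓr) where

  private
    module k = FiniteField k
    module R = CommutativeRing R
  open k using (0#; 1#; elements) renaming (Carrier to K; _≈_ to _≈ᵏ_; _≟_ to _≟ᵏ_)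
  open R using (_≈_; _+_; _*_) renaming (Carrier to A)
  open LinearAlgebra k.commutativeRing
  open Determinants k.commutativeRing
  open FiniteFieldLinearAlgebra k
  open FiniteSums R.commutativeSemiring
  open FiniteFieldSums k R.commutativeSemiring
  open SemiringSum k.semiring using (sum; sum-cong-≋; ∑-distrib-+)
  open SemiringExp R.semiring using (_^_)
  open SetoidReasoning R.setoid

  private module R-Solver = SemiringSolver R.commutativeSemiring

  matrices : ∀ m n → List (Matrix m n)
  matrices m n = tuples (vectors n) m

  matrixEnumeration : ∀ m n → Enumeration ((k.setoid ^ˢ n) ^ˢ m)
  matrixEnumeration m n = tuplesEnumeration (vectorEnumeration n) m

  -- `tuples` enumerates a matrix by rows, whereas the part below a cleared row is summed as a free
  -- first column and a square remainder.
  ∑-columns : ∀ m n (f : Matrix m (suc n) → A) → (∀ {X Y} → X ≋ᴹ Y → f X ≈ f Y) →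
    ∑ (matrices m (suc n)) f ≈ ∑ᵛ λ c → ∑ (matrices m n) λ Y → f λ i → c i ∷ Y i
  ∑-columns zero n f f-cong = R.trans (R.+-congʳ (f-cong λ ())) (R.sym (R.+-identityʳ _))
  ∑-columns (suc m) n f f-cong = begin
    ∑ (matrices (suc m) (suc n)) f
      ≈⟨ ∑-tuples (vectors (suc n)) m f ⟩
    ∑ᵛ (λ x → ∑ (matrices m (suc n)) λ X → f (x ∷ X))
      ≈⟨ ∑-tuples elements n _ ⟩
    ∑ᵏ (λ x₀ → ∑ᵛ λ x → ∑ (matrices m (suc n)) λ X → f ((x₀ ∷ x) ∷ X))
      ≈⟨ ∑ᵏ-cong (λ x₀ → R.trans
           (∑ᵛ-cong n λ x → ∑-columns m n (λ X → f ((x₀ ∷ x) ∷ X)) λ X≋Y → f-cong (∷-congᴹ (λ _ → k.refl) X≋Y))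
           (∑-swap _ (vectors n) (vectors m))) ⟩
    ∑ᵏ (λ x₀ → ∑ᵛ λ c → ∑ᵛ λ x → ∑ (matrices m n) λ Y → f ((x₀ ∷ x) ∷ λ i → c i ∷ Y i))
      ≈⟨ ∑ᵏ-cong (λ x₀ → ∑ᵛ-cong m λ c → R.trans
           (∑ᵛ-cong n λ x → ∑-cong (λ Y → f-cong λ { zero j → k.refl ; (suc i) j → k.refl }) (matrices m n))
           (R.sym (∑-tuples (vectors n) m _))) ⟩
    ∑ᵏ (λ x₀ → ∑ᵛ λ c → ∑ (matrices (suc m) n) λ Y → f λ i → (x₀ ∷ c) i ∷ Y i)
      ≈⟨ ∑-tuples elements m _ ⟨
    ∑ᵛ (λ c → ∑ (matrices (suc m) n) λ Y → f λ i → c i ∷ Y i) ∎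

  module Character (ψ : K → A)
    (ψ-cong : ∀ {x y} → x ≈ᵏ y → ψ x ≈ ψ y)
    (ψ-+ : ∀ x y → ψ (x k.+ y) ≈ ψ x * ψ y)
    (ψ-0 : ψ 0# ≈ R.1#)
    (∑ψ≈0 : ∑ᵏ ψ ≈ R.0#)
    where

    ∑ᵏ-scale : ∀ {a} → ¬ a ≈ᵏ 0# → (f : K → A) → (∀ {x y} → x ≈ᵏ y → f x ≈ f y) →
               ∑ᵏ (λ t → f (a k.* t)) ≈ ∑ᵏ f
    ∑ᵏ-scale {a} a≉0 f f-cong = ∑-reindex fieldEnumeration fieldEnumeration (a k.*_) (λ t → t k.* inv a)
      (λ s t s≈ → k.trans (k.*-congˡ s≈) (*-inv-cancel t a≉0))
      (λ s t ≈t → *-cancelˡ a≉0 (k.trans ≈t (k.sym (*-inv-cancel t a≉0))))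
      f f-cong

    ∑ψ-scaled : ∀ a → ∑ᵏ (λ t → ψ (a k.* t)) ≈ |K| * 𝟙 (a ≟ᵏ 0#)
    ∑ψ-scaled a = scaled (a ≟ᵏ 0#)
      where
      scaled : Dec (a ≈ᵏ 0#) → ∑ᵏ (λ t → ψ (a k.* t)) ≈ |K| * 𝟙 (a ≟ᵏ 0#)
      scaled (yes a≈0) = R.trans
        (∑ᵏ-cong λ t → R.trans (ψ-cong (k.trans (k.*-congʳ a≈0) (k.zeroˡ t))) ψ-0)
        (R.sym (R.trans (R.*-congˡ (𝟙-yes (a ≟ᵏ 0#) a≈0)) (R.*-identityʳ |K|)))
      scaled (no a≉0) = R.trans (R.trans (∑ᵏ-scale a≉0 ψ ψ-cong) ∑ψ≈0)
        (R.sym (R.trans (R.*-congˡ (𝟙-no (a ≟ᵏ 0#) a≉0)) (R.zeroʳ |K|)))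

    -- Orthogonality of characters, one coordinate at a time. Applied to the free column, it
    -- annihilates all first rows outside the kernel.
    ∑ψ-⟨⟩ : ∀ {n} (a : Vector K n) → ∑ᵛ (λ c → ψ ⟨ a , c ⟩) ≈ |K| ^ n * 𝟙 (a ≋? 0ᵛ)
    ∑ψ-⟨⟩ {zero} a = R.trans (R.+-identityʳ _) (R.trans ψ-0
      (R.sym (R.trans (R.*-identityˡ _) (𝟙-yes (a ≋? 0ᵛ) λ ()))))
    ∑ψ-⟨⟩ {suc n} a = begin
      ∑ᵛ (λ c → ψ ⟨ a , c ⟩)
        ≈⟨ ∑-tuples elements n _ ⟩
      ∑ᵏ (λ c₀ → ∑ᵛ λ c → ψ (head a k.* c₀ k.+ ⟨ tail a , c ⟩))
        ≈⟨ ∑ᵏ-cong (λ c₀ → R.trans (∑ᵛ-cong n λ c → ψ-+ _ _) (R.sym (*-∑ _ _ (vectors n)))) ⟩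
      ∑ᵏ (λ c₀ → ψ (head a k.* c₀) * ∑ᵛ λ c → ψ ⟨ tail a , c ⟩)
        ≈⟨ ∑-* _ _ elements ⟨
      ∑ᵏ (λ c₀ → ψ (head a k.* c₀)) * ∑ᵛ (λ c → ψ ⟨ tail a , c ⟩)
        ≈⟨ R.*-cong (∑ψ-scaled (head a)) (∑ψ-⟨⟩ (tail a)) ⟩
      (|K| * 𝟙 (head a ≟ᵏ 0#)) * (|K| ^ n * 𝟙 (tail a ≋? 0ᵛ))
        ≈⟨ R-Solver.solve 4 (λ a b c d → (a R-Solver.:* b) R-Solver.:* (c R-Solver.:* d)
             R-Solver.:= (a R-Solver.:* c) R-Solver.:* (b R-Solver.:* d)) R.refl _ _ _ _ ⟩
      (|K| * |K| ^ n) * (𝟙 (head a ≟ᵏ 0#) * 𝟙 (tail a ≋? 0ᵛ))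
        ≈⟨ R.*-congˡ (𝟙-× (head a ≟ᵏ 0#) (tail a ≋? 0ᵛ)) ⟨
      (|K| * |K| ^ n) * 𝟙 ((head a ≟ᵏ 0#) ×-dec (tail a ≋? 0ᵛ))
        ≈⟨ R.*-congˡ (𝟙-cong ((head a ≟ᵏ 0#) ×-dec (tail a ≋? 0ᵛ)) (a ≋? 0ᵛ)
             (λ (e₀ , e) → λ { zero → e₀ ; (suc i) → e i }) (λ e → e zero , e ∘ suc)) ⟩
      |K| ^ suc n * 𝟙 (a ≋? 0ᵛ) ∎

    ∙-congʳ : ∀ {m n} (U : Matrix m n) {X Y} → X ≋ᴹ Y → U ∙ X ≈ᵏ U ∙ Y
    ∙-congʳ U X≋Y = sum-cong-≋ λ i → ⟨⟩-cong {x = U i} (λ _ → k.refl) (X≋Y i)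

    -- G-SL is the case y = 1.
    G : ∀ n → Matrix n n → K → A
    G n U y = ∑ (matrices n n) λ X → 𝟙 (det X ≟ᵏ y) * ψ (U ∙ X)

    G-firstRow : ∀ {n} → Matrix (suc n) (suc n) → K → Vector K (suc n) → A
    G-firstRow {n} U y x = ∑ (matrices n (suc n)) λ X → 𝟙 (det (x ∷ X) ≟ᵏ y) * ψ (U ∙ (x ∷ X))

    G-rows : ∀ n (U : Matrix (suc n) (suc n)) y → G (suc n) U y ≈ ∑ᵛ (G-firstRow U y)
    G-rows n U y = ∑-tuples (vectors (suc n)) n _

    G-firstRow-zero : ∀ {n} (U : Matrix (suc n) (suc n)) {y x} → ¬ y ≈ᵏ 0# → x ≋ 0ᵛ →
                      G-firstRow U y x ≈ R.0#
    G-firstRow-zero {n} U {y} {x} y≉0 x≈0 = ∑-vanish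
      (λ X → 𝟙*-no (det (x ∷ X) ≟ᵏ y) (λ e → y≉0 (k.trans (k.sym e) (det≈0 X))) _) (matrices n (suc n))
      where
      det≈0 : ∀ X → det (x ∷ X) ≈ᵏ 0#
      det≈0 X = k.trans (det-clearedRow (x ∷ X) (x≈0 ∘ suc)) (k.trans (k.*-congʳ (x≈0 zero)) (k.zeroˡ _))

    module _ {n} (U : Matrix (suc n) (suc n)) {x : Vector K (suc n)} (cl : Clearing x) where
      open Clearing cl
      open ColumnOperation operation

      private
        a = clearedColumn operation (tail U)
        M = clearedMinor operation (tail U)

      det-cleared : ∀ (c : Vector K n) (Y : Matrix n n) →
        det (x ∷ λ i → to (c i ∷ Y i)) ≈ᵏ pivot k.* det Y
      det-cleared c Y = k.trans
        (det-cong {A = x ∷ λ i → to (c i ∷ Y i)} {B = λ i → to (Z i)}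
          λ { zero → k.sym ∘ clears ; (suc i) j → k.refl })
        (k.trans (det-to Z) (det-clearedRow Z λ _ → k.refl))
        where
        Z : Matrix (suc n) (suc n)
        Z = (pivot ∷ 0ᵛ) ∷ λ i → c i ∷ Y i

      ∙-cleared : ∀ (c : Vector K n) (Y : Matrix n n) →
        U ∙ (x ∷ λ i → to (c i ∷ Y i)) ≈ᵏ ⟨ head U , x ⟩ k.+ (⟨ a , c ⟩ k.+ M ∙ Y)
      ∙-cleared c Y = k.+-congˡ (k.trans
        (sum-cong-≋ λ i → ⟨⟩-adjoint (tail U i) (c i ∷ Y i))
        (∑-distrib-+ (λ i → a i k.* c i) (λ i → ⟨ M i , Y i ⟩)))

      -- Under the substitution the determinant becomes `pivot * det Y`, which is how a parameter
      -- other than `1#` arises. The phase splits into the constant `⟨ head U , x ⟩`, a part linear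
      -- in the free column, and the pairing of the minors.
      G-firstRow-cleared : ∀ y → G-firstRow U y x ≈
        (𝟙 (Kernel? (tail U) x) * ψ ⟨ head U , x ⟩) * (|K| ^ n * G n M (y k.* inv pivot))
      G-firstRow-cleared y = begin
        ∑ (matrices n (suc n)) f
          ≈⟨ ∑-reindex (matrixEnumeration n (suc n)) (matrixEnumeration n (suc n)) (to ∘_) (from ∘_)
               (λ X Y X≈ i j → k.trans (to-cong (X≈ i) j) (to-from (Y i) j))
               (λ X Y ≈Y i j → k.trans (k.sym (from-to (X i) j)) (from-cong (≈Y i) j))
               f f-cong ⟨
        ∑ (matrices n (suc n)) (λ X → f (to ∘ X))
          ≈⟨ ∑-columns n n (λ X → f (to ∘ X)) (λ X≋Y → f-cong λ i → to-cong (X≋Y i)) ⟩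
        ∑ᵛ (λ c → ∑ (matrices n n) λ Y → f λ i → to (c i ∷ Y i))
          ≈⟨ ∑ᵛ-cong n (λ c → ∑-cong (f-cleared c) (matrices n n)) ⟩
        ∑ᵛ (λ c → ∑ (matrices n n) λ Y → ψ ⟨ head U , x ⟩ * (ψ ⟨ a , c ⟩ * (𝟙 (det Y ≟ᵏ y′) * ψ (M ∙ Y))))
          ≈⟨ ∑ᵛ-cong n (λ c → R.trans (R.sym (*-∑ _ _ (matrices n n))) (R.*-congˡ (R.sym (*-∑ _ _ (matrices n n))))) ⟩
        ∑ᵛ (λ c → ψ ⟨ head U , x ⟩ * (ψ ⟨ a , c ⟩ * G n M y′))
          ≈⟨ *-∑ _ _ (vectors n) ⟨
        ψ ⟨ head U , x ⟩ * ∑ᵛ (λ c → ψ ⟨ a , c ⟩ * G n M y′)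
          ≈⟨ R.*-congˡ (∑-* (G n M y′) _ (vectors n)) ⟨
        ψ ⟨ head U , x ⟩ * (∑ᵛ (λ c → ψ ⟨ a , c ⟩) * G n M y′)
          ≈⟨ R.*-congˡ (R.*-congʳ (R.trans (∑ψ-⟨⟩ a) (R.*-congˡ (𝟙-cong (a ≋? 0ᵛ) (Kernel? (tail U) x)
               (clearedColumn≈0⇒Kernel cl (tail U)) (Kernel⇒clearedColumn≈0 cl (tail U)))))) ⟩
        ψ ⟨ head U , x ⟩ * ((|K| ^ n * 𝟙 (Kernel? (tail U) x)) * G n M y′)
          ≈⟨ R-Solver.solve 4 (λ a b c d → a R-Solver.:* ((b R-Solver.:* c) R-Solver.:* d)
             R-Solver.:= (c R-Solver.:* a) R-Solver.:* (b R-Solver.:* d)) R.refl _ _ _ _ ⟩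
        (𝟙 (Kernel? (tail U) x) * ψ ⟨ head U , x ⟩) * (|K| ^ n * G n M y′) ∎
        where
        y′ = y k.* inv pivot
        f : Matrix n (suc n) → A
        f X = 𝟙 (det (x ∷ X) ≟ᵏ y) * ψ (U ∙ (x ∷ X))
        f-cong : ∀ {X Y} → X ≋ᴹ Y → f X ≈ f Y
        f-cong {X} {Y} X≋Y = R.*-cong
          (𝟙-cong (det (x ∷ X) ≟ᵏ y) (det (x ∷ Y) ≟ᵏ y) (k.trans (k.sym det≈)) (k.trans det≈))
          (ψ-cong (∙-congʳ U x∷X≋x∷Y))
          where
          x∷X≋x∷Y : (x ∷ X) ≋ᴹ (x ∷ Y)
          x∷X≋x∷Y = ∷-congᴹ (λ _ → k.refl) X≋Y
          det≈ : det (x ∷ X) ≈ᵏ det (x ∷ Y)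
          det≈ = det-cong {A = x ∷ X} {B = x ∷ Y} x∷X≋x∷Y
        f-cleared : ∀ c Y → f (λ i → to (c i ∷ Y i)) ≈
          ψ ⟨ head U , x ⟩ * (ψ ⟨ a , c ⟩ * (𝟙 (det Y ≟ᵏ y′) * ψ (M ∙ Y)))
        f-cleared c Y = R.trans
          (R.*-cong
            (𝟙-cong (det (x ∷ λ i → to (c i ∷ Y i)) ≟ᵏ y) (det Y ≟ᵏ y′)
              (λ e → *-cancelˡ pivot≉0 (k.trans (k.sym (det-cleared c Y)) (k.trans e (k.sym (*-inv-cancel y pivot≉0)))))
              (λ e → k.trans (det-cleared c Y) (k.trans (k.*-congˡ e) (*-inv-cancel y pivot≉0))))
            (R.trans (ψ-cong (∙-cleared c Y)) (R.trans (ψ-+ _ _) (R.*-congˡ (ψ-+ _ _)))))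
          (R-Solver.solve 4 (λ a b c d → a R-Solver.:* (b R-Solver.:* (c R-Solver.:* d))
             R-Solver.:= b R-Solver.:* (c R-Solver.:* (a R-Solver.:* d))) R.refl _ _ _ _)

-- Matrices with trivial kernel, their determinants and their minors.

module NonsingularMatrices {c ℓ q} (k : FiniteField c ℓ q) where

  private
    module k = FiniteField k
  open k using (0#; 1#) renaming (Carrier to K; _≈_ to _≈ᵏ_; _≟_ to _≟ᵏ_)
  open LinearAlgebra k.commutativeRing
  open Determinants k.commutativeRing
  open FiniteFieldLinearAlgebra k
  open KernelSize k
  open FiniteFieldSums k ℕ.+-*-commutativeSemiring
  open ≡ using (refl; sym; trans; cong)

  1<q : 1 ℕ.< q
  1<q = two (from 0#) (from 1#) λ e → k.0≉1 (k.trans (k.sym (inverseˡ ≡.refl)) (inverseˡ e))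
    where
    open Inverse k.enumeration
    two : ∀ {n} (i j : Fin n) → ¬ i ≡ j → 1 ℕ.< n
    two {suc zero}    zero zero i≢j = contradiction refl i≢j
    two {suc (suc n)} _    _    _   = ℕ.s≤s (ℕ.s≤s ℕ.z≤n)

  instance
    q-nonZero : ℕ.NonZero q
    q-nonZero = ℕ.>-nonZero (ℕ.<-trans (ℕ.s≤s ℕ.z≤n) 1<q)

  -- If `w` vanished on the kernel of `B`, that kernel would have one element, but `n` equations in
  -- `n + 1` unknowns have at least `q` solutions.
  kernel-nonvanishing : ∀ {n} (w : Vector K (suc n)) (B : Matrix n (suc n)) → #kernel (w ∷ B) ≡ 1 →
    ∃ λ x → Kernel B x × ¬ ⟨ w , x ⟩ ≈ᵏ 0#
  kernel-nonvanishing {n} w B #≡1 with vanishes-on-kernel? B w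
  ... | inj₁ found    = found
  ... | inj₂ vanishes = contradiction 1<q (ℕ.≤⇒≯ (ℕ.*-cancelʳ-≤ q 1 (q ℕ.^ n) {{ℕ.m^n≢0 q n}} (begin
    q ℕ.* q ℕ.^ n             ≤⟨ #kernel-≥ B ⟩
    #kernel B ℕ.* q ℕ.^ n     ≡⟨ cong (ℕ._* q ℕ.^ n) (trans (sym (#kernel-vanishing w B vanishes)) #≡1) ⟩
    1 ℕ.* q ℕ.^ n             ∎)))
    where open ℕ.≤-Reasoning

  #kernel-minor : ∀ {m n} {x : Vector K (suc n)} (cl : Clearing x) (B : Matrix m (suc n)) → Kernel B x →
    ∀ {N} → #kernel B ≡ q ℕ.* N → #kernel (clearedMinor (Clearing.operation cl) B) ≡ N
  #kernel-minor cl B Bx≈0 e = ℕ.*-cancelˡ-≡ _ _ q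
    (trans (cong (ℕ._* #kernel (clearedMinor (Clearing.operation cl) B)) (sym |K|≡q)) (trans (sym (#kernel-clearedMinor cl B Bx≈0)) e))

  #kernel-tail : ∀ {m n} (w x : Vector K n) (B : Matrix m n) → Kernel B x → ¬ ⟨ w , x ⟩ ≈ᵏ 0# →
    #kernel B ≡ q ℕ.* #kernel (w ∷ B)
  #kernel-tail w x B Bx≈0 wx≉0 = trans (#kernel-nonvanishing w x B Bx≈0 wx≉0)
    (trans (cong (#kernel (w ∷ B) ℕ.*_) |K|≡q) (ℕ.*-comm (#kernel (w ∷ B)) q))

  ⟨⟩≉0⇒≉0 : ∀ {n} {w x : Vector K n} → ¬ ⟨ w , x ⟩ ≈ᵏ 0# → ¬ x ≋ 0ᵛ
  ⟨⟩≉0⇒≉0 {w = w} wx≉0 x≈0 = wx≉0 (⟨⟩-zeroʳ w x≈0)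

  ∷-nonvanishing : ∀ {m n} (w : Vector K n) (B : Matrix m n) → #kernel (w ∷ B) ≡ 1 →
    ∀ {x} → Kernel B x → ¬ x ≋ 0ᵛ → ¬ ⟨ w , x ⟩ ≈ᵏ 0#
  ∷-nonvanishing w B #≡1 {x} Bx≈0 x≉0 wx≈0 =
    x≉0 (#kernel≡1⇒trivial (w ∷ B) #≡1 x λ { zero → wx≈0 ; (suc i) → Bx≈0 i })

  #kernel-minor≡1 : ∀ {n} (w : Vector K (suc n)) (B : Matrix n (suc n)) → #kernel (w ∷ B) ≡ 1 →
    ∀ {x} (cl : Clearing x) → Kernel B x → ¬ x ≋ 0ᵛ →
    #kernel (clearedMinor (Clearing.operation cl) B) ≡ 1
  #kernel-minor≡1 w B #≡1 {x} cl Bx≈0 x≉0 = #kernel-minor cl B Bx≈0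
    (trans (#kernel-tail w x B Bx≈0 (∷-nonvanishing w B #≡1 Bx≈0 x≉0)) (cong (q ℕ.*_) #≡1))

  det-η : ∀ {n} (U : Matrix (suc n) (suc n)) → det (head U ∷ tail U) ≈ᵏ det U
  det-η U = det-cong {A = head U ∷ tail U} {B = U} λ { zero i → k.refl ; (suc j) i → k.refl }

  -- The reduction used for the sums also computes the determinant: for a kernel vector `x` of the
  -- lower rows, `det U` is, up to the pivot, `⟨ head U , x ⟩` times the determinant of a minor with
  -- trivial kernel.
  det-nonzero : ∀ n (U : Matrix n n) → #kernel U ≡ 1 → ¬ det U ≈ᵏ 0#
  det-nonzero zero    U #≡1 det≈0 = k.0≉1 (k.sym det≈0)
  det-nonzero (suc n) U #≡1 det≈0 with kernel-nonvanishing (head U) (tail U) (trans (#kernel-η U) #≡1)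
  ... | x , Ux≈0 , wx≉0 = *-nonzero wx≉0
    (det-nonzero n _ (#kernel-minor≡1 (head U) (tail U) (trans (#kernel-η U) #≡1) cl Ux≈0 x≉0))
    (k.trans (k.sym (det-clearedMinor cl (head U) (tail U) Ux≈0))
      (k.trans (k.*-congʳ (k.trans (det-η U) det≈0)) (k.zeroˡ _)))
    where
    x≉0 = ⟨⟩≉0⇒≉0 {w = head U} wx≉0
    cl = clearing x x≉0

  kernel-nonzero : ∀ {m n} (B : Matrix m n) → ¬ #kernel B ≡ 1 → ∃ λ x → Kernel B x × ¬ x ≋ 0ᵛ
  kernel-nonzero B #≢1
    with anyVector? {P = λ x → Kernel B x × ¬ x ≋ 0ᵛ}
           (λ x≋y (Bx≈0 , x≉0) → Kernel-resp B x≋y Bx≈0 , λ y≈0 → x≉0 λ i → k.trans (x≋y i) (y≈0 i))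
           (λ x → Kernel? B x ×-dec ¬? (x ≋? 0ᵛ))
  ... | yes found = found
  ... | no none   = contradiction
    (#kernel-trivial B λ x Bx≈0 → decidable-stable (x ≋? 0ᵛ) λ x≉0 → none (x , Bx≈0 , x≉0)) #≢1

  -- By `det-clearedMinor` the choice of clearing cancels out, so the Kloosterman argument of the
  -- minor depends on `x` only through `⟨ w , x ⟩`. The form `w` is kept apart from the first row of
  -- `U` because corank one calls for another form.
  cleared-parameter : ∀ {n} (w : Vector K (suc n)) (B : Matrix n (suc n)) → #kernel (w ∷ B) ≡ 1 →
    ∀ {x} (cl : Clearing x) → Kernel B x → ¬ x ≋ 0ᵛ → ∀ y →
    y k.* inv (Clearing.pivot cl) k.* det (clearedMinor (Clearing.operation cl) B)
      ≈ᵏ y k.* det (w ∷ B) k.* inv ⟨ w , x ⟩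
  cleared-parameter w B #≡1 {x} cl Bx≈0 x≉0 y = *-cancelˡ (*-nonzero pivot≉0 wx≉0) $ begin
    pivot k.* wx k.* (y k.* inv pivot k.* det M)
      ≈⟨ solve 5 (λ p w y i d → (p :* w) :* ((y :* i) :* d) := (p :* (y :* i)) :* (w :* d))
           k.refl pivot wx y (inv pivot) (det M) ⟩
    pivot k.* (y k.* inv pivot) k.* (wx k.* det M)
      ≈⟨ k.*-cong (*-inv-cancel y pivot≉0) (k.sym (det-clearedMinor cl w B Bx≈0)) ⟩
    y k.* (det (w ∷ B) k.* pivot)
      ≈⟨ solve 3 (λ p y d → y :* (d :* p) := p :* (y :* d)) k.refl pivot y (det (w ∷ B)) ⟩
    pivot k.* (y k.* det (w ∷ B))
      ≈⟨ k.*-congˡ (*-inv-cancel _ wx≉0) ⟨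
    pivot k.* (wx k.* (y k.* det (w ∷ B) k.* inv wx))
      ≈⟨ k.*-assoc _ _ _ ⟨
    pivot k.* wx k.* (y k.* det (w ∷ B) k.* inv wx) ∎
    where
    open Clearing cl
    open SetoidReasoning k.setoid
    open SemiringSolver k.commutativeSemiring using (solve; _:*_; _:=_)
    M = clearedMinor operation B
    wx = ⟨ w , x ⟩
    wx≉0 = ∷-nonvanishing w B #≡1 Bx≈0 x≉0

  -- Excludes rank zero: were the kernel of `w ∷ B` the whole space, the kernel of `B` would be `q`
  -- times larger still.
  #kernel-proper : ∀ {m n} (w x : Vector K n) (B : Matrix m n) → Kernel B x → ¬ ⟨ w , x ⟩ ≈ᵏ 0# →
    ¬ #kernel (w ∷ B) ≡ q ℕ.^ n
  #kernel-proper {n = n} w x B Bx≈0 wx≉0 #≡qⁿ =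
    ℕ.<⇒≱ 1<q (ℕ.*-cancelʳ-≤ q 1 (q ℕ.^ n) {{ℕ.m^n≢0 q n}} (begin
      q ℕ.* q ℕ.^ n            ≡⟨ cong (q ℕ.*_) #≡qⁿ ⟨
      q ℕ.* #kernel (w ∷ B)    ≡⟨ #kernel-tail w x B Bx≈0 wx≉0 ⟨
      #kernel B                ≤⟨ #kernel-≤ B ⟩
      q ℕ.^ n                  ≡⟨ ℕ.*-identityˡ _ ⟨
      1 ℕ.* q ℕ.^ n            ∎))
    where open ℕ.≤-Reasoning

-- Kloosterman sums and the evaluation of the matrix sum by induction on its size.

module GaussSumEvaluation {c ℓ q r ℓr} (k : FiniteField c ℓ q) (R : CommutativeRing r ℓr) where

  private
    module k = FiniteField k
    module R = CommutativeRing R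
  open k using (0#; 1#; elements) renaming (Carrier to K; _≈_ to _≈ᵏ_; _≟_ to _≟ᵏ_)
  open R using (_≈_; _+_; _*_; -_) renaming (Carrier to A)
  open LinearAlgebra k.commutativeRing
  open Determinants k.commutativeRing
  open FiniteFieldLinearAlgebra k
  open FiniteSums R.commutativeSemiring
  open FiniteFieldSums k R.commutativeSemiring
  open NonsingularMatrices k
  open KernelSize k using (#kernel≡1⇒trivial)
  open SemiringSum k.semiring using (sum; sum-cong-≋)
  open Algebra.Definitions.RawSemiring (Semiring.rawSemiring k.semiring) using () renaming (product to productᵏ)
  open Algebra.Definitions.RawSemiring (Semiring.rawSemiring R.semiring) using (product; _^_) renaming (_×_ to _·_)
  open SemiringExp R.semiring using (^-homo-*)
  open SetoidReasoning R.setoid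
  open GaussSums k R
  private
    module ℕ-Solver = +-*-Solver
    module Count where
      open FiniteSums ℕ.+-*-commutativeSemiring public
      open FiniteFieldSums k ℕ.+-*-commutativeSemiring public

  open SemiringSolver R.commutativeSemiring using (solve; _:*_; _:=_)

  -- Carries kernel sizes from ℕ, where the rank determines them, into the ring where the sums live.
  ∑-𝟙-fromℕ : ∀ {a p} {B : Set a} {P : B → Set p} (P? : Unary.Decidable P) xs →
               ∑ xs (λ x → 𝟙 (P? x)) ≈ Count.∑ xs (λ x → Count.𝟙 (P? x)) · R.1#
  ∑-𝟙-fromℕ P? List.[] = R.refl
  ∑-𝟙-fromℕ P? (x List.∷ xs) with P? x
  ... | yes _ = R.+-congˡ (∑-𝟙-fromℕ P? xs)
  ... | no  _ = R.trans (R.+-identityˡ _) (∑-𝟙-fromℕ P? xs)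

  #kernel-fromℕ : ∀ {m n} (B : Matrix m n) → #kernel B ≈ Count.#kernel B · R.1#
  #kernel-fromℕ {n = n} B = ∑-𝟙-fromℕ (Kernel? B) (vectors n)

  |K|≈q : |K| ≈ q · R.1#
  |K|≈q = R.trans (∑-tabulate (Inverse.to k.enumeration) (λ _ → R.1#)) (SemiringSum.sum-replicate R.semiring q)

  fromℕ-^ : ∀ d → (q ℕ.^ d) · R.1# ≈ |K| ^ d
  fromℕ-^ zero    = R.+-identityʳ R.1#
  fromℕ-^ (suc d) = R.trans (SemiringMult.×1-homo-* R.semiring q (q ℕ.^ d))
    (R.*-cong (R.sym |K|≈q) (fromℕ-^ d))

  infix 4 _≉0?
  _≉0? : ∀ t → Dec (¬ t ≈ᵏ 0#)
  t ≉0? = ¬? (t ≟ᵏ 0#)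

  𝟙-¬+𝟙 : ∀ {p} {P : Set p} (P? : Dec P) → 𝟙 (¬? P?) + 𝟙 P? ≈ R.1#
  𝟙-¬+𝟙 (yes _) = R.+-identityˡ _
  𝟙-¬+𝟙 (no _)  = R.+-identityʳ _

  ∑ˣ : (K → A) → A
  ∑ˣ f = ∑ᵏ λ t → 𝟙 (t ≉0?) * f t

  ∑ˣ-cong : ∀ {f g} → (∀ t → ¬ t ≈ᵏ 0# → f t ≈ g t) → ∑ˣ f ≈ ∑ˣ g
  ∑ˣ-cong f≈g = ∑ᵏ-cong λ t → 𝟙*-cong (t ≉0?) (f≈g t)

  *-∑ˣ : ∀ a f → a * ∑ˣ f ≈ ∑ˣ λ t → a * f t
  *-∑ˣ a f = R.trans (*-∑ a _ elements) (∑ᵏ-cong λ t →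
    solve 3 (λ a b c → a :* (b :* c) := b :* (a :* c)) R.refl a _ (f t))

  ∑ˣ-* : ∀ a f → ∑ˣ f * a ≈ ∑ˣ λ t → f t * a
  ∑ˣ-* a f = R.trans (∑-* a _ elements) (∑ᵏ-cong λ t → R.*-assoc _ _ _)

  ∑ˣ+0 : ∀ (f : K → A) → (∀ {x y} → x ≈ᵏ y → f x ≈ f y) → ∑ˣ f + f 0# ≈ ∑ᵏ f
  ∑ˣ+0 f f-cong = begin
    ∑ˣ f + f 0#
      ≈⟨ R.+-congˡ (Enumeration.∑-δ fieldEnumeration 0# f f-cong) ⟨
    ∑ˣ f + ∑ᵏ (λ t → 𝟙 (t ≟ᵏ 0#) * f t)
      ≈⟨ ∑-+ _ _ elements ⟨
    ∑ᵏ (λ t → 𝟙 (t ≉0?) * f t + 𝟙 (t ≟ᵏ 0#) * f t)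
      ≈⟨ ∑ᵏ-cong (λ t → R.trans (R.sym (R.distribʳ _ _ _))
           (R.trans (R.*-congʳ (𝟙-¬+𝟙 (t ≟ᵏ 0#))) (R.*-identityˡ _))) ⟩
    ∑ᵏ f ∎

  𝟙-≉0-cong : ∀ {s t} → (s ≈ᵏ 0# → t ≈ᵏ 0#) → (t ≈ᵏ 0# → s ≈ᵏ 0#) → 𝟙 (s ≉0?) ≈ 𝟙 (t ≉0?)
  𝟙-≉0-cong {s} {t} f g = 𝟙-cong (s ≉0?) (t ≉0?) (_∘ g) (_∘ f)

  inv-0 : ∀ {x} → x ≈ᵏ 0# → inv x ≈ᵏ 0#
  inv-0 {x} x≈0 with x ≟ᵏ 0#
  ... | yes _  = k.refl
  ... | no x≉0 = contradiction x≈0 x≉0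

  ∑ˣ-quotient : ∀ {a} → ¬ a ≈ᵏ 0# → ∀ (f : K → A) → (∀ {x y} → x ≈ᵏ y → f x ≈ f y) →
                ∑ˣ (λ t → f (a k.* inv t)) ≈ ∑ˣ f
  ∑ˣ-quotient {a} a≉0 f f-cong = begin
    ∑ᵏ (λ t → 𝟙 (t ≉0?) * f (a k.* inv t))
      ≈⟨ ∑ᵏ-cong (λ t → R.*-congʳ (𝟙-≉0-cong {t} {a k.* inv t} quotient-0
           (λ e → decidable-stable (t ≟ᵏ 0#) λ t≉0 → *-nonzero a≉0 (inv-nonzero t≉0) e))) ⟩
    ∑ᵏ (λ t → 𝟙 ((a k.* inv t) ≉0?) * f (a k.* inv t))
      ≈⟨ ∑-reindex fieldEnumeration fieldEnumeration (λ t → a k.* inv t) (λ t → a k.* inv t)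
           (λ s t s≈ → k.trans (k.*-congˡ (inv-cong s≈)) (involution t))
           (λ s t ≈t → k.trans (k.sym (involution s)) (k.*-congˡ (inv-cong ≈t)))
           (λ t → 𝟙 (t ≉0?) * f t)
           (λ {s} {t} s≈t → R.*-cong (𝟙-≉0-cong {s} {t} (k.trans (k.sym s≈t)) (k.trans s≈t)) (f-cong s≈t)) ⟩
    ∑ˣ f ∎
    where
    quotient-0 : ∀ {t} → t ≈ᵏ 0# → a k.* inv t ≈ᵏ 0#
    quotient-0 t≈0 = k.trans (k.*-congˡ (inv-0 t≈0)) (k.zeroʳ a)
    involution : ∀ t → a k.* inv (a k.* inv t) ≈ᵏ t
    involution t with t ≟ᵏ 0#
    ... | yes t≈0 = k.trans (quotient-0 (k.zeroʳ a)) (k.sym t≈0)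
    ... | no t≉0  = *-cancelˡ t′≉0 (k.trans (*-inv-cancel a t′≉0)
      (k.sym (k.trans (k.*-assoc _ _ _) (k.trans (k.*-congˡ (k.trans (k.*-comm _ _) (proj₂ (k.inverse t t≉0)))) (k.*-identityʳ a)))))
      where
      t′≉0 : ¬ a k.* proj₁ (k.inverse t t≉0) ≈ᵏ 0#
      t′≉0 = *-nonzero a≉0 λ e → k.0≉1 (k.trans (k.sym (k.zeroʳ t)) (k.trans (k.*-congˡ (k.sym e)) (proj₂ (k.inverse t t≉0))))

  module Evaluation (ψ : K → A)
    (ψ-cong : ∀ {x y} → x ≈ᵏ y → ψ x ≈ ψ y)
    (ψ-+ : ∀ x y → ψ (x k.+ y) ≈ ψ x * ψ y)
    (ψ-0 : ψ 0# ≈ R.1#)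
    (∑ψ≈0 : ∑ᵏ ψ ≈ R.0#)
    where

    open Character ψ ψ-cong ψ-+ ψ-0 ∑ψ≈0

    Kl : ∀ n → K → A
    Kl n z = ∑ᵛ {n} λ x → 𝟙 (productᵏ x ≟ᵏ z) * ψ (sum x)

    Kl-cong : ∀ n {y z} → y ≈ᵏ z → Kl n y ≈ Kl n z
    Kl-cong n {y} {z} y≈z = ∑ᵛ-cong n λ x → R.*-congʳ (𝟙-cong (productᵏ x ≟ᵏ y) (productᵏ x ≟ᵏ z)
      (λ e → k.trans e y≈z) (λ e → k.trans e (k.sym y≈z)))

    -- Since `z` is nonzero, so is the first factor `t` of the product, and the remaining factors
    -- multiply to `z * inv t`.
    Kl-suc : ∀ n {z} → ¬ z ≈ᵏ 0# → Kl (suc n) z ≈ ∑ˣ λ t → ψ t * Kl n (z k.* inv t)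
    Kl-suc n {z} z≉0 = begin
      Kl (suc n) z
        ≈⟨ ∑-tuples elements n _ ⟩
      ∑ᵏ (λ t → ∑ᵛ {n} λ x → 𝟙 ((t k.* productᵏ x) ≟ᵏ z) * ψ (t k.+ sum x))
        ≈⟨ ∑ᵏ-cong (λ t → R.trans
             (∑ᵛ-cong n λ x → R.trans (R.*-cong (divide t (productᵏ x)) (ψ-+ t (sum x)))
               (solve 4 (λ a b c d → (a :* b) :* (c :* d) := (a :* c) :* (b :* d)) R.refl
                 (𝟙 (t ≉0?)) (𝟙 (productᵏ x ≟ᵏ (z k.* inv t))) (ψ t) (ψ (sum x))))
             (R.trans (R.sym (*-∑ _ _ (vectors n))) (R.*-assoc _ _ _))) ⟩
      ∑ˣ (λ t → ψ t * Kl n (z k.* inv t)) ∎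
      where
      divide : ∀ t p → 𝟙 ((t k.* p) ≟ᵏ z) ≈ 𝟙 (t ≉0?) * 𝟙 (p ≟ᵏ (z k.* inv t))
      divide t p = R.trans
        (𝟙-cong ((t k.* p) ≟ᵏ z) ((t ≉0?) ×-dec (p ≟ᵏ (z k.* inv t)))
          (λ e → t≉0 e , *-cancelˡ (t≉0 e) (k.trans e (k.sym (*-inv-cancel z (t≉0 e)))))
          (λ (t≉0 , e) → k.trans (k.*-congˡ e) (*-inv-cancel z t≉0)))
        (𝟙-× (t ≉0?) (p ≟ᵏ (z k.* inv t)))
        where
        t≉0 : t k.* p ≈ᵏ z → ¬ t ≈ᵏ 0#
        t≉0 e t≈0 = z≉0 (k.trans (k.sym e) (k.trans (k.*-congʳ t≈0) (k.zeroˡ p)))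

    ∑ˣψ : ∑ˣ ψ ≈ - R.1#
    ∑ˣψ = GroupProperties.inverseˡ-unique R.+-group _ _
      (R.trans (R.+-congˡ (R.sym ψ-0)) (R.trans (∑ˣ+0 ψ ψ-cong) ∑ψ≈0))

    -- Scaling `z` by a unit permutes the units, so after expansion by `Kl-suc` the variables
    -- separate and each contributes `∑ˣ ψ = - 1`. The start `Kl 0` is the indicator of `1#`.
    ∑ˣ-Kl : ∀ n → ∑ˣ (Kl n) ≈ (- R.1#) ^ n
    ∑ˣ-Kl zero = begin
      ∑ˣ (Kl zero)
        ≈⟨ ∑ᵏ-cong (λ z → R.trans (R.*-congˡ (Kl-zero z)) (R.*-comm _ _)) ⟩
      ∑ᵏ (λ z → 𝟙 (z ≟ᵏ 1#) * 𝟙 (z ≉0?))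
        ≈⟨ Enumeration.∑-δ fieldEnumeration 1# (λ z → 𝟙 (z ≉0?)) (λ {s} {t} s≈t → 𝟙-≉0-cong {s} {t} (k.trans (k.sym s≈t)) (k.trans s≈t)) ⟩
      𝟙 (1# ≉0?)
        ≈⟨ 𝟙-yes (1# ≉0?) (k.0≉1 ∘ k.sym) ⟩
      R.1# ∎
      where
      Kl-zero : ∀ z → Kl zero z ≈ 𝟙 (z ≟ᵏ 1#)
      Kl-zero z = R.trans (R.+-identityʳ _) (R.trans (R.*-congˡ ψ-0) (R.trans (R.*-identityʳ _)
        (𝟙-cong (1# ≟ᵏ z) (z ≟ᵏ 1#) k.sym k.sym)))
    ∑ˣ-Kl (suc n) = begin
      ∑ˣ (Kl (suc n))
        ≈⟨ ∑ˣ-cong (λ z z≉0 → Kl-suc n z≉0) ⟩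
      ∑ˣ (λ z → ∑ˣ λ t → ψ t * Kl n (z k.* inv t))
        ≈⟨ ∑ᵏ-cong (λ z → R.trans (*-∑ _ _ elements) (∑ᵏ-cong λ t →
             solve 4 (λ a b c d → a :* (b :* (c :* d)) := b :* (c :* (a :* d))) R.refl (𝟙 (z ≉0?)) (𝟙 (t ≉0?)) (ψ t) _)) ⟩
      ∑ᵏ (λ z → ∑ᵏ λ t → 𝟙 (t ≉0?) * (ψ t * (𝟙 (z ≉0?) * Kl n (z k.* inv t))))
        ≈⟨ ∑-swap _ elements elements ⟩
      ∑ᵏ (λ t → ∑ᵏ λ z → 𝟙 (t ≉0?) * (ψ t * (𝟙 (z ≉0?) * Kl n (z k.* inv t))))
        ≈⟨ ∑ᵏ-cong (λ t → R.trans (R.sym (*-∑ _ _ elements)) (R.*-congˡ (R.sym (*-∑ _ _ elements)))) ⟩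
      ∑ˣ (λ t → ψ t * ∑ˣ λ z → Kl n (z k.* inv t))
        ≈⟨ ∑ˣ-cong (λ t t≉0 → R.*-congˡ (R.trans (scaled t≉0) (∑ˣ-Kl n))) ⟩
      ∑ˣ (λ t → ψ t * (- R.1#) ^ n)
        ≈⟨ ∑ˣ-* _ ψ ⟨
      ∑ˣ ψ * (- R.1#) ^ n
        ≈⟨ R.*-congʳ ∑ˣψ ⟩
      (- R.1#) ^ suc n ∎
      where
      scaled : ∀ {t} → ¬ t ≈ᵏ 0# → ∑ˣ (λ z → Kl n (z k.* inv t)) ≈ ∑ˣ (Kl n)
      scaled {t} t≉0 = R.trans
        (∑ᵏ-cong λ z → R.*-cong
          (𝟙-≉0-cong {z} {inv t k.* z} (λ e → k.trans (k.*-congˡ e) (k.zeroʳ _))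
            (λ e → *-cancelˡ (inv-nonzero t≉0) (k.trans e (k.sym (k.zeroʳ _)))))
          (Kl-cong n (k.*-comm z (inv t))))
        (∑ᵏ-scale (inv-nonzero t≉0) (λ z → 𝟙 (z ≉0?) * Kl n z)
          (λ {s} {t} s≈t → R.*-cong (𝟙-≉0-cong {s} {t} (k.trans (k.sym s≈t)) (k.trans s≈t)) (Kl-cong n s≈t)))

    -- Pascal's rule with `n C 1 = n`: the factor `|K| ^ n` from each free column accumulates to the
    -- binomial exponent.
    C₂-suc : ∀ n → |K| ^ n * |K| ^ (n C 2) ≈ |K| ^ (suc n C 2)
    C₂-suc n = R.trans (R.sym (^-homo-* |K| n (n C 2))) (R.reflexive (≡.cong (|K| ^_)
      (≡.trans (≡.cong (ℕ._+ n C 2) (≡.sym (nC1≡n n))) (nCk+nC[k+1]≡[n+1]C[k+1] n 1))))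

    NonsingularFormula : ℕ → Set _
    NonsingularFormula n = ∀ (U : Matrix n n) → Count.#kernel U ≡ 1 → ∀ {y} → ¬ y ≈ᵏ 0# →
      G n U y ≈ |K| ^ (n C 2) * Kl n (y k.* det U)

    cleared-Kl : ∀ {n} → NonsingularFormula n →
      ∀ (w : Vector K (suc n)) (B : Matrix n (suc n)) → Count.#kernel (w ∷ B) ≡ 1 → ∀ {y} → ¬ y ≈ᵏ 0# →
      ∀ {x} (cl : Clearing x) → Kernel B x → ¬ x ≋ 0ᵛ →
      G n (clearedMinor (Clearing.operation cl) B) (y k.* inv (Clearing.pivot cl))
        ≈ |K| ^ (n C 2) * Kl n (y k.* det (w ∷ B) k.* inv ⟨ w , x ⟩)
    cleared-Kl {n} formula w B #≡1 {y} y≉0 {x} cl Bx≈0 x≉0 = R.trans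
      (formula M (#kernel-minor≡1 w B #≡1 cl Bx≈0 x≉0) (*-nonzero y≉0 (inv-nonzero pivot≉0)))
      (R.*-congˡ (Kl-cong n (cleared-parameter w B #≡1 cl Bx≈0 x≉0 y)))
      where
      open Clearing cl
      M = clearedMinor operation B

    -- Rows outside the kernel contribute 0; on the kernel the summand is a
    -- function of ⟨ w , x ⟩, which takes each value once.
    G-via-form : ∀ {n} (U : Matrix (suc n) (suc n)) (w : Vector K (suc n)) → Count.#kernel (w ∷ tail U) ≡ 1 →
      ∀ {y} → ¬ y ≈ᵏ 0# → (f : K → A) → (∀ {s t} → s ≈ᵏ t → f s ≈ f t) →
      (∀ {x} (cl : Clearing x) → Kernel (tail U) x → ¬ x ≋ 0ᵛ →
        ψ ⟨ head U , x ⟩ * (|K| ^ n * G n (clearedMinor (Clearing.operation cl) (tail U)) (y k.* inv (Clearing.pivot cl)))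
          ≈ f ⟨ w , x ⟩) →
      G (suc n) U y ≈ ∑ˣ f
    G-via-form {n} U w #≡1 {y} y≉0 f f-cong cleared with kernel-nonvanishing w (tail U) #≡1
    ... | x₀ , Bx₀≈0 , wx₀≉0 = begin
      G (suc n) U y
        ≈⟨ G-rows n U y ⟩
      ∑ᵛ (G-firstRow U y)
        ≈⟨ ∑ᵛ-cong (suc n) (λ x → row x (x ≋? 0ᵛ) (Kernel? (tail U) x)) ⟩
      ∑ᵛ (λ x → 𝟙 (Kernel? (tail U) x) * g ⟨ w , x ⟩)
        ≈⟨ ∑-kernel (tail U) w x₀ Bx₀≈0 wx₀≉0 g g-cong ⟩
      #kernel (w ∷ tail U) * ∑ˣ f
        ≈⟨ R.*-congʳ (#kernel-trivial (w ∷ tail U) (#kernel≡1⇒trivial (w ∷ tail U) #≡1)) ⟩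
      R.1# * ∑ˣ f
        ≈⟨ R.*-identityˡ _ ⟩
      ∑ˣ f ∎
      where
      g : K → A
      g t = 𝟙 (t ≉0?) * f t
      g-cong : ∀ {s t} → s ≈ᵏ t → g s ≈ g t
      g-cong {s} {t} s≈t = R.*-cong (𝟙-≉0-cong {s} {t} (k.trans (k.sym s≈t)) (k.trans s≈t)) (f-cong s≈t)
      row : ∀ x → Dec (x ≋ 0ᵛ) → Dec (Kernel (tail U) x) →
            G-firstRow U y x ≈ 𝟙 (Kernel? (tail U) x) * g ⟨ w , x ⟩
      row x (yes x≈0) _ = R.trans (G-firstRow-zero U y≉0 x≈0) (R.sym (R.trans
        (R.*-congˡ (𝟙*-no (⟨ w , x ⟩ ≉0?) (λ wx≉0 → wx≉0 (⟨⟩-zeroʳ w x≈0)) _)) (R.zeroʳ _)))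
      row x (no x≉0) (no Bx≉0) = R.trans (G-firstRow-cleared U (clearing x x≉0) y) (R.trans
        (R.*-congʳ (𝟙*-no (Kernel? (tail U) x) Bx≉0 _)) (R.trans (R.zeroˡ _)
          (R.sym (𝟙*-no (Kernel? (tail U) x) Bx≉0 _))))
      row x (no x≉0) (yes Bx≈0) = R.trans (G-firstRow-cleared U (clearing x x≉0) y) (R.trans (R.*-assoc _ _ _)
        (R.*-congˡ (R.trans (cleared (clearing x x≉0) Bx≈0 x≉0)
          (R.sym (𝟙*-yes (⟨ w , x ⟩ ≉0?) (∷-nonvanishing w (tail U) #≡1 Bx≈0 x≉0) _)))))

    -- With `w = head U` the parameter `t` is also the argument of the character, so the reduction
    -- is the Kloosterman recursion itself.
    G-nonsingular : ∀ n → NonsingularFormula n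
    G-nonsingular zero U #≡1 {y} y≉0 = R.trans
      (R.+-congʳ (R.*-congʳ (𝟙-cong (1# ≟ᵏ y) (1# ≟ᵏ (y k.* 1#))
        (λ e → k.trans e (k.sym (k.*-identityʳ y))) (λ e → k.trans e (k.*-identityʳ y)))))
      (R.sym (R.*-identityˡ _))
    G-nonsingular (suc n) U #≡1 {y} y≉0 = begin
      G (suc n) U y
        ≈⟨ G-via-form U (head U) #≡1′ y≉0 f
             (λ s≈t → R.*-cong (ψ-cong s≈t) (R.*-congˡ (R.*-congˡ (Kl-cong n (k.*-congˡ (inv-cong s≈t))))))
             (λ cl Bx≈0 x≉0 → R.*-congˡ (R.*-congˡ (cleared-Kl (G-nonsingular n) (head U) (tail U) #≡1′ y≉0 cl Bx≈0 x≉0))) ⟩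
      ∑ˣ (λ t → ψ t * (|K| ^ n * (|K| ^ (n C 2) * Kl n (y k.* D k.* inv t))))
        ≈⟨ ∑ᵏ-cong (λ t → solve 5 (λ o p a b c → o :* (p :* (a :* (b :* c))) := (a :* b) :* (o :* (p :* c))) R.refl
             (𝟙 (t ≉0?)) (ψ t) (|K| ^ n) (|K| ^ (n C 2)) _) ⟩
      ∑ᵏ (λ t → (|K| ^ n * |K| ^ (n C 2)) * (𝟙 (t ≉0?) * (ψ t * Kl n (y k.* D k.* inv t))))
        ≈⟨ *-∑ _ _ elements ⟨
      (|K| ^ n * |K| ^ (n C 2)) * ∑ˣ (λ t → ψ t * Kl n (y k.* D k.* inv t))
        ≈⟨ R.*-cong (C₂-suc n) (R.sym (Kl-suc n (*-nonzero y≉0 D≉0))) ⟩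
      |K| ^ (suc n C 2) * Kl (suc n) (y k.* D)
        ≈⟨ R.*-congˡ (Kl-cong (suc n) (k.*-congˡ (det-η U))) ⟩
      |K| ^ (suc n C 2) * Kl (suc n) (y k.* det U) ∎
      where
      D = det (head U ∷ tail U)
      D≉0 : ¬ D ≈ᵏ 0#
      D≉0 e = det-nonzero (suc n) U #≡1 (k.trans (k.sym (det-η U)) e)
      #≡1′ : Count.#kernel (head U ∷ tail U) ≡ 1
      #≡1′ = ≡.trans (Count.#kernel-η U) #≡1
      f : K → A
      f t = ψ t * (|K| ^ n * (|K| ^ (n C 2) * Kl n (y k.* D k.* inv t)))

    -- The truncated subtraction makes both `∏ 0` and `∏ 1` empty.
    ∏ : ℕ → A
    ∏ d = product {suc d ℕ.∸ 2} λ i → |K| ^ (2 ℕ.+ toℕ i) + - R.1#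

    -- The recursion begins at `∏ 1`: no factor appears between `∏ 0` and `∏ 1`. That gap is the
    -- corank-one case with nonsingular minors, where a sum of Kloosterman sums takes over.
    ∏-suc : ∀ d → ∏ (suc (suc d)) ≈ ∏ (suc d) * (|K| ^ suc (suc d) + - R.1#)
    ∏-suc d = R.trans
      (MonoidSum.sum-init-last R.*-monoid {d} λ i → |K| ^ (2 ℕ.+ toℕ i) + - R.1#)
      (R.*-cong
        (MonoidSum.sum-cong-≋ R.*-monoid {d} λ i → exponent (Fin.toℕ-inject₁ i))
        (exponent (Fin.toℕ-fromℕ d)))
      where
      exponent : ∀ {m n} → m ≡ n → |K| ^ (2 ℕ.+ m) + - R.1# ≈ |K| ^ (2 ℕ.+ n) + - R.1#
      exponent m≡n = R.reflexive (≡.cong (λ m → |K| ^ (2 ℕ.+ m) + - R.1#) m≡n)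

    -- Each nonzero kernel row contributes its character value times the same constant. The `- 1`
    -- removes the zero row, which would have weight 1 but contributes nothing because `y` is
    -- nonzero.
    G-constant-minors : ∀ {n} (U : Matrix (suc n) (suc n)) {y} → ¬ y ≈ᵏ 0# → ∀ c →
      (∀ {x} (cl : Clearing x) → Kernel (tail U) x → ¬ x ≋ 0ᵛ →
        G n (clearedMinor (Clearing.operation cl) (tail U)) (y k.* inv (Clearing.pivot cl)) ≈ c) →
      G (suc n) U y ≈ (∑ᵛ (λ x → 𝟙 (Kernel? (tail U) x) * ψ ⟨ head U , x ⟩) + - R.1#) * (|K| ^ n * c)
    G-constant-minors {n} U {y} y≉0 c minors = begin
      G (suc n) U y
        ≈⟨ G-rows n U y ⟩
      ∑ᵛ (G-firstRow U y)
        ≈⟨ ∑ᵛ-cong (suc n) (λ x → row x (x ≋? 0ᵛ) (Kernel? (tail U) x)) ⟩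
      ∑ᵛ (λ x → (h x + - R.1# * 𝟙 (x ≋? 0ᵛ)) * (|K| ^ n * c))
        ≈⟨ ∑-* _ _ (vectors (suc n)) ⟨
      ∑ᵛ (λ x → h x + - R.1# * 𝟙 (x ≋? 0ᵛ)) * (|K| ^ n * c)
        ≈⟨ R.*-congʳ (R.trans (∑-+ h _ (vectors (suc n))) (R.+-congˡ (R.trans (R.sym (*-∑ _ _ (vectors (suc n))))
             (R.trans (R.*-congˡ (Enumeration.∑-𝟙-≟ (vectorEnumeration (suc n)) 0ᵛ)) (R.*-identityʳ _))))) ⟩
      (∑ᵛ h + - R.1#) * (|K| ^ n * c) ∎
      where
      h : Vector K (suc n) → A
      h x = 𝟙 (Kernel? (tail U) x) * ψ ⟨ head U , x ⟩
      minus-zero : ∀ {x} → ¬ x ≋ 0ᵛ → h x ≈ h x + - R.1# * 𝟙 (x ≋? 0ᵛ)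
      minus-zero {x} x≉0 = R.sym (R.trans (R.+-congˡ (R.trans (R.*-congˡ (𝟙-no (x ≋? 0ᵛ) x≉0)) (R.zeroʳ _))) (R.+-identityʳ _))
      row : ∀ x → Dec (x ≋ 0ᵛ) → Dec (Kernel (tail U) x) →
            G-firstRow U y x ≈ (h x + - R.1# * 𝟙 (x ≋? 0ᵛ)) * (|K| ^ n * c)
      row x (yes x≈0) _ = R.trans (G-firstRow-zero U y≉0 x≈0) (R.sym (R.trans
        (R.*-congʳ (R.trans
          (R.+-cong
            (R.trans (𝟙*-yes (Kernel? (tail U) x) (λ i → ⟨⟩-zeroʳ (tail U i) x≈0) _)
              (R.trans (ψ-cong (⟨⟩-zeroʳ (head U) x≈0)) ψ-0))
            (R.trans (R.*-congˡ (𝟙-yes (x ≋? 0ᵛ) x≈0)) (R.*-identityʳ _)))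
          (R.-‿inverseʳ R.1#))) (R.zeroˡ _)))
      row x (no x≉0) (no Bx≉0) = R.trans (G-firstRow-cleared U (clearing x x≉0) y) (R.trans
        (R.trans (R.*-congʳ h≈0) (R.trans (R.zeroˡ _) (R.sym (R.trans (R.*-congʳ h≈0) (R.zeroˡ _)))))
        (R.*-congʳ (minus-zero x≉0)))
        where
        h≈0 : h x ≈ R.0#
        h≈0 = 𝟙*-no (Kernel? (tail U) x) Bx≉0 _
      row x (no x≉0) (yes Bx≈0) = R.trans (G-firstRow-cleared U (clearing x x≉0) y)
        (R.*-cong (minus-zero x≉0) (R.*-congˡ (minors (clearing x x≉0) Bx≈0 x≉0)))

    singular-step : ∀ {n} (U : Matrix (suc n) (suc n)) u →
      Count.#kernel U ℕ.* q ℕ.^ u ≡ q ℕ.^ suc n → u ℕ.< suc n →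
      (∀ (M : Matrix n n) v → Count.#kernel M ℕ.* q ℕ.^ v ≡ q ℕ.^ n → v ℕ.< n → ∀ {y} → ¬ y ≈ᵏ 0# →
        G n M y ≈ (- R.1#) ^ v * |K| ^ (n C 2) * ∏ (n ℕ.∸ v)) →
      ∀ {y} → ¬ y ≈ᵏ 0# →
      G (suc n) U y ≈ (- R.1#) ^ u * |K| ^ (suc n C 2) * ∏ (suc n ℕ.∸ u)
    singular-step {n} U u #U u<1+n formula {y} y≉0 with vanishes-on-kernel? (tail U) (head U)
    ... | inj₁ (x₀ , Bx₀≈0 , Ux₀≉0) = nonvanishing u #U u<1+n
      where
      #B : Count.#kernel (tail U) ≡ q ℕ.* Count.#kernel U
      #B = ≡.trans (#kernel-tail (head U) x₀ (tail U) Bx₀≈0 Ux₀≉0) (≡.cong (q ℕ.*_) (Count.#kernel-η U))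
      nonvanishing : ∀ u → Count.#kernel U ℕ.* q ℕ.^ u ≡ q ℕ.^ suc n → u ℕ.< suc n →
        G (suc n) U y ≈ (- R.1#) ^ u * |K| ^ (suc n C 2) * ∏ (suc n ℕ.∸ u)
      -- Rank zero would make the kernel everything, while `head U` is nonzero at `x₀`.
      nonvanishing zero #U _ = contradiction
        (≡.trans (Count.#kernel-η U) (≡.trans (≡.sym (ℕ.*-identityʳ _)) #U))
        (#kernel-proper (head U) x₀ (tail U) Bx₀≈0 Ux₀≉0)
      nonvanishing (suc u) #U (ℕ.s≤s u<n) = begin
        G (suc n) U y
          ≈⟨ G-constant-minors U y≉0 γ (λ cl Bx≈0 x≉0 → formula _ u (minor# cl Bx≈0) u<n
               (*-nonzero y≉0 (inv-nonzero (Clearing.pivot≉0 cl)))) ⟩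
        (∑ᵛ (λ x → 𝟙 (Kernel? (tail U) x) * ψ ⟨ head U , x ⟩) + - R.1#) * (|K| ^ n * γ)
          -- The values of `head U` on the kernel are equidistributed, so the full character sum
          -- vanishes; the omitted zero row leaves `- 1`, which provides the new sign.
          ≈⟨ R.*-congʳ (R.trans (R.+-congʳ (R.trans (∑-kernel (tail U) (head U) x₀ Bx₀≈0 Ux₀≉0 ψ ψ-cong)
               (R.trans (R.*-congˡ ∑ψ≈0) (R.zeroʳ _)))) (R.+-identityˡ _)) ⟩
        - R.1# * (|K| ^ n * γ)
          ≈⟨ solve 5 (λ m a b c d → m :* (a :* ((b :* c) :* d)) := ((m :* b) :* (a :* c)) :* d) R.refl
               (- R.1#) (|K| ^ n) ((- R.1#) ^ u) (|K| ^ (n C 2)) (∏ (n ℕ.∸ u)) ⟩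
        (- R.1#) ^ suc u * (|K| ^ n * |K| ^ (n C 2)) * ∏ (n ℕ.∸ u)
          ≈⟨ R.*-congʳ (R.*-congˡ (C₂-suc n)) ⟩
        (- R.1#) ^ suc u * |K| ^ (suc n C 2) * ∏ (n ℕ.∸ u) ∎
        where
        γ : A
        γ = (- R.1#) ^ u * |K| ^ (n C 2) * ∏ (n ℕ.∸ u)
        minor# : ∀ {x} (cl : Clearing x) → Kernel (tail U) x →
          Count.#kernel (clearedMinor (Clearing.operation cl) (tail U)) ℕ.* q ℕ.^ u ≡ q ℕ.^ n
        minor# cl Bx≈0 = ≡.trans (≡.cong (ℕ._* q ℕ.^ u) (#kernel-minor cl (tail U) Bx≈0 #B))
          (ℕ.*-cancelˡ-≡ _ _ q (≡.trans (ℕ-Solver.solve 3 (λ q k p → q ℕ-Solver.:* (k ℕ-Solver.:* p)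
              ℕ-Solver.:= k ℕ-Solver.:* (q ℕ-Solver.:* p)) ≡.refl q (Count.#kernel U) (q ℕ.^ u)) #U))
    -- The minors have size `n` and kernel size `q ^ (n ∸ u)`, so they are singular exactly when
    -- `u < n`.
    ... | inj₂ vanishes with ℕ.m<1+n⇒m<n∨m≡n u<1+n
    ... | inj₁ u<n = begin
        G (suc n) U y
          ≈⟨ G-constant-minors U y≉0 γ (λ cl Bx≈0 x≉0 → formula _ u (minor# cl Bx≈0) u<n
               (*-nonzero y≉0 (inv-nonzero (Clearing.pivot≉0 cl)))) ⟩
        (∑ᵛ (λ x → 𝟙 (Kernel? (tail U) x) * ψ ⟨ head U , x ⟩) + - R.1#) * (|K| ^ n * γ)
          ≈⟨ R.*-congʳ (R.+-congʳ (R.trans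
               (∑ᵛ-cong (suc n) λ x → R.trans
                 (𝟙*-cong (Kernel? (tail U) x) λ Bx≈0 → R.trans (ψ-cong (vanishes x Bx≈0)) ψ-0) (R.*-identityʳ _))
               (R.trans (#kernel-fromℕ (tail U)) (R.trans (R.reflexive (≡.cong (_· R.1#) #B)) (fromℕ-^ (suc (n ℕ.∸ u))))))) ⟩
        (|K| ^ suc (n ℕ.∸ u) + - R.1#) * (|K| ^ n * γ)
          ≈⟨ solve 5 (λ m a b c d → m :* (a :* ((b :* c) :* d)) := (b :* (a :* c)) :* (d :* m)) R.refl
               (|K| ^ suc (n ℕ.∸ u) + - R.1#) (|K| ^ n) ((- R.1#) ^ u) (|K| ^ (n C 2)) (∏ (n ℕ.∸ u)) ⟩
        (- R.1#) ^ u * (|K| ^ n * |K| ^ (n C 2)) * (∏ (n ℕ.∸ u) * (|K| ^ suc (n ℕ.∸ u) + - R.1#))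
          ≈⟨ R.*-cong (R.*-congˡ (C₂-suc n)) (∏-n∸u) ⟩
        (- R.1#) ^ u * |K| ^ (suc n C 2) * ∏ (suc n ℕ.∸ u) ∎
        where
        γ : A
        γ = (- R.1#) ^ u * |K| ^ (n C 2) * ∏ (n ℕ.∸ u)
        1+n∸u : suc n ℕ.∸ u ≡ suc (n ℕ.∸ u)
        1+n∸u = ℕ.+-∸-assoc 1 (ℕ.<⇒≤ u<n)
        ∏-n∸u : ∏ (n ℕ.∸ u) * (|K| ^ suc (n ℕ.∸ u) + - R.1#) ≈ ∏ (suc n ℕ.∸ u)
        ∏-n∸u rewrite 1+n∸u with n ℕ.∸ u | ℕ.m<n⇒0<n∸m u<n
        ... | suc d | _ = R.sym (∏-suc d)
        #B : Count.#kernel (tail U) ≡ q ℕ.^ suc (n ℕ.∸ u)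
        #B = ℕ.*-cancelʳ-≡ _ _ (q ℕ.^ u) {{ℕ.m^n≢0 q u}} (≡.trans
          (≡.cong (ℕ._* q ℕ.^ u) (≡.trans (≡.sym (Count.#kernel-vanishing (head U) (tail U) vanishes)) (Count.#kernel-η U)))
          (≡.trans #U (≡.trans (≡.cong (q ℕ.^_) (≡.cong suc (≡.sym (ℕ.m∸n+n≡m (ℕ.<⇒≤ u<n)))))
            (ℕ.^-distribˡ-+-* q (suc (n ℕ.∸ u)) u))))
        minor# : ∀ {x} (cl : Clearing x) → Kernel (tail U) x →
          Count.#kernel (clearedMinor (Clearing.operation cl) (tail U)) ℕ.* q ℕ.^ u ≡ q ℕ.^ n
        minor# cl Bx≈0 = ≡.trans (≡.cong (ℕ._* q ℕ.^ u) (#kernel-minor cl (tail U) Bx≈0 #B))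
          (≡.trans (≡.sym (ℕ.^-distribˡ-+-* q (n ℕ.∸ u) u)) (≡.cong (q ℕ.^_) (ℕ.m∸n+n≡m (ℕ.<⇒≤ u<n))))
    -- The kernel of `tail U` is a line on which `head U` vanishes, so `head U` cannot parametrise
    -- it.
    ... | inj₂ ≡.refl = corank-one
      where
      #B : Count.#kernel (tail U) ≡ q
      #B = ≡.trans (≡.sym (Count.#kernel-vanishing (head U) (tail U) vanishes)) (≡.trans (Count.#kernel-η U)
        (ℕ.*-cancelʳ-≡ _ _ (q ℕ.^ n) {{ℕ.m^n≢0 q n}} #U))
      corank-one : G (suc n) U y ≈ (- R.1#) ^ n * |K| ^ (suc n C 2) * ∏ (suc n ℕ.∸ n)
      corank-one with kernel-nonzero (tail U) (λ #≡1 → ℕ.<⇒≢ 1<q (≡.trans (≡.sym #≡1) #B))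
      ... | x₀ , Bx₀≈0 , x₀≉0 with nonzero-entry x₀ x₀≉0
      ... | i , x₀ᵢ≉0 with ⟨⟩-scalar-unit i 1#
      -- `w` is the coordinate form at a nonzero entry of `x₀`. It is a parameter on the line, and
      -- `w ∷ tail U` is a nonsingular substitute for `U` with the same minors.
      ... | w , w-unit = begin
        G (suc n) U y
          ≈⟨ G-via-form U w #≡1 y≉0 f
               (λ s≈t → R.*-congˡ (Kl-cong n (k.*-congˡ (inv-cong s≈t))))
               (λ {x} cl Bx≈0 x≉0 → R.trans
                 (R.*-cong (R.trans (ψ-cong (vanishes x Bx≈0)) ψ-0)
                   (R.*-congˡ (cleared-Kl (G-nonsingular n) w (tail U) #≡1 y≉0 cl Bx≈0 x≉0)))
                 (R.trans (R.*-identityˡ _) (R.sym (R.*-assoc _ _ _)))) ⟩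
        ∑ˣ f
          ≈⟨ *-∑ˣ _ _ ⟨
        (|K| ^ n * |K| ^ (n C 2)) * ∑ˣ (λ t → Kl n (y k.* D k.* inv t))
          ≈⟨ R.*-cong (C₂-suc n) (R.trans (∑ˣ-quotient (*-nonzero y≉0 (det-nonzero (suc n) (w ∷ tail U) #≡1)) (Kl n) (Kl-cong n)) (∑ˣ-Kl n)) ⟩
        |K| ^ (suc n C 2) * (- R.1#) ^ n
          ≈⟨ R.trans (R.*-comm _ _) (R.sym (R.*-identityʳ _)) ⟩
        (- R.1#) ^ n * |K| ^ (suc n C 2) * ∏ 1
          ≈⟨ R.*-congˡ (R.reflexive (≡.cong ∏ (≡.sym (ℕ.m+n∸n≡m 1 n)))) ⟩
        (- R.1#) ^ n * |K| ^ (suc n C 2) * ∏ (suc n ℕ.∸ n) ∎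
        where
        wx₀≉0 : ¬ ⟨ w , x₀ ⟩ ≈ᵏ 0#
        wx₀≉0 e = x₀ᵢ≉0 (k.trans (k.sym (k.trans (w-unit x₀) (k.*-identityˡ _))) e)
        #≡1 : Count.#kernel (w ∷ tail U) ≡ 1
        #≡1 = ℕ.*-cancelˡ-≡ _ _ q (≡.trans (≡.sym (#kernel-tail w x₀ (tail U) Bx₀≈0 wx₀≉0))
          (≡.trans #B (≡.sym (ℕ.*-identityʳ q))))
        D = det (w ∷ tail U)
        f : K → A
        f t = (|K| ^ n * |K| ^ (n C 2)) * Kl n (y k.* D k.* inv t)

    G-singular : ∀ n (U : Matrix n n) u → Count.#kernel U ℕ.* q ℕ.^ u ≡ q ℕ.^ n → u ℕ.< n → ∀ {y} → ¬ y ≈ᵏ 0# →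
      G n U y ≈ (- R.1#) ^ u * |K| ^ (n C 2) * ∏ (n ℕ.∸ u)
    G-singular (suc n) U u #U u<1+n = singular-step U u #U u<1+n (G-singular n)

-- Constructive reasoning about zero among the real numbers.

module RealZeros where

  open Real
  open Data.Rational.Solver.+-*-Solver using (solve; _:-_; _:+_; _:*_; :-_; _:=_)

  0ᴿ : ℝ
  0ᴿ = fromℚ 0ℚ

  AwayFromZero : ℝ → Set
  AwayFromZero x = ∃ λ δ → 0ℚ ℚ.< δ × ∃ λ N → ∀ n → N ℕ.≤ n → δ ℚ.≤ ∣ seq x n ∣

  SmallerThan : ℚ → ℝ → Set
  SmallerThan ε x = ∃ λ N → ∀ n → N ℕ.≤ n → ∣ seq x n ∣ ℚ.< ε

  <⇒≱ : ∀ {p q} → p ℚ.< q → ¬ q ℚ.≤ p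
  <⇒≱ p<q q≤p = ℚ.<-irrefl ≡.refl (ℚ.<-≤-trans p<q q≤p)

  -0ℚ : ∀ p → p ℚ.- 0ℚ ≡ p
  -0ℚ p = ℚ.+-identityʳ p

  ≈0⇒small : ∀ {x} → x ≈ 0ᴿ → ∀ ε → 0ℚ ℚ.< ε → SmallerThan ε x
  ≈0⇒small {x} (mk≈ null) ε ε>0 with null ε ε>0
  ... | N , small = N , λ n N≤n → ≡.subst (λ z → ∣ z ∣ ℚ.< ε) (-0ℚ (seq x n)) (small n N≤n)

  small⇒≈0 : ∀ {x} → (∀ ε → 0ℚ ℚ.< ε → SmallerThan ε x) → x ≈ 0ᴿ
  small⇒≈0 {x} small = mk≈ λ ε ε>0 → proj₁ (small ε ε>0) , λ n N≤n →
    ≡.subst (λ z → ∣ z ∣ ℚ.< ε) (≡.sym (-0ℚ (seq x n))) (proj₂ (small ε ε>0) n N≤n)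

  -- Replaces the undecidable question whether `x` is zero. One late rational term is compared with
  -- `ε / 2`, all later terms being within `ε / 4` of it: either they stay below `ε`, or they are at
  -- least `ε / 4` in absolute value. The alternatives overlap.
  small-or-away : ∀ x ε → 0ℚ ℚ.< ε → SmallerThan ε x ⊎ AwayFromZero x
  small-or-away x ε ε>0 = compare (∣ seq x N ∣ ℚ.<? η)
    where
    η δ : ℚ
    η = ε ℚ.* ½
    δ = η ℚ.* ½
    N : ℕ
    N = proj₁ (cauchy x δ (half>0 (half>0 ε>0)))
    close : ∀ m n → N ℕ.≤ m → N ℕ.≤ n → ∣ seq x m ℚ.- seq x n ∣ ℚ.< δ
    close = proj₂ (cauchy x δ (half>0 (half>0 ε>0)))
    open ℚ.≤-Reasoning
    split : ∀ a b → ∣ a ∣ ℚ.≤ ∣ a ℚ.- b ∣ ℚ.+ ∣ b ∣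
    split a b = begin
      ∣ a ∣                      ≡⟨ ≡.cong ∣_∣ (solve 2 (λ a b → a := (a :- b) :+ b) ≡.refl a b) ⟩
      ∣ (a ℚ.- b) ℚ.+ b ∣        ≤⟨ ℚ.∣p+q∣≤∣p∣+∣q∣ (a ℚ.- b) b ⟩
      ∣ a ℚ.- b ∣ ℚ.+ ∣ b ∣      ∎
    compare : Dec (∣ seq x N ∣ ℚ.< η) → SmallerThan ε x ⊎ AwayFromZero x
    compare (yes xN<η) = inj₁ (N , λ n N≤n → begin-strict
      ∣ seq x n ∣                                ≤⟨ split (seq x n) (seq x N) ⟩
      ∣ seq x n ℚ.- seq x N ∣ ℚ.+ ∣ seq x N ∣    <⟨ ℚ.+-mono-< (close n N N≤n ℕ.≤-refl) xN<η ⟩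
      δ ℚ.+ η                                    ≤⟨ ℚ.+-monoˡ-≤ η δ≤η ⟩
      η ℚ.+ η                                    ≡⟨ half+half ε ⟩
      ε                                          ∎)
      where
      δ≤η : δ ℚ.≤ η
      δ≤η = begin
        δ          ≡⟨ ℚ.+-identityʳ δ ⟨
        δ ℚ.+ 0ℚ   ≤⟨ ℚ.+-monoʳ-≤ δ (ℚ.<⇒≤ (half>0 (half>0 ε>0))) ⟩
        δ ℚ.+ δ    ≡⟨ half+half η ⟩
        η          ∎
    compare (no xN≮η) = inj₂ (δ , half>0 (half>0 ε>0) , N , λ n N≤n → ℚ.≮⇒≥ λ xn<δ → xN≮η (begin-strict
      ∣ seq x N ∣                                ≤⟨ split (seq x N) (seq x n) ⟩
      ∣ seq x N ℚ.- seq x n ∣ ℚ.+ ∣ seq x n ∣    <⟨ ℚ.+-mono-< (close N n ℕ.≤-refl N≤n) xn<δ ⟩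
      δ ℚ.+ δ                                    ≡⟨ half+half η ⟩
      η                                          ∎))

  away⇒≉0 : ∀ {x} → AwayFromZero x → ¬ x ≈ 0ᴿ
  away⇒≉0 (δ , δ>0 , N , away) x≈0 with ≈0⇒small x≈0 δ δ>0
  ... | M , small = <⇒≱ (small (N ℕ.⊔ M) (ℕ.m≤n⊔m N M)) (away (N ℕ.⊔ M) (ℕ.m≤m⊔n N M))

  -- For each `ε` the alternative "away from zero" refutes `x ≈ 0ᴿ`, hence contradicts the
  -- hypothesis, and smallness remains.
  ≈0-stable : ∀ {x} → ¬ ¬ x ≈ 0ᴿ → x ≈ 0ᴿ
  ≈0-stable {x} ¬¬x≈0 = small⇒≈0 λ ε ε>0 → decide (small-or-away x ε ε>0)
    where
    decide : ∀ {ε} → SmallerThan ε x ⊎ AwayFromZero x → SmallerThan ε x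
    decide (inj₁ small) = small
    decide (inj₂ away)  = contradiction (away⇒≉0 away) ¬¬x≈0

  away-cancelʳ : ∀ {x y} → x *ᴿ y ≈ 0ᴿ → AwayFromZero y → x ≈ 0ᴿ
  away-cancelʳ {x} {y} xy≈0 (δ , δ>0 , N , away) = small⇒≈0 small
    where
    instance
      δ-positive : ℚ.Positive δ
      δ-positive = ℚ.positive δ>0
    open ℚ.≤-Reasoning
    small : ∀ ε → 0ℚ ℚ.< ε → SmallerThan ε x
    small ε ε>0 with ≈0⇒small xy≈0 (ε ℚ.* δ) (ℚ.positive⁻¹ _ {{ℚ.pos*pos⇒pos ε {{ℚ.positive ε>0}} δ}})
    ... | M , small = N ℕ.⊔ M , λ n ≤n → ℚ.*-cancelʳ-<-nonNeg δ {{ℚ.pos⇒nonNeg δ}} (begin-strict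
      ∣ seq x n ∣ ℚ.* δ             ≤⟨ ℚ.*-monoˡ-≤-nonNeg ∣ seq x n ∣ {{ℚ.∣-∣-nonNeg (seq x n)}} (away n (ℕ.m⊔n≤o⇒m≤o N M ≤n)) ⟩
      ∣ seq x n ∣ ℚ.* ∣ seq y n ∣   ≡⟨ ℚ.∣p*q∣≡∣p∣*∣q∣ (seq x n) (seq y n) ⟨
      ∣ seq x n ℚ.* seq y n ∣       <⟨ small n (ℕ.m⊔n≤o⇒n≤o N M ≤n) ⟩
      ε ℚ.* δ                       ∎)

  -- That `x` is not zero gives no lower bound to divide by. Instead, if `y` were away from zero,
  -- division by `y` would force `x` to vanish.
  *-cancel-≉0 : ∀ {x y} → x *ᴿ y ≈ 0ᴿ → ¬ x ≈ 0ᴿ → y ≈ 0ᴿ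
  *-cancel-≉0 {x} {y} xy≈0 x≉0 = ≈0-stable λ y≉0 → y≉0 (small⇒≈0 λ ε ε>0 → decide (small-or-away y ε ε>0))
    where
    decide : ∀ {ε} → SmallerThan ε y ⊎ AwayFromZero y → SmallerThan ε y
    decide (inj₁ small) = small
    decide (inj₂ away)  = contradiction (away-cancelʳ xy≈0 away) x≉0

  -- An index with `ε ≤ ∣ x n ∣` makes the sum of squares at that same index at least `ε * ε`.
  +-squares≈0 : ∀ {x y} → x *ᴿ x +ᴿ y *ᴿ y ≈ 0ᴿ → x ≈ 0ᴿ
  +-squares≈0 {x} {y} x²+y²≈0 = small⇒≈0 small
    where
    open ℚ.≤-Reasoning
    square : ∀ p → p ℚ.* p ≡ ∣ p ∣ ℚ.* ∣ p ∣
    square p with ℚ.∣p∣≡p∨∣p∣≡-p p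
    ... | inj₁ ∣p∣≡p  = ≡.sym (≡.cong₂ ℚ._*_ ∣p∣≡p ∣p∣≡p)
    ... | inj₂ ∣p∣≡-p = ≡.trans (solve 1 (λ p → p :* p := (:- p) :* (:- p)) ≡.refl p)
      (≡.sym (≡.cong₂ ℚ._*_ ∣p∣≡-p ∣p∣≡-p))
    square≥0 : ∀ p → 0ℚ ℚ.≤ p ℚ.* p
    square≥0 p = ≡.subst (0ℚ ℚ.≤_) (≡.sym (square p)) (ℚ.nonNegative⁻¹ _
      {{ℚ.nonNeg*nonNeg⇒nonNeg (∣ p ∣) {{ℚ.∣-∣-nonNeg p}} (∣ p ∣) {{ℚ.∣-∣-nonNeg p}}}})
    small : ∀ ε → 0ℚ ℚ.< ε → SmallerThan ε x
    small ε ε>0 with ≈0⇒small x²+y²≈0 (ε ℚ.* ε) (ℚ.positive⁻¹ _ {{ℚ.pos*pos⇒pos ε {{ℚ.positive ε>0}} ε {{ℚ.positive ε>0}}}})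
    ... | N , bound = N , λ n N≤n → ℚ.≰⇒> λ ε≤∣x∣ → <⇒≱ (bound n N≤n) (begin
      ε ℚ.* ε                                              ≤⟨ ℚ.*-monoˡ-≤-nonNeg ε ε≤∣x∣ ⟩
      ε ℚ.* ∣ seq x n ∣                                    ≤⟨ ℚ.*-monoʳ-≤-nonNeg ∣ seq x n ∣ {{ℚ.∣-∣-nonNeg (seq x n)}} ε≤∣x∣ ⟩
      ∣ seq x n ∣ ℚ.* ∣ seq x n ∣                          ≡⟨ square (seq x n) ⟨
      seq x n ℚ.* seq x n                                  ≡⟨ ℚ.+-identityʳ _ ⟨
      seq x n ℚ.* seq x n ℚ.+ 0ℚ                           ≤⟨ ℚ.+-monoʳ-≤ (seq x n ℚ.* seq x n) (square≥0 (seq y n)) ⟩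
      seq x n ℚ.* seq x n ℚ.+ seq y n ℚ.* seq y n          ≡⟨ ℚ.0≤p⇒∣p∣≡p (ℚ.+-mono-≤ {0ℚ} {_} {0ℚ} (square≥0 (seq x n)) (square≥0 (seq y n))) ⟨
      ∣ seq x n ℚ.* seq x n ℚ.+ seq y n ℚ.* seq y n ∣      ∎)
      where
      instance
        ε-nonNegative : ℚ.NonNegative ε
        ε-nonNegative = ℚ.nonNegative (ℚ.<⇒≤ ε>0)

-- Products with the norm after adjoining a square root of -1.

module ComplexNorm {c ℓ} (R : CommutativeRing c ℓ) where

  open CommutativeRing R hiding (zero)
  open SemiringSolver commutativeSemiring using (solve; _:+_; _:*_; _:=_)
  open SetoidReasoning setoid

  -- Inserting a multiple of a vanishing term turns the identities below into semiring identities in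
  -- which a negated product is a single variable.
  +-0 : ∀ {x z} y → z ≈ 0# → x + y * z ≈ x
  +-0 y z≈0 = trans (+-congˡ (trans (*-congˡ z≈0) (zeroʳ y))) (+-identityʳ _)

  -- (a + bi)(c + di) = 0 multiplied by the conjugate a - bi.
  norm-*-re : ∀ a b c d → a * c + - (b * d) ≈ 0# → a * d + b * c ≈ 0# → (a * a + b * b) * c ≈ 0#
  norm-*-re a b c d re≈0 im≈0 = begin
    (a * a + b * b) * c
      ≈⟨ +-0 a (-‿inverseʳ (b * d)) ⟨
    (a * a + b * b) * c + a * (b * d + - (b * d))
      ≈⟨ solve 5 (λ a b c d m → (a :* a :+ b :* b) :* c :+ a :* (b :* d :+ m) :=
           a :* (a :* c :+ m) :+ b :* (a :* d :+ b :* c)) refl a b c d (- (b * d)) ⟩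
    a * (a * c + - (b * d)) + b * (a * d + b * c)
      ≈⟨ trans (+-0 b im≈0) (trans (*-congˡ re≈0) (zeroʳ a)) ⟩
    0# ∎

  norm-*-im : ∀ a b c d → a * c + - (b * d) ≈ 0# → a * d + b * c ≈ 0# → (a * a + b * b) * d ≈ 0#
  norm-*-im a b c d re≈0 im≈0 = begin
    (a * a + b * b) * d
      ≈⟨ +-0 b re≈0 ⟨
    (a * a + b * b) * d + b * (a * c + - (b * d))
      ≈⟨ solve 5 (λ a b c d m → (a :* a :+ b :* b) :* d :+ b :* (a :* c :+ m) :=
           a :* (a :* d :+ b :* c) :+ b :* (b :* d :+ m)) refl a b c d (- (b * d)) ⟩
    a * (a * d + b * c) + b * (b * d + - (b * d))
      ≈⟨ trans (+-0 b (-‿inverseʳ (b * d))) (trans (*-congˡ im≈0) (zeroʳ a)) ⟩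
    0# ∎

-- That a character is nontrivial is a negative statement, so its sum is shown to
-- vanish by way of the ¬¬-stability of equality with 0.
module ComplexZeros where

  open Real
  open RealZeros
  open ComplexNorm ℝ-ring
  module ℂᶜ = Complexification ℝ-ring
  open ℂᶜ using (_+i_)

  norm≉0 : ∀ a b → ¬ (a +i b) ℂᶜ.≈ (0ᴿ +i 0ᴿ) → ¬ a *ᴿ a +ᴿ b *ᴿ b ≈ 0ᴿ
  norm≉0 a b z≉0 N≈0 = z≉0 (ℂᶜ.mk≈ (+-squares≈0 {a} {b} N≈0)
    (+-squares≈0 {b} {a} (≈-trans {y = a *ᴿ a +ᴿ b *ᴿ b} (CommutativeRing.+-comm ℝ-ring (b *ᴿ b) (a *ᴿ a)) N≈0)))

  *-cancel-≉0ᶜ : ∀ z w → z ℂᶜ.*ᶜ w ℂᶜ.≈ (0ᴿ +i 0ᴿ) → ¬ z ℂᶜ.≈ (0ᴿ +i 0ᴿ) → w ℂᶜ.≈ (0ᴿ +i 0ᴿ)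
  *-cancel-≉0ᶜ (a +i b) (c +i d) (ℂᶜ.mk≈ re≈0 im≈0) z≉0 = ℂᶜ.mk≈
    (*-cancel-≉0 {a *ᴿ a +ᴿ b *ᴿ b} {c} (norm-*-re a b c d re≈0 im≈0) (norm≉0 a b z≉0))
    (*-cancel-≉0 {a *ᴿ a +ᴿ b *ᴿ b} {d} (norm-*-im a b c d re≈0 im≈0) (norm≉0 a b z≉0))

  ≈0-stableᶜ : ∀ z → ¬ ¬ z ℂᶜ.≈ (0ᴿ +i 0ᴿ) → z ℂᶜ.≈ (0ᴿ +i 0ᴿ)
  ≈0-stableᶜ z ¬¬z≈0 = ℂᶜ.mk≈ (≈0-stable λ re≉0 → ¬¬z≈0 λ z≈0 → re≉0 (ℂᶜ.re≈ z≈0))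
                              (≈0-stable λ im≉0 → ¬¬z≈0 λ z≈0 → im≉0 (ℂᶜ.im≈ z≈0))

-- The sum of a nontrivial additive character.

module _ {c ℓ q} (k : FiniteField c ℓ q) where

  open CharacterSums k
  private module k = FiniteField k
  open FiniteSums ℂ.commutativeSemiring
  open FiniteFieldSums k ℂ.commutativeSemiring
  open SetoidReasoning ℂ.setoid
  open ComplexZeros

  module _ (χ : AdditiveCharacter) where

    private module χ = GroupHomomorphism χ

    ∑-character-absorbs : ∀ a → χ ⟨ a ⟩ ℂ.* ∑ᵏ (χ ⟨_⟩) ℂ.≈ ∑ᵏ (χ ⟨_⟩)
    ∑-character-absorbs a = begin
      χ ⟨ a ⟩ ℂ.* ∑ᵏ (χ ⟨_⟩)
        ≈⟨ *-∑ (χ ⟨ a ⟩) (χ ⟨_⟩) k.elements ⟩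
      ∑ᵏ (λ t → χ ⟨ a ⟩ ℂ.* χ ⟨ t ⟩)
        ≈⟨ ∑ᵏ-cong (λ t → χ.homo a t) ⟨
      ∑ᵏ (λ t → χ ⟨ a k.+ t ⟩)
        ≈⟨ ∑-reindex fieldEnumeration fieldEnumeration (a k.+_) (k.- a k.+_)
             (λ s t s≈ → k.trans (k.+-congˡ s≈) (cancel a (k.- a) t (k.-‿inverseʳ a)))
             (λ s t ≈t → k.trans (k.sym (cancel (k.- a) a s (k.-‿inverseˡ a))) (k.+-congˡ ≈t))
             (χ ⟨_⟩) χ.⟦⟧-cong ⟩
      ∑ᵏ (χ ⟨_⟩) ∎
      where
      cancel : ∀ a b t → a k.+ b ≈ 0# → a k.+ (b k.+ t) ≈ t
      cancel a b t a+b≈0 = k.trans (k.sym (k.+-assoc a b t)) (k.trans (k.+-congʳ a+b≈0) (k.+-identityˡ t))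

    -- The usual choice of some `a` with `χ ⟨ a ⟩` different from 1 cannot be read off a negative
    -- hypothesis. If the sum were nonzero, it could be cancelled from its product with
    -- `χ ⟨ a ⟩ - 1` for every `a`, and `χ` would be trivial.
    ∑-character≈0 : Nontrivial χ → ∑ᵏ (χ ⟨_⟩) ℂ.≈ ℂ.0#
    ∑-character≈0 nontrivial = ≈0-stableᶜ S λ S≉0 → nontrivial λ a →
      GroupProperties.x∙y⁻¹≈ε⇒x≈y ℂ.+-group (χ ⟨ a ⟩) ℂ.1# (*-cancel-≉0ᶜ S (χ ⟨ a ⟩ ℂ.- ℂ.1#) (annihilates a) S≉0)
      where
      S = ∑ᵏ (χ ⟨_⟩)
      annihilates : ∀ a → S ℂ.* (χ ⟨ a ⟩ ℂ.- ℂ.1#) ℂ.≈ ℂ.0#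
      annihilates a = begin
        S ℂ.* (χ ⟨ a ⟩ ℂ.- ℂ.1#)                 ≈⟨ RingProperties.x[y-z]≈xy-xz ℂ.ring S (χ ⟨ a ⟩) ℂ.1# ⟩
        S ℂ.* χ ⟨ a ⟩ ℂ.- S ℂ.* ℂ.1#             ≈⟨ ℂ.+-cong (ℂ.trans (ℂ.*-comm S (χ ⟨ a ⟩)) (∑-character-absorbs a)) (ℂ.-‿cong (ℂ.*-identityʳ S)) ⟩
        S ℂ.- S                                  ≈⟨ ℂ.-‿inverseʳ S ⟩
        ℂ.0#                                     ∎

-- From weighted sums with parameter `y = 1` to the sums over `SL` and the Kloosterman sums.

theorem2p4 : ∀ {c ℓ} (q : ℕ) → IsPrimePower q → (k : FiniteField c ℓ q) →
    let open CharacterSums k in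
    (n : ℕ) → 1 ≤ n →
    (χ : AdditiveCharacter) → Nontrivial χ →
    (U : Matrix n n) → ¬ (∀ i j → U i j ≈ 0#) →
    (u : ℕ) → HasRank U u →
    (u ≡ n →
    G-SL n U χ ℂ.≈ ℂ.fromℕ q ℂ.^ (n C 2) ℂ.* Kloosterman n χ (det U))
    ×
    (u < n →
    G-SL n U χ ℂ.≈
    (ℂ.- ℂ.1#) ℂ.^ u ℂ.* ℂ.fromℕ q ℂ.^ (n C 2)
    ℂ.* ℂ.∏[ 2 ⋯ n ∸ u ] (λ i → ℂ.fromℕ q ℂ.^ i ℂ.- ℂ.1#))
theorem2p4 q _ k n _ χ nontrivial U _ u U-rank = nonsingular , singular
  where
  open CharacterSums k
  module k = FiniteField k
  module χ = GroupHomomorphism χ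
  open FiniteSums ℂ.commutativeSemiring
  open FiniteFieldSums k ℂ.commutativeSemiring using (|K|)
  open KernelSize k using (HasRank⇒#kernel)
  open NonsingularMatrices k using (q-nonZero)
  open GaussSumEvaluation k ℂ-ring using (|K|≈q; module Evaluation)
  open Evaluation (χ ⟨_⟩) χ.⟦⟧-cong χ.homo χ.ε-homo (∑-character≈0 k χ nontrivial)
  open GaussSums.Character k ℂ-ring (χ ⟨_⟩) χ.⟦⟧-cong χ.homo χ.ε-homo (∑-character≈0 k χ nontrivial) using (G)
  open FiniteFieldSums k ℕ.+-*-commutativeSemiring using (#kernel)
  open SemiringExp ℂ.semiring using (^-congˡ)
  open Algebra.Definitions.RawSemiring (Semiring.rawSemiring k.semiring) using (sum; product)
  open SetoidReasoning ℂ.setoid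

  G-SL≈G : G-SL n U χ ℂ.≈ G n U k.1#
  G-SL≈G = ∑-filter (λ X → det X k.≟ k.1#) (λ X → χ ⟨ U ∙ X ⟩) (tuples (tuples k.elements n) n)

  #U : #kernel U ℕ.* q ℕ.^ u ≡ q ℕ.^ n
  #U = HasRank⇒#kernel U u U-rank

  1≉0 : ¬ k.1# ≈ 0#
  1≉0 = k.0≉1 ∘ k.sym

  nonsingular : u ≡ n → G-SL n U χ ℂ.≈ ℂ.fromℕ q ℂ.^ (n C 2) ℂ.* Kloosterman n χ (det U)
  nonsingular ≡.refl = begin
    G-SL n U χ
      ≈⟨ G-SL≈G ⟩
    G n U k.1#
      ≈⟨ G-nonsingular n U #U≡1 1≉0 ⟩
    |K| ℂ.^ (n C 2) ℂ.* Kl n (k.1# k.* det U)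
      ≈⟨ ℂ.*-cong (^-congˡ (n C 2) |K|≈q) (Kl-cong n (k.*-identityˡ (det U))) ⟩
    ℂ.fromℕ q ℂ.^ (n C 2) ℂ.* Kl n (det U)
      ≈⟨ ℂ.*-congˡ (∑-filter (λ x → product x k.≟ det U) (λ x → χ ⟨ sum x ⟩) (tuples k.elements n)) ⟨
    ℂ.fromℕ q ℂ.^ (n C 2) ℂ.* Kloosterman n χ (det U) ∎
    where
    #U≡1 : #kernel U ≡ 1
    #U≡1 = ℕ.*-cancelʳ-≡ _ 1 (q ℕ.^ n) {{ℕ.m^n≢0 q n}} (≡.trans #U (≡.sym (ℕ.*-identityˡ _)))

  singular : u < n → G-SL n U χ ℂ.≈
    (ℂ.- ℂ.1#) ℂ.^ u ℂ.* ℂ.fromℕ q ℂ.^ (n C 2) ℂ.* ℂ.∏[ 2 ⋯ n ∸ u ] (λ i → ℂ.fromℕ q ℂ.^ i ℂ.- ℂ.1#)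
  singular u<n = begin
    G-SL n U χ
      ≈⟨ G-SL≈G ⟩
    G n U k.1#
      ≈⟨ G-singular n U u #U u<n 1≉0 ⟩
    (ℂ.- ℂ.1#) ℂ.^ u ℂ.* |K| ℂ.^ (n C 2) ℂ.* ∏ (n ∸ u)
      ≈⟨ ℂ.*-cong (ℂ.*-congˡ (^-congˡ (n C 2) |K|≈q))
           (MonoidSum.sum-cong-≋ ℂ.*-monoid {suc (n ∸ u) ∸ 2} λ i → ℂ.+-congʳ (^-congˡ (2 ℕ.+ toℕ i) |K|≈q)) ⟩
    (ℂ.- ℂ.1#) ℂ.^ u ℂ.* ℂ.fromℕ q ℂ.^ (n C 2) ℂ.* ℂ.∏[ 2 ⋯ n ∸ u ] (λ i → ℂ.fromℕ q ℂ.^ i ℂ.- ℂ.1#) ∎
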